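{- There exists an absolute constant $C>0$ such that the following holds. Let $\varepsilon\in(0,1/4)$, let $t\geq 1$ be an integer, and let $n\geq 2^{t\cdot 2^{C(\log(1/\varepsilon))^8}}$. Let $G$ be a $2$-edge-coloured (red/blue) complete graph $K_n$ which is locally $(1/4+\varepsilon)$-balanced. Then $G$ contains two disjoint vertex sets $A,B$ with $|A|=|B|=t$ such that, for some colour $c\in\{\text{red},\text{blue}\}$, all edges inside $A$ and all edges inside $B$ have colour $c$ and all edges between $A$ and $B$ have the other colour. (Equivalently, $G$ contains a complete subgraph on $2t$ vertices in which one colour class forms exactly a $K_{t,t}$.)
   Context: A $2$-edge-coloured $K_n$ is called locally $\gamma$-balanced if every vertex is incident to at least $\gamma n$ red edges and at least $\gamma n$ blue edges. -}

module Defs where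

open import Data.Empty using (⊥; ⊥-elim)
open import Data.Fin using (Fin)
open import Data.Fin.Properties using (nonZeroIndex)
import Data.Fin.Properties as Fin
open import Data.Fin.Subset using (Subset; _∈_; ∣_∣)
open import Data.Integer using (+_; +[1+_])
import Data.Integer as ℤ
import Data.Integer.Properties as ℤ
open import Data.List using (length; filter; allFin)
open import Data.Nat using (ℕ; zero; suc)
import Data.Nat as ℕ
import Data.Nat.Properties as ℕ
open import Data.Product using (∃-syntax; ∃₂; _×_; _,_)
open import Data.Rational
open import Data.Rational.Properties
open import Data.Rational.Unnormalised using (mkℚᵘ)
import Data.Rational.Unnormalised as ℚᵘ
import Data.Rational.Unnormalised.Properties as ℚᵘ
open import Data.Rational.Solver using (module +-*-Solver)
open import Data.Sum using (_⊎_; inj₁; inj₂)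
open import Algebra.Bundles using (CommutativeRing)
open import Algebra.Properties.CommutativeSemiring.Exp
  (CommutativeRing.commutativeSemiring +-*-commutativeRing)
  using (_^_; ^-assocʳ; ^-distrib-*)
open import Relation.Binary.PropositionalEquality
  using (_≡_; _≢_; refl; sym; trans; cong; cong₂; subst; subst₂)
open import Relation.Binary.Definitions using (DecidableEquality; tri<; tri≈; tri>)
open import Relation.Nullary using (¬_; yes; no; ¬?; _×-dec_)

2ℚ : ℚ
2ℚ = + 2 / 1

module RationalLemmas where
  0<⇒nonNeg : ∀ {p} → 0ℚ < p → NonNegative p
  0<⇒nonNeg {p} 0<p = pos⇒nonNeg p {{positive 0<p}}

  *-mono-≤ : ∀ {p q r s} → 0ℚ < p → 0ℚ < r → p ≤ q → r ≤ s → p * r ≤ q * s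
  *-mono-≤ {p} {q} {r} {s} 0<p 0<r p≤q r≤s =
    ≤-trans (*-monoʳ-≤-nonNeg r {{0<⇒nonNeg 0<r}} p≤q)
            (*-monoˡ-≤-nonNeg q {{0<⇒nonNeg (<-≤-trans 0<p p≤q)}} r≤s)

  *-pos : ∀ {p q} → 0ℚ < p → 0ℚ < q → 0ℚ < p * q
  *-pos {p} {q} 0<p 0<q =
    positive⁻¹ (p * q) {{pos*pos⇒pos p {{positive 0<p}} q {{positive 0<q}}}}

  0<1 : 0ℚ < 1ℚ
  0<1 = positive⁻¹ 1ℚ

  0<2 : 0ℚ < 2ℚ
  0<2 = positive⁻¹ 2ℚ

  1<2 : 1ℚ < 2ℚ
  1<2 = *<* (ℤ.+<+ (ℕ.s≤s (ℕ.s≤s ℕ.z≤n)))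

  2ℚ*p : ∀ p → 2ℚ * p ≡ p + p
  2ℚ*p p = trans (*-distribʳ-+ p 1ℚ 1ℚ) (cong₂ _+_ (*-identityˡ p) (*-identityˡ p))

  -- Opaque so that `with` never tries to evaluate these witnesses.
  opaque
    dense : ∀ {p q} → p < q → ∃[ m ] (p < m × m < q)
    dense = <-dense

  opaque
    <⊎≥ : ∀ p q → p < q ⊎ q ≤ p
    <⊎≥ p q with <-cmp p q
    ... | tri< p<q _ _ = inj₁ p<q
    ... | tri≈ _ p≡q _ = inj₂ (≤-reflexive (sym p≡q))
    ... | tri> _ _ q<p = inj₂ (<⇒≤ q<p)

  p<p*ρ : ∀ {p ρ} → 0ℚ < p → 1ℚ < ρ → p < p * ρ
  p<p*ρ {p} {ρ} 0<p 1<ρ =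
    subst (_< p * ρ) (*-identityʳ p) (*-monoʳ-<-pos p {{positive 0<p}} 1<ρ)

  opaque
    ratio : ∀ {q r} → 0ℚ < q → q < r → ∃[ ρ ] (1ℚ < ρ × q * ρ ≡ r)
    ratio {q} {r} 0<q q<r = ρ , 1<ρ , qρ≡r
      where
      instance
        q>0 : Positive q
        q>0 = positive 0<q
        q≢0 : NonZero q
        q≢0 = pos⇒nonZero q
      ρ : ℚ
      ρ = 1/ q * r
      qρ≡r : q * ρ ≡ r
      qρ≡r = trans (sym (*-assoc q (1/ q) r))
               (trans (cong (_* r) (*-inverseʳ q)) (*-identityˡ r))
      1<ρ : 1ℚ < ρ
      1<ρ = *-cancelˡ-<-nonNeg q {{pos⇒nonNeg q}}
              (subst (_< q * ρ) (sym (*-identityʳ q)) (subst (q <_) (sym qρ≡r) q<r))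

  opaque
    ratio⁻ : ∀ {δ} → 0ℚ < δ → ∀ M → ∃[ v ] v * δ ≡ M
    ratio⁻ {δ} 0<δ M = M * 1/ δ ,
      trans (*-assoc M (1/ δ) δ) (trans (cong (M *_) (*-inverseˡ δ)) (*-identityʳ M))
      where
      instance
        δ≢0 : NonZero δ
        δ≢0 = pos⇒nonZero δ {{positive 0<δ}}

  -- σ is the smaller of m and ρ/m, where 1 < m < ρ
  opaque
    root : ∀ {ρ} → 1ℚ < ρ → ∃[ σ ] (1ℚ < σ × σ * σ ≤ ρ)
    root {ρ} 1<ρ with dense 1<ρ
    ... | m , 1<m , m<ρ with ratio (<-trans 0<1 1<m) m<ρ
    ... | m' , 1<m' , mm'≡ρ with ≤-total m m'
    ... | inj₁ m≤m' = m , 1<m ,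
          subst (m * m ≤_) mm'≡ρ
            (*-mono-≤ (<-trans 0<1 1<m) (<-trans 0<1 1<m) ≤-refl m≤m')
    ... | inj₂ m'≤m = m' , 1<m' ,
          subst (m' * m' ≤_) mm'≡ρ
            (*-mono-≤ (<-trans 0<1 1<m') (<-trans 0<1 1<m') m'≤m ≤-refl)

  ^-pos : ∀ {p} → 0ℚ < p → ∀ n → 0ℚ < p ^ n
  ^-pos 0<p zero    = 0<1
  ^-pos 0<p (suc n) = *-pos 0<p (^-pos 0<p n)

  ^-monoˡ-≤ : ∀ {p q} → 0ℚ < p → p ≤ q → ∀ n → p ^ n ≤ q ^ n
  ^-monoˡ-≤ 0<p p≤q zero    = ≤-refl
  ^-monoˡ-≤ 0<p p≤q (suc n) = *-mono-≤ 0<p (^-pos 0<p n) p≤q (^-monoˡ-≤ 0<p p≤q n)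

  ^-monoˡ-< : ∀ {p q} → 0ℚ < p → p < q → ∀ n → p ^ suc n < q ^ suc n
  ^-monoˡ-< {p} {q} 0<p p<q n =
    <-≤-trans (*-monoˡ-<-pos (p ^ n) {{positive (^-pos 0<p n)}} p<q)
              (*-monoˡ-≤-nonNeg q {{0<⇒nonNeg (<-trans 0<p p<q)}} (^-monoˡ-≤ 0<p (<⇒≤ p<q) n))

  1≤^ : ∀ {ρ} → 1ℚ < ρ → ∀ n → 1ℚ ≤ ρ ^ n
  1≤^ 1<ρ zero    = ≤-refl
  1≤^ {ρ} 1<ρ (suc n) = ≤-trans (1≤^ 1<ρ n)
    (subst (_≤ ρ ^ suc n) (*-identityˡ (ρ ^ n))
      (*-mono-≤ 0<1 (^-pos (<-trans 0<1 1<ρ) n) (<⇒≤ 1<ρ) ≤-refl))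

  ^-monoʳ-≤ : ∀ {ρ} → 1ℚ < ρ → ∀ {m n} → m ℕ.≤ n → ρ ^ m ≤ ρ ^ n
  ^-monoʳ-≤ 1<ρ {n = n} ℕ.z≤n = 1≤^ 1<ρ n
  ^-monoʳ-≤ 1<ρ {suc m} (ℕ.s≤s m≤n) =
    *-mono-≤ (<-trans 0<1 1<ρ) (^-pos (<-trans 0<1 1<ρ) m) ≤-refl (^-monoʳ-≤ 1<ρ m≤n)

  ^-step : ∀ {ρ} → 1ℚ < ρ → ∀ n → ρ ^ n < ρ ^ suc n
  ^-step {ρ} 1<ρ n =
    subst (ρ ^ n <_) (*-comm (ρ ^ n) ρ) (p<p*ρ (^-pos (<-trans 0<1 1<ρ) n) 1<ρ)

  ^-monoʳ-< : ∀ {ρ} → 1ℚ < ρ → ∀ {m n} → m ℕ.< n → ρ ^ m < ρ ^ n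
  ^-monoʳ-< 1<ρ {m} m<n = <-≤-trans (^-step 1<ρ m) (^-monoʳ-≤ 1<ρ m<n)

  ^-swap : ∀ p m n → (p ^ m) ^ n ≡ (p ^ n) ^ m
  ^-swap p m n = trans (^-assocʳ p m n)
    (trans (cong (p ^_) (ℕ.*-comm m n)) (sym (^-assocʳ p n m)))

  /≃ : ∀ a b → toℚᵘ (+ a / suc b) ℚᵘ.≃ mkℚᵘ (+ a) b
  /≃ a b = toℚᵘ-fromℚᵘ (mkℚᵘ (+ a) b)

  /-<⇒ : ∀ {a b c d} → + a / suc b < + c / suc d → a ℕ.* suc d ℕ.< c ℕ.* suc b
  /-<⇒ {a} {b} {c} {d} lt = ℤ.drop‿+<+
    (subst₂ ℤ._<_ (sym (ℤ.pos-* a (suc d))) (sym (ℤ.pos-* c (suc b))) (ℚᵘ.drop-*<* lt'))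
    where
    lt' : mkℚᵘ (+ a) b ℚᵘ.< mkℚᵘ (+ c) d
    lt' = ℚᵘ.<-respˡ-≃ (/≃ a b) (ℚᵘ.<-respʳ-≃ (/≃ c d) (toℚᵘ-mono-< lt))

  /-<⇐ : ∀ {a b c d} → a ℕ.* suc d ℕ.< c ℕ.* suc b → + a / suc b < + c / suc d
  /-<⇐ {a} {b} {c} {d} lt = toℚᵘ-cancel-<
    (ℚᵘ.<-respˡ-≃ (ℚᵘ.≃-sym (/≃ a b)) (ℚᵘ.<-respʳ-≃ (ℚᵘ.≃-sym (/≃ c d))
      (ℚᵘ.*<* (subst₂ ℤ._<_ (ℤ.pos-* a (suc d)) (ℤ.pos-* c (suc b)) (ℤ.+<+ lt)))))

  /-step : ∀ a b → + a / suc b < + suc a / suc b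
  /-step a b = /-<⇐ {a} {b} {suc a} {b} (ℕ.*-monoˡ-< (suc b) (ℕ.n<1+n a))

  -- Over the product of the denominators of q and r.
  opaque
    grid : ∀ {q r} → 0ℚ < q → q < r →
           ∃₂ λ a k → q ≤ + a / suc k × + suc a / suc k ≤ r
    grid {q} {r} 0<q q<r =
      go q r (positive 0<q) (positive (<-trans 0<q q<r)) (↥p/↧p≡p q) (↥p/↧p≡p r) q<r
      where
      go : ∀ q r → Positive q → Positive r → ↥ q / ↧ₙ q ≡ q → ↥ r / ↧ₙ r ≡ r → q < r →
           ∃₂ λ a k → q ≤ + a / suc k × + suc a / suc k ≤ r
      go (mkℚ +[1+ m ] d cq) (mkℚ +[1+ n ] e cr) _ _ q≡ r≡ q<r =
        a , k , ≮⇒≥ q≮ , ≮⇒≥ r≮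
        where
        a k : ℕ
        a = suc m ℕ.* suc e
        k = e ℕ.+ d ℕ.* suc e
        open ℕ.≤-Reasoning
        cross : suc m ℕ.* suc e ℕ.< suc n ℕ.* suc d
        cross = /-<⇒ {suc m} {d} {suc n} {e}
          (<-respˡ-≡ (sym q≡) (<-respʳ-≡ (sym r≡) q<r))
        q≮ : ¬ (+ a / suc k < mkℚ +[1+ m ] d cq)
        q≮ lt = ℕ.<-irrefl eq (/-<⇒ {a} {k} {suc m} {d} (<-respʳ-≡ (sym q≡) lt))
          where
          eq : a ℕ.* suc d ≡ suc m ℕ.* suc k
          eq = trans (ℕ.*-assoc (suc m) (suc e) (suc d))
                     (cong (suc m ℕ.*_) (ℕ.*-comm (suc e) (suc d)))
        r≮ : ¬ (mkℚ +[1+ n ] e cr < + suc a / suc k)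
        r≮ lt = ℕ.<⇒≱ (/-<⇒ {suc n} {e} {suc a} {k} (<-respˡ-≡ (sym r≡) lt)) (begin
          suc a ℕ.* suc e                   ≤⟨ ℕ.*-monoˡ-≤ (suc e) cross ⟩
          suc n ℕ.* suc d ℕ.* suc e         ≡⟨ ℕ.*-assoc (suc n) (suc d) (suc e) ⟩
          suc n ℕ.* (suc d ℕ.* suc e)       ∎)

  opaque
    ∃ℕ> : ∀ p → ∃[ n ] p < + n / 1
    ∃ℕ> p@(mkℚ (ℤ.-[1+ m ]) d _) = 1 , neg<pos p 1ℚ
    ∃ℕ> p@(mkℚ (+ m) d _) = suc m , <-respˡ-≡ (↥p/↧p≡p p)
      (/-<⇐ {m} {d} {suc m} {0}
        (subst (ℕ._< suc m ℕ.* suc d) (sym (ℕ.*-identityʳ m)) (ℕ.m≤m*n (suc m) (suc d))))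

  suc/1 : ∀ n → + suc n / 1 ≡ 1ℚ + + n / 1
  suc/1 n = toℚᵘ-injective (ℚᵘ.≃-trans (/≃ (suc n) 0) (ℚᵘ.≃-sym
    (ℚᵘ.≃-trans (toℚᵘ-homo-+ 1ℚ (+ n / 1))
      (ℚᵘ.≃-trans (ℚᵘ.+-congʳ (toℚᵘ 1ℚ) (/≃ n 0))
        (ℚᵘ.≃-reflexive (cong (λ i → mkℚᵘ i 0) (cong (λ j → (+ 1) ℤ.+ j) (ℤ.*-identityʳ (+ n)))))))))

  bernoulli : ∀ {δ} → 0ℚ < δ → ∀ n → + n / 1 * δ ≤ (1ℚ + δ) ^ n
  bernoulli {δ} 0<δ zero    = subst (_≤ 1ℚ) (sym (*-zeroˡ δ)) (<⇒≤ 0<1)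
  bernoulli {δ} 0<δ (suc n) = begin
    + suc n / 1 * δ          ≡⟨ cong (_* δ) (suc/1 n) ⟩
    (1ℚ + + n / 1) * δ       ≡⟨ *-distribʳ-+ δ 1ℚ (+ n / 1) ⟩
    1ℚ * δ + + n / 1 * δ     ≤⟨ +-mono-≤ (*-mono-≤ 0<1 0<δ (1≤^ 1<1+δ n) ≤-refl)
                                          (bernoulli 0<δ n) ⟩
    P * δ + P                ≡⟨ +-*-Solver.solve 2 (λ P δ → P :* δ :+ P := (con 1ℚ :+ δ) :* P)
                                  refl P δ ⟩
    (1ℚ + δ) * P             ∎
    where
    open ≤-Reasoning
    open +-*-Solver using (_:*_; _:+_; _:=_; con)
    P = (1ℚ + δ) ^ n
    1<1+δ : 1ℚ < 1ℚ + δ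
    1<1+δ = subst (_< 1ℚ + δ) (+-identityʳ 1ℚ) (+-monoʳ-< 1ℚ 0<δ)

  opaque
    ∃ℕ*> : ∀ {δ} → 0ℚ < δ → ∀ M → ∃[ n ] M < + n / 1 * δ
    ∃ℕ*> {δ} 0<δ M with ratio⁻ 0<δ M
    ... | v , vδ≡M with ∃ℕ> v
    ... | n , v<n = n , subst (_< + n / 1 * δ) vδ≡M (*-monoˡ-<-pos δ {{positive 0<δ}} v<n)

  opaque
    archimedes : ∀ {ρ} → 1ℚ < ρ → ∀ M → ∃[ n ] M < ρ ^ n
    archimedes {ρ} 1<ρ M = go (ρ - 1ℚ) 0<δ 1+δ≡ρ
      where
      0<δ : 0ℚ < ρ - 1ℚ
      0<δ = subst (_< ρ - 1ℚ) (+-inverseʳ 1ℚ) (+-monoˡ-< (- 1ℚ) 1<ρ)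
      1+δ≡ρ : 1ℚ + (ρ - 1ℚ) ≡ ρ
      1+δ≡ρ = trans (+-comm 1ℚ (ρ - 1ℚ)) (trans (+-assoc ρ (- 1ℚ) 1ℚ)
                (trans (cong (λ z → ρ + z) (+-inverseˡ 1ℚ)) (+-identityʳ ρ)))
      go : ∀ δ → 0ℚ < δ → 1ℚ + δ ≡ ρ → ∃[ n ] M < ρ ^ n
      go δ 0<δ refl with ∃ℕ*> 0<δ M
      ... | n , M<nδ = n , <-≤-trans M<nδ (bernoulli 0<δ n)

  opaque
    archimedes⁺ : ∀ {ρ} → 1ℚ < ρ → ∀ M → ∃[ n ] M < ρ ^ suc n
    archimedes⁺ 1<ρ M with archimedes 1<ρ M
    ... | n , M<ρⁿ = n , <-trans M<ρⁿ (^-step 1<ρ n)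

  opaque
    rootⁿ : ∀ {ρ} → 1ℚ < ρ → ∀ n → ∃[ σ ] (1ℚ < σ × σ ^ n ≤ ρ)
    rootⁿ {ρ} 1<ρ zero = ρ , 1<ρ , <⇒≤ 1<ρ
    rootⁿ {ρ} 1<ρ (suc n) with root 1<ρ
    ... | τ , 1<τ , ττ≤ρ with rootⁿ 1<τ n
    ... | σ , 1<σ , σⁿ≤τ = choose (≤-total σ τ)
      where
      shrink : ∀ {p} → 1ℚ < p → p ≤ τ → p ^ n ≤ τ → p ^ suc n ≤ ρ
      shrink {p} 1<p p≤τ pⁿ≤τ =
        ≤-trans (*-mono-≤ {p} {τ} {p ^ n} {τ} (<-trans 0<1 1<p) (^-pos (<-trans 0<1 1<p) n) p≤τ pⁿ≤τ)
                ττ≤ρ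
      choose : σ ≤ τ ⊎ τ ≤ σ → ∃[ σ ] (1ℚ < σ × σ ^ suc n ≤ ρ)
      choose (inj₁ σ≤τ) = σ , 1<σ , shrink 1<σ σ≤τ σⁿ≤τ
      choose (inj₂ τ≤σ) = τ , 1<τ ,
        shrink 1<τ ≤-refl (≤-trans (^-monoˡ-≤ (<-trans 0<1 1<τ) τ≤σ n) σⁿ≤τ)

open RationalLemmas

-- Positive real numbers, as two-sided located Dedekind cuts in ℚ
-- whose lower part contains 0.
-- `Lower x q` reads q < x and `Upper x q` reads x < q.

record ℝ⁺ : Set₁ where
  field
    Lower Upper  : ℚ → Set
    0-lower      : Lower 0ℚ
    bounded      : ∃[ q ] Upper q
    lower-closed : ∀ {q r} → q < r → Lower r → Lower q
    lower-open   : ∀ {q} → Lower q → ∃[ r ] (q < r × Lower r)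
    upper-closed : ∀ {q r} → q < r → Upper q → Upper r
    upper-open   : ∀ {r} → Upper r → ∃[ q ] (q < r × Upper q)
    disjoint     : ∀ {q} → Lower q → Upper q → ⊥
    located      : ∀ {q r} → q < r → Lower q ⊎ Upper r

open ℝ⁺ using (Lower; Upper)

-- The real number determined by a set of rational lower bounds and a set of
-- rational upper bounds that are separated and come arbitrarily close.
record Bounds : Set₁ where
  field
    Below Above : ℚ → Set
    below⁺      : ∃[ q ] (0ℚ < q × Below q)
    above       : ∃[ r ] Above r
    separated   : ∀ {q r} → Below q → Above r → q ≤ r
    close       : ∀ {q r} → 0ℚ < q → q < r → Below q ⊎ Above r

  real : ℝ⁺
  real = record
    { Lower        = λ q → ∃[ p ] (q < p × Below p)
    ; Upper        = λ r → ∃[ p ] (p < r × Above p)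
    ; 0-lower      = below⁺
    ; bounded      = let r , ar = above ; n , r<n = ∃ℕ> r in _ , r , r<n , ar
    ; lower-closed = λ { q<r (p , r<p , b) → p , <-trans q<r r<p , b }
    ; lower-open   = λ { (p , q<p , b) →
                         let m , q<m , m<p = dense q<p in m , q<m , p , m<p , b }
    ; upper-closed = λ { q<r (p , p<q , a) → p , <-trans p<q q<r , a }
    ; upper-open   = λ { (p , p<r , a) →
                         let m , p<m , m<r = dense p<r in m , m<r , p , p<m , a }
    ; disjoint     = λ { (p , q<p , b) (p' , p'<q , a) →
                         <-irrefl refl (<-≤-trans (<-trans p'<q q<p) (separated b a)) }
    ; located      = λ {q} {r} → loc {q} {r}
    }
    where
    loc : ∀ {q r} → q < r → (∃[ p ] (q < p × Below p)) ⊎ (∃[ p ] (p < r × Above p))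
    loc {q} {r} q<r with <⊎≥ 0ℚ q
    ... | inj₂ q≤0 = let p , 0<p , b = below⁺ in inj₁ (p , ≤-<-trans q≤0 0<p , b)
    ... | inj₁ 0<q with dense q<r
    ... | m , q<m , m<r with dense m<r
    ... | m' , m<m' , m'<r with close (<-trans 0<q q<m) m<m'
    ... | inj₁ b = inj₁ (m , q<m , b)
    ... | inj₂ a = inj₂ (m' , m'<r , a)

open Bounds using (real)

infix 4 _<ʳ_ _≤ᴺ_

_<ʳ_ : ℝ⁺ → ℝ⁺ → Set
x <ʳ y = ∃[ q ] (Upper x q × Lower y q)

-- The right-hand side may be 0, which is not an element of ℝ⁺.
_≤ᴺ_ : ℝ⁺ → ℕ → Set
x ≤ᴺ n = ∀ q → Lower x q → q ≤ + n / 1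

fromℚ : (q : ℚ) → .{{Positive q}} → ℝ⁺
fromℚ q = record
  { Lower        = _< q
  ; Upper        = q <_
  ; 0-lower      = positive⁻¹ q
  ; bounded      = let n , q<n = ∃ℕ> q in _ , q<n
  ; lower-closed = <-trans
  ; lower-open   = λ p<q → let m , p<m , m<q = dense p<q in m , p<m , m<q
  ; upper-closed = λ p<r q<p → <-trans q<p p<r
  ; upper-open   = λ q<r → let m , q<m , m<r = dense q<r in m , m<r , q<m
  ; disjoint     = <-asym
  ; located      = λ {p} {r} p<r → loc {p} {r} p<r
  }
  where
  loc : ∀ {p r} → p < r → p < q ⊎ q < r
  loc {p} p<r with <⊎≥ p q
  ... | inj₁ p<q = inj₁ p<q
  ... | inj₂ q≤p = inj₂ (≤-<-trans q≤p p<r)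

fromℕ : (n : ℕ) → .{{ℕ.NonZero n}} → ℝ⁺
fromℕ n = fromℚ (+ n / 1) {{normalize-pos n 1}}

1ʳ ¼ : ℝ⁺
1ʳ = fromℚ 1ℚ
¼  = fromℚ (+ 1 / 4)

module CutLemmas where
  upper-≤ : ∀ x {q r} → q ≤ r → Upper x q → Upper x r
  upper-≤ x {q} {r} q≤r u with ℝ⁺.upper-open x u
  ... | p , p<q , u' = ℝ⁺.upper-closed x (<-≤-trans p<q q≤r) u'

  lower<upper : ∀ x {q r} → Lower x q → Upper x r → q < r
  lower<upper x {q} {r} l u with <⊎≥ q r
  ... | inj₁ q<r = q<r
  ... | inj₂ r≤q = ⊥-elim (ℝ⁺.disjoint x l (upper-≤ x r≤q u))

  0<upper : ∀ x {r} → Upper x r → 0ℚ < r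
  0<upper x = lower<upper x (ℝ⁺.0-lower x)

  opaque
    search : ∀ x (f : ℕ → ℚ) → (∀ i → f i < f (suc i)) → ∀ j i →
             Lower x (f i) → Upper x (f (j ℕ.+ i)) →
             ∃[ k ] (Lower x (f k) × Upper x (f (suc (suc k))))
    search x f inc zero    i l u = ⊥-elim (ℝ⁺.disjoint x l u)
    search x f inc (suc j) i l u with ℝ⁺.located x (inc (suc i))
    ... | inj₁ l' = search x f inc j (suc i) l' (subst (λ k → Upper x (f k)) (sym (ℕ.+-suc j i)) u)
    ... | inj₂ u' = i , l , u'

  opaque
    approx : ∀ x {ρ} → 1ℚ < ρ → ∃[ s ] (0ℚ < s × Lower x s × Upper x (s * ρ))
    approx x {ρ} 1<ρ with root 1<ρ | ℝ⁺.lower-open x (ℝ⁺.0-lower x) | ℝ⁺.bounded x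
    ... | σ , 1<σ , σσ≤ρ | s , 0<s , ls | u , ux with ratio 0<s (lower<upper x ls ux)
    ... | v , _ , sv≡u with archimedes 1<σ v
    ... | n , v<σⁿ = result (search x f inc n 0 l₀ uₙ)
      where
      instance
        s>0 : Positive s
        s>0 = positive 0<s
      f : ℕ → ℚ
      f i = s * σ ^ i
      inc : ∀ i → f i < f (suc i)
      inc i = *-monoʳ-<-pos s (^-step 1<σ i)
      l₀ : Lower x (f 0)
      l₀ = subst (Lower x) (sym (*-identityʳ s)) ls
      uₙ : Upper x (f (n ℕ.+ 0))
      uₙ = subst (λ k → Upper x (f k)) (sym (ℕ.+-identityʳ n))
             (ℝ⁺.upper-closed x (subst (_< f n) sv≡u (*-monoʳ-<-pos s v<σⁿ)) ux)
      open +-*-Solver using (_:*_; _:=_)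
      result : ∃[ k ] (Lower x (f k) × Upper x (f (suc (suc k)))) →
               ∃[ s ] (0ℚ < s × Lower x s × Upper x (s * ρ))
      result (k , l , u) = f k , 0<fk , l , upper-≤ x le u
        where
        0<fk : 0ℚ < f k
        0<fk = *-pos 0<s (^-pos (<-trans 0<1 1<σ) k)
        le : f (suc (suc k)) ≤ f k * ρ
        le = subst (_≤ f k * ρ)
          (+-*-Solver.solve 3 (λ s σ p → s :* p :* (σ :* σ) := s :* (σ :* (σ :* p)))
            refl s σ (σ ^ k))
          (*-monoˡ-≤-nonNeg (f k) {{0<⇒nonNeg 0<fk}} σσ≤ρ)

open CutLemmas

infixl 6 _+ʳ_
infixl 7 _*ʳ_
infixr 8 _^ʳ_
infix  9 _⁻¹ 2^_

_+ʳ_ : ℝ⁺ → ℝ⁺ → ℝ⁺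
x +ʳ y = real record
  { Below     = λ q → ∃₂ λ s t → Lower x s × Lower y t × q ≤ s + t
  ; Above     = λ r → ∃₂ λ s t → Upper x s × Upper y t × s + t ≤ r
  ; below⁺    = let s , 0<s , ls = ℝ⁺.lower-open x (ℝ⁺.0-lower x)
                    t , 0<t , lt = ℝ⁺.lower-open y (ℝ⁺.0-lower y)
                in s + t , +-mono-< 0<s 0<t , s , t , ls , lt , ≤-refl
  ; above     = let s , us = ℝ⁺.bounded x ; t , ut = ℝ⁺.bounded y
                in s + t , s , t , us , ut , ≤-refl
  ; separated = λ { (s , t , ls , lt , q≤s+t) (s' , t' , us , ut , s'+t'≤r) →
                    ≤-trans q≤s+t (≤-trans (+-mono-≤ (<⇒≤ (lower<upper x ls us))
                                                     (<⇒≤ (lower<upper y lt ut))) s'+t'≤r) }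
  ; close     = close
  }
  where
  close : ∀ {q r} → 0ℚ < q → q < r →
          (∃₂ λ s t → Lower x s × Lower y t × q ≤ s + t) ⊎
          (∃₂ λ s t → Upper x s × Upper y t × s + t ≤ r)
  close {q} {r} 0<q q<r with ratio 0<q q<r
  ... | ρ , 1<ρ , qρ≡r with approx x 1<ρ | approx y 1<ρ
  ... | s , 0<s , ls , us | t , 0<t , lt , ut with ≤-total q (s + t)
  ... | inj₁ q≤s+t = inj₁ (s , t , ls , lt , q≤s+t)
  ... | inj₂ s+t≤q = inj₂ (s * ρ , t * ρ , us , ut , (begin
    s * ρ + t * ρ  ≡⟨ *-distribʳ-+ ρ s t ⟨
    (s + t) * ρ    ≤⟨ *-monoʳ-≤-nonNeg ρ {{0<⇒nonNeg (<-trans 0<1 1<ρ)}} s+t≤q ⟩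
    q * ρ          ≡⟨ qρ≡r ⟩
    r              ∎))
    where open ≤-Reasoning

_*ʳ_ : ℝ⁺ → ℝ⁺ → ℝ⁺
x *ʳ y = real record
  { Below     = λ q → ∃₂ λ s t → 0ℚ < s × 0ℚ < t × Lower x s × Lower y t × q ≤ s * t
  ; Above     = λ r → ∃₂ λ s t → Upper x s × Upper y t × s * t ≤ r
  ; below⁺    = let s , 0<s , ls = ℝ⁺.lower-open x (ℝ⁺.0-lower x)
                    t , 0<t , lt = ℝ⁺.lower-open y (ℝ⁺.0-lower y)
                in s * t , *-pos 0<s 0<t , s , t , 0<s , 0<t , ls , lt , ≤-refl
  ; above     = let s , us = ℝ⁺.bounded x ; t , ut = ℝ⁺.bounded y
                in s * t , s , t , us , ut , ≤-refl
  ; separated = λ { (s , t , 0<s , 0<t , ls , lt , q≤st) (s' , t' , us , ut , s't'≤r) →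
                    ≤-trans q≤st (≤-trans (*-mono-≤ 0<s 0<t (<⇒≤ (lower<upper x ls us))
                                                            (<⇒≤ (lower<upper y lt ut))) s't'≤r) }
  ; close     = close
  }
  where
  close : ∀ {q r} → 0ℚ < q → q < r →
          (∃₂ λ s t → 0ℚ < s × 0ℚ < t × Lower x s × Lower y t × q ≤ s * t) ⊎
          (∃₂ λ s t → Upper x s × Upper y t × s * t ≤ r)
  close {q} {r} 0<q q<r with ratio 0<q q<r
  ... | ρ , 1<ρ , qρ≡r with root 1<ρ
  ... | σ , 1<σ , σσ≤ρ with approx x 1<σ | approx y 1<σ
  ... | s , 0<s , ls , us | t , 0<t , lt , ut with ≤-total q (s * t)
  ... | inj₁ q≤st = inj₁ (s , t , 0<s , 0<t , ls , lt , q≤st)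
  ... | inj₂ st≤q = inj₂ (s * σ , t * σ , us , ut , (begin
    s * σ * (t * σ)  ≡⟨ +-*-Solver.solve 3 (λ s t σ → s :* σ :* (t :* σ) := s :* t :* (σ :* σ))
                          refl s t σ ⟩
    s * t * (σ * σ)  ≤⟨ *-mono-≤ (*-pos 0<s 0<t) (*-pos 0<σ 0<σ) st≤q σσ≤ρ ⟩
    q * ρ            ≡⟨ qρ≡r ⟩
    r                ∎))
    where
    open ≤-Reasoning
    open +-*-Solver using (_:*_; _:=_)
    0<σ = <-trans 0<1 1<σ

_^ʳ_ : ℝ⁺ → ℕ → ℝ⁺
x ^ʳ zero  = 1ʳ
x ^ʳ suc n = x *ʳ x ^ʳ n

_⁻¹ : ℝ⁺ → ℝ⁺
x ⁻¹ = real record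
  { Below     = λ q → ∃[ s ] (Upper x s × q * s ≤ 1ℚ)
  ; Above     = λ r → ∃[ s ] (0ℚ < s × Lower x s × 1ℚ ≤ r * s)
  ; below⁺    = below⁺
  ; above     = above
  ; separated = separated
  ; close     = close
  }
  where
  below⁺ : ∃[ q ] (0ℚ < q × ∃[ s ] (Upper x s × q * s ≤ 1ℚ))
  below⁺ with ℝ⁺.bounded x
  ... | s , us = 1/s , positive⁻¹ 1/s {{1/pos⇒pos s}} , s , us , ≤-reflexive (*-inverseˡ s)
    where
    instance
      s>0 : Positive s
      s>0 = positive (0<upper x us)
      s≢0 : NonZero s
      s≢0 = pos⇒nonZero s
    1/s = 1/ s
  above : ∃[ r ] ∃[ s ] (0ℚ < s × Lower x s × 1ℚ ≤ r * s)
  above with ℝ⁺.lower-open x (ℝ⁺.0-lower x)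
  ... | s , 0<s , ls = 1/ s , s , 0<s , ls , ≤-reflexive (sym (*-inverseˡ s))
    where
    instance
      s≢0 : NonZero s
      s≢0 = pos⇒nonZero s {{positive 0<s}}
  separated : ∀ {q r} → ∃[ s ] (Upper x s × q * s ≤ 1ℚ) →
              ∃[ s ] (0ℚ < s × Lower x s × 1ℚ ≤ r * s) → q ≤ r
  separated {q} {r} (s , us , qs≤1) (s' , 0<s' , ls' , 1≤rs') with <⊎≥ r q
  ... | inj₂ q≤r = q≤r
  ... | inj₁ r<q = ⊥-elim (<-irrefl refl (begin-strict
    1ℚ      ≤⟨ 1≤rs' ⟩
    r * s'  <⟨ *-monoˡ-<-pos s' {{positive 0<s'}} r<q ⟩
    q * s'  ≤⟨ *-monoˡ-≤-nonNeg q {{0<⇒nonNeg (<-trans 0<r r<q)}} (<⇒≤ (lower<upper x ls' us)) ⟩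
    q * s   ≤⟨ qs≤1 ⟩
    1ℚ      ∎))
    where
    open ≤-Reasoning
    0<r : 0ℚ < r
    0<r = *-cancelʳ-<-nonNeg s' {{0<⇒nonNeg 0<s'}}
            (subst (_< r * s') (sym (*-zeroˡ s')) (<-≤-trans 0<1 1≤rs'))
  close : ∀ {q r} → 0ℚ < q → q < r →
          (∃[ s ] (Upper x s × q * s ≤ 1ℚ)) ⊎ (∃[ s ] (0ℚ < s × Lower x s × 1ℚ ≤ r * s))
  close {q} {r} 0<q q<r with ratio 0<q q<r
  ... | ρ , 1<ρ , qρ≡r with approx x 1<ρ
  ... | s , 0<s , ls , us with ≤-total (q * (s * ρ)) 1ℚ
  ... | inj₁ ≤1 = inj₁ (s * ρ , us , ≤1)
  ... | inj₂ 1≤ = inj₂ (s , 0<s , ls , subst (1ℚ ≤_)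
          (trans (+-*-Solver.solve 3 (λ q s ρ → q :* (s :* ρ) := q :* ρ :* s) refl q s ρ)
                 (cong (_* s) qρ≡r)) 1≤)
    where open +-*-Solver using (_:*_; _:=_)

-- q ≤ 2^(a/b) is expressed as q^b ≤ 2^a, and dually for ≥.
2^_ : ℝ⁺ → ℝ⁺
2^ x = real record
  { Below     = Below
  ; Above     = Above
  ; below⁺    = 1ℚ , 0<1 , 0 , 0 , 0<1 , ℝ⁺.0-lower x , ≤-refl
  ; above     = above
  ; separated = separated
  ; close     = close
  }
  where
  Below Above : ℚ → Set
  Below q = ∃₂ λ a b → 0ℚ < q × Lower x (+ a / suc b) × q ^ suc b ≤ 2ℚ ^ a
  Above r = ∃₂ λ a b → 0ℚ < r × Upper x (+ a / suc b) × 2ℚ ^ a ≤ r ^ suc b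
  above : ∃[ r ] Above r
  above with ℝ⁺.bounded x
  ... | u , ux with ∃ℕ> u
  ... | a , u<a = 2ℚ ^ a , a , 0 , ^-pos 0<2 a , ℝ⁺.upper-closed x u<a ux
                , ≤-reflexive (sym (*-identityʳ (2ℚ ^ a)))
  separated : ∀ {q r} → Below q → Above r → q ≤ r
  separated {q} {r} (a , b , 0<q , l , q^b≤2^a) (c , d , 0<r , u , 2^c≤r^d) with <⊎≥ r q
  ... | inj₂ q≤r = q≤r
  ... | inj₁ r<q = ⊥-elim (<-irrefl refl (begin-strict
    (r ^ suc d) ^ suc b  ≡⟨ ^-swap r (suc d) (suc b) ⟩
    (r ^ suc b) ^ suc d  ≤⟨ ^-monoˡ-≤ (^-pos 0<r (suc b)) (^-monoˡ-≤ 0<r (<⇒≤ r<q) (suc b)) (suc d) ⟩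
    (q ^ suc b) ^ suc d  ≤⟨ ^-monoˡ-≤ (^-pos 0<q (suc b)) q^b≤2^a (suc d) ⟩
    (2ℚ ^ a) ^ suc d     ≡⟨ ^-assocʳ 2ℚ a (suc d) ⟩
    2ℚ ^ (a ℕ.* suc d)   <⟨ ^-monoʳ-< 1<2 (/-<⇒ {a} {b} {c} {d} (lower<upper x l u)) ⟩
    2ℚ ^ (c ℕ.* suc b)   ≡⟨ ^-assocʳ 2ℚ c (suc b) ⟨
    (2ℚ ^ c) ^ suc b     ≤⟨ ^-monoˡ-≤ (^-pos 0<2 c) 2^c≤r^d (suc b) ⟩
    (r ^ suc d) ^ suc b  ∎))
    where open ≤-Reasoning
  close : ∀ {q r} → 0ℚ < q → q < r → Below q ⊎ Above r
  close {q} {r} 0<q q<r with ratio 0<q q<r | ℝ⁺.bounded x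
  ... | ρ , 1<ρ , qρ≡r | u , ux with archimedes⁺ 1<ρ (2ℚ * 2ℚ) | ∃ℕ> u
  ... | k , 4<ρ^k | N , u<N with search x (λ i → + i / suc k) (λ i → /-step i k) (N ℕ.* suc k) 0 l₀ u₀
    where
    l₀ : Lower x (+ 0 / suc k)
    l₀ = subst (Lower x) (toℚᵘ-injective (ℚᵘ.≃-trans (ℚᵘ.*≡* refl) (ℚᵘ.≃-sym (/≃ 0 k)))) (ℝ⁺.0-lower x)
    u₀ : Upper x (+ (N ℕ.* suc k ℕ.+ 0) / suc k)
    u₀ = upper-≤ x (≮⇒≥ λ lt → ℕ.<-irrefl (eq N k) (/-<⇒ {N ℕ.* suc k ℕ.+ 0} {k} {N} {0} lt))
                 (ℝ⁺.upper-closed x u<N ux)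
      where
      eq : ∀ N k → (N ℕ.* suc k ℕ.+ 0) ℕ.* 1 ≡ N ℕ.* suc k
      eq N k = trans (ℕ.*-identityʳ _) (ℕ.+-identityʳ _)
  ... | c , lc , uc with ≤-total (q ^ suc k) (2ℚ ^ c)
  ... | inj₁ q^k≤2^c = inj₁ (c , k , 0<q , lc , q^k≤2^c)
  ... | inj₂ 2^c≤q^k = inj₂ (suc (suc c) , k , <-trans 0<q q<r , uc , (begin
    2ℚ * (2ℚ * 2ℚ ^ c)       ≡⟨ *-assoc 2ℚ 2ℚ (2ℚ ^ c) ⟨
    2ℚ * 2ℚ * 2ℚ ^ c         ≡⟨ *-comm (2ℚ * 2ℚ) (2ℚ ^ c) ⟩
    2ℚ ^ c * (2ℚ * 2ℚ)       ≤⟨ *-mono-≤ (^-pos 0<2 c) (*-pos 0<2 0<2) 2^c≤q^k (<⇒≤ 4<ρ^k) ⟩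
    q ^ suc k * ρ ^ suc k    ≡⟨ ^-distrib-* q ρ (suc k) ⟨
    (q * ρ) ^ suc k          ≡⟨ cong (_^ suc k) qρ≡r ⟩
    r ^ suc k                ∎))
    where open ≤-Reasoning

-- a/b ≤ log₂ s is expressed as 2^a ≤ s^b, and dually for ≥; x > 1 makes log₂ x positive.
log₂ : (x : ℝ⁺) → 1ʳ <ʳ x → ℝ⁺
log₂ x (p , 1<p , lp) = real record
  { Below     = Below
  ; Above     = Above
  ; below⁺    = below⁺
  ; above     = above
  ; separated = separated
  ; close     = close
  }
  where
  Below Above : ℚ → Set
  Below q = ∃[ s ] ∃₂ λ a b → 0ℚ < s × Lower x s × 2ℚ ^ a ≤ s ^ suc b × q ≤ + a / suc b
  Above r = ∃[ s ] ∃₂ λ a b → Upper x s × s ^ suc b ≤ 2ℚ ^ a × + a / suc b ≤ r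
  below⁺ : ∃[ q ] (0ℚ < q × Below q)
  below⁺ with archimedes⁺ 1<p 2ℚ
  ... | b , 2<p^b = + 1 / suc b , positive⁻¹ (+ 1 / suc b) {{normalize-pos 1 (suc b)}}
                  , p , 1 , b , <-trans 0<1 1<p , lp
                  , ≤-trans (≤-reflexive (*-identityʳ 2ℚ)) (<⇒≤ 2<p^b) , ≤-refl
  above : ∃[ r ] Above r
  above with ℝ⁺.bounded x
  ... | u , ux with archimedes 1<2 u
  ... | a , u<2^a = + a / 1 , u , a , 0 , ux
                  , ≤-trans (≤-reflexive (*-identityʳ u)) (<⇒≤ u<2^a) , ≤-refl
  separated : ∀ {q r} → Below q → Above r → q ≤ r
  separated {q} {r} (s , a , b , 0<s , ls , 2^a≤s^b , q≤) (u , c , d , ux , u^d≤2^c , ≤r) =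
    ≤-trans q≤ (≤-trans (≮⇒≥ λ lt → <-irrefl refl (begin-strict
    (u ^ suc d) ^ suc b  ≤⟨ ^-monoˡ-≤ (^-pos 0<u (suc d)) u^d≤2^c (suc b) ⟩
    (2ℚ ^ c) ^ suc b     ≡⟨ ^-assocʳ 2ℚ c (suc b) ⟩
    2ℚ ^ (c ℕ.* suc b)   <⟨ ^-monoʳ-< 1<2 (/-<⇒ {c} {d} {a} {b} lt) ⟩
    2ℚ ^ (a ℕ.* suc d)   ≡⟨ ^-assocʳ 2ℚ a (suc d) ⟨
    (2ℚ ^ a) ^ suc d     ≤⟨ ^-monoˡ-≤ (^-pos 0<2 a) 2^a≤s^b (suc d) ⟩
    (s ^ suc b) ^ suc d  ≤⟨ ^-monoˡ-≤ (^-pos 0<s (suc b))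
                              (^-monoˡ-≤ 0<s (<⇒≤ (lower<upper x ls ux)) (suc b)) (suc d) ⟩
    (u ^ suc b) ^ suc d  ≡⟨ ^-swap u (suc b) (suc d) ⟩
    (u ^ suc d) ^ suc b  ∎)) ≤r)
    where
    open ≤-Reasoning
    0<u = 0<upper x ux
  close : ∀ {q r} → 0ℚ < q → q < r → Below q ⊎ Above r
  close {q} {r} 0<q q<r with grid 0<q q<r
  ... | a , k , q≤ , ≤r with rootⁿ 1<2 (suc k)
  ... | σ , 1<σ , σ^k≤2 with approx x 1<σ
  ... | s , 0<s , ls , us with ≤-total (2ℚ ^ a) (s ^ suc k)
  ... | inj₁ 2^a≤s^k = inj₁ (s , a , k , 0<s , ls , 2^a≤s^k , q≤)
  ... | inj₂ s^k≤2^a = inj₂ (s * σ , suc a , k , us , (begin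
    (s * σ) ^ suc k        ≡⟨ ^-distrib-* s σ (suc k) ⟩
    s ^ suc k * σ ^ suc k  ≤⟨ *-mono-≤ (^-pos 0<s (suc k)) (^-pos (<-trans 0<1 1<σ) (suc k))
                                       s^k≤2^a σ^k≤2 ⟩
    2ℚ ^ a * 2ℚ            ≡⟨ *-comm (2ℚ ^ a) 2ℚ ⟩
    2ℚ * 2ℚ ^ a            ∎) , ≤r)
    where open ≤-Reasoning

1<x⁻¹ : ∀ x → x <ʳ ¼ → 1ʳ <ʳ x ⁻¹
1<x⁻¹ x (q , uq , q<¼) =
  2ℚ , 1<2 , 4ℚ , 2<4 , q , uq , *-monoˡ-≤-nonNeg 4ℚ (<⇒≤ q<¼)
  where
  4ℚ = + 4 / 1
  2<4 : 2ℚ < 4ℚ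
  2<4 = *<* (ℤ.+<+ (ℕ.s≤s (ℕ.s≤s (ℕ.s≤s ℕ.z≤n))))

data Colour : Set where
  red blue : Colour

opposite : Colour → Colour
opposite red  = blue
opposite blue = red

_≟ᶜ_ : DecidableEquality Colour
red  ≟ᶜ red  = yes refl
red  ≟ᶜ blue = no λ ()
blue ≟ᶜ red  = no λ ()
blue ≟ᶜ blue = yes refl

-- K_n on the vertex set Fin n.  The diagonal values carry no meaning: they are
-- ignored everywhere below.
record ColouredK (n : ℕ) : Set where
  field
    colour    : Fin n → Fin n → Colour
    symmetric : ∀ u v → colour u v ≡ colour v u

open ColouredK public

degree : ∀ {n} → ColouredK n → Colour → Fin n → ℕ
degree {n} G c v =
  length (filter (λ w → ¬? (v Fin.≟ w) ×-dec (colour G v w ≟ᶜ c)) (allFin n))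

LocallyBalanced : ∀ {n} → ℝ⁺ → ColouredK n → Set
LocallyBalanced {n} γ G =
  ∀ v c → (γ *ʳ fromℕ n {{nonZeroIndex v}}) ≤ᴺ degree G c v

Disjoint : ∀ {n} → Subset n → Subset n → Set
Disjoint A B = ∀ {v} → v ∈ A → ¬ v ∈ B

AllInside : ∀ {n} → ColouredK n → Colour → Subset n → Set
AllInside G c A = ∀ {u v} → u ∈ A → v ∈ A → u ≢ v → colour G u v ≡ c

AllBetween : ∀ {n} → ColouredK n → Colour → Subset n → Subset n → Set
AllBetween G c A B = ∀ {u v} → u ∈ A → v ∈ B → colour G u v ≡ c

{-# OPTIONS --safe #-}
-- A colouring of K_S without the pattern for t = 2 (four vertices with one colour class C₄ or 2K₂) is almost
-- split: all but O(S) of the pairs inside a suitable vertex set are red and all but O(S) of those outside are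
-- blue.  Counting the blue edges of the first part and the red edges of the second, each crossing pair is
-- counted once, so the degrees involved average at most S/4 + O(1), and the colouring cannot be locally
-- (1/4 + 1/k)-balanced.  A random sample of S = O(k²) vertices inherits balancedness up to a second-moment
-- error, hence at least half of all samples contain the pattern, and the pattern has density at least
-- k^(-O(1)) among the 4-tuples of vertices.
--
-- Nikiforov's argument blows such a dense pattern up to four sets of size k^(-O(1)) log n; running
-- Erdős–Szekeres at each step makes every one of the four sets a monochromatic clique.  Whatever the four
-- colours are, two of the sets form the required pattern.  This needs only n ≥ 2^(t k^O(1)), well
-- below the bound assumed on n.
module Submission where

open import Data.Fin using (Fin)
open import Data.Fin.Subset using (Subset; ∣_∣)
open import Data.List using (List)
open import Data.Nat using (ℕ; zero; suc; NonZero)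
open import Data.Product using (_×_; Σ-syntax)
open import Relation.Binary.PropositionalEquality using (_≡_)
open import Defs

-- Samples are drawn with replacement, which makes the positions independent. The price is that two
-- positions may hold the same vertex, and the colour between them is then a meaningless diagonal
-- value. Hence patterns speak of positions and colours only: the splitting argument sees a sample
-- as a colouring of its positions, and the 4-tuples counted for the density may have coinciding
-- entries. Distinctness comes back with the blow-up, whose cliques consist of distinct vertices;
-- one spare tuple then proves that the two chosen sets are disjoint. In the splitting argument,
-- maximality of the red clique alone says nothing about red edges outside it whose two ends have
-- the same single blue neighbour in the clique. The exchange of one vertex for two excludes exactly
-- these. Averages and probabilities are sums over all tuples with denominators multiplied out, so
-- this part lives in the integers; real numbers enter only to turn the hypotheses on `n` and on the
-- degrees into inequalities between natural numbers.

-- Finite sums of integers.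

module IntegerSums where

  open import Data.Bool using (Bool; true; false)
  open import Data.Fin using (Fin; zero; suc)
  import Data.Fin.Properties as Fin
  open import Data.Integer hiding (suc)
  open import Data.Integer.Properties
  open import Data.Integer.Tactic.RingSolver using (solve-∀)
  open import Data.List using (List; []; _∷_; _++_; map; length; filter; allFin; cartesianProductWith)
  open import Data.List.Properties using (map-tabulate; length-tabulate)
  open import Data.List.Membership.Propositional using (_∈_)
  open import Data.List.Relation.Unary.Any using (here; there)
  open import Data.Nat using (ℕ)
  import Data.Nat.Properties as ℕ
  open import Function using (id; _∘_)
  open import Relation.Binary.PropositionalEquality
  open import Relation.Nullary using (Dec; does; yes; no; contradiction)
  open import Relation.Unary using (Decidable)

  private variable
    A B C : Set

  ∑ : List A → (A → ℤ) → ℤ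
  ∑ []       f = 0ℤ
  ∑ (x ∷ xs) f = f x + ∑ xs f

  ι : Bool → ℤ
  ι true  = 1ℤ
  ι false = 0ℤ

  0≤ι : ∀ b → 0ℤ ≤ ι b
  0≤ι true  = +≤+ Data.Nat.z≤n
  0≤ι false = ≤-refl

  module _ {f g : A → ℤ} where

    ∑-cong : (∀ x → f x ≡ g x) → ∀ xs → ∑ xs f ≡ ∑ xs g
    ∑-cong eq []       = refl
    ∑-cong eq (x ∷ xs) = cong₂ _+_ (eq x) (∑-cong eq xs)

    ∑-mono : (∀ x → f x ≤ g x) → ∀ xs → ∑ xs f ≤ ∑ xs g
    ∑-mono le []       = ≤-refl
    ∑-mono le (x ∷ xs) = +-mono-≤ (le x) (∑-mono le xs)

  ∑-+ : ∀ (f g : A → ℤ) xs → ∑ xs (λ x → f x + g x) ≡ ∑ xs f + ∑ xs g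
  ∑-+ f g []       = refl
  ∑-+ f g (x ∷ xs) = trans (cong (_+_ (f x + g x)) (∑-+ f g xs)) (shuffle (f x) (g x) (∑ xs f) (∑ xs g))
    where
    shuffle : ∀ a b c d → a + b + (c + d) ≡ a + c + (b + d)
    shuffle = solve-∀

  ∑-*ˡ : ∀ c (f : A → ℤ) xs → ∑ xs (λ x → c * f x) ≡ c * ∑ xs f
  ∑-*ˡ c f []       = sym (*-zeroʳ c)
  ∑-*ˡ c f (x ∷ xs) = trans (cong (_+_ (c * f x)) (∑-*ˡ c f xs)) (sym (*-distribˡ-+ c (f x) (∑ xs f)))

  ∑-const : ∀ c (xs : List A) → ∑ xs (λ _ → c) ≡ + length xs * c
  ∑-const c []       = refl
  ∑-const c (x ∷ xs) = trans (cong (_+_ c) (∑-const c xs)) (sym (suc-* (+ length xs) c))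

  ∑-swap : ∀ (f : A → B → ℤ) xs ys → ∑ xs (λ x → ∑ ys (f x)) ≡ ∑ ys (λ y → ∑ xs (λ x → f x y))
  ∑-swap f []       ys = sym (trans (∑-const 0ℤ ys) (*-zeroʳ (+ length ys)))
  ∑-swap f (x ∷ xs) ys = trans (cong (_+_ (∑ ys (f x))) (∑-swap f xs ys)) (sym (∑-+ (f x) (λ y → ∑ xs (λ x → f x y)) ys))

  ∑-++ : ∀ (f : A → ℤ) xs ys → ∑ (xs ++ ys) f ≡ ∑ xs f + ∑ ys f
  ∑-++ f []       ys = sym (+-identityˡ _)
  ∑-++ f (x ∷ xs) ys = trans (cong (_+_ (f x)) (∑-++ f xs ys)) (sym (+-assoc (f x) _ _))

  ∑-map : ∀ (f : B → ℤ) (g : A → B) xs → ∑ (map g xs) f ≡ ∑ xs (f ∘ g)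
  ∑-map f g []       = refl
  ∑-map f g (x ∷ xs) = cong (_+_ (f (g x))) (∑-map f g xs)

  ∑-product : ∀ (f : C → ℤ) (g : A → B → C) xs ys →
              ∑ (cartesianProductWith g xs ys) f ≡ ∑ xs (λ x → ∑ ys (λ y → f (g x y)))
  ∑-product f g []       ys = refl
  ∑-product f g (x ∷ xs) ys =
    trans (∑-++ f (map (g x) ys) _) (cong₂ _+_ (∑-map f (g x) ys) (∑-product f g xs ys))

  ∑-nonneg : ∀ {f : A → ℤ} → (∀ x → 0ℤ ≤ f x) → ∀ xs → 0ℤ ≤ ∑ xs f
  ∑-nonneg 0≤f []       = ≤-refl
  ∑-nonneg 0≤f (x ∷ xs) = +-mono-≤ (0≤f x) (∑-nonneg 0≤f xs)

  ∑-term : ∀ {f : A → ℤ} → (∀ x → 0ℤ ≤ f x) → ∀ {x xs} → x ∈ xs → f x ≤ ∑ xs f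
  ∑-term {f = f} 0≤f {x} {_ ∷ xs} (here refl) =
    subst (_≤ f x + ∑ xs f) (+-identityʳ (f x)) (+-monoʳ-≤ (f x) (∑-nonneg 0≤f xs))
  ∑-term {f = f} 0≤f {x} {y ∷ xs} (there x∈) =
    subst (_≤ f y + ∑ xs f) (+-identityˡ (f x)) (+-mono-≤ (0≤f y) (∑-term 0≤f x∈))

  ∑-filter : ∀ {P : A → Set} (P? : Decidable P) xs → ∑ xs (λ x → ι (does (P? x))) ≡ + length (filter P? xs)
  ∑-filter P? []       = refl
  ∑-filter P? (x ∷ xs) with does (P? x)
  ... | true  = cong (_+_ 1ℤ) (∑-filter P? xs)
  ... | false = trans (+-identityˡ _) (∑-filter P? xs)

  ∑-allFin-suc : ∀ {n} (f : Fin (ℕ.suc n) → ℤ) → ∑ (allFin (ℕ.suc n)) f ≡ f zero + ∑ (allFin n) (f ∘ suc)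
  ∑-allFin-suc {n} f = cong (_+_ (f zero))
    (trans (cong (λ xs → ∑ xs f) (sym (map-tabulate id suc))) (∑-map f suc (allFin n)))

  ∑-Kronecker : ∀ {n} (a : Fin n) → ∑ (allFin n) (λ j → ι (does (j Fin.≟ a))) ≡ 1ℤ
  ∑-Kronecker {ℕ.suc n} zero    = trans (∑-allFin-suc {n} (λ j → ι (does (j Fin.≟ zero))))
    (cong (_+_ 1ℤ) (trans (∑-const 0ℤ (allFin n)) (*-zeroʳ (+ length (allFin n)))))
  ∑-Kronecker {ℕ.suc n} (suc a) = trans (∑-allFin-suc {n} (λ j → ι (does (j Fin.≟ suc a))))
    (trans (+-identityˡ _) (∑-Kronecker a))

  ∑-allFin-const : ∀ n c → ∑ (allFin n) (λ _ → c) ≡ + n * c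
  ∑-allFin-const n c = trans (∑-const c (allFin n)) (cong (λ l → + l * c) (length-tabulate {n = n} id))

  0≤square : ∀ z → 0ℤ ≤ z * z
  0≤square (+ m)    = subst (0ℤ ≤_) (pos-* m m) (+≤+ Data.Nat.z≤n)
  0≤square -[1+ m ] = +≤+ Data.Nat.z≤n

  ∑∑ : List A → (A → A → ℤ) → ℤ
  ∑∑ xs f = ∑ xs (λ x → ∑ xs (f x))

  ∑∑-+ : ∀ (f g : A → A → ℤ) xs → ∑∑ xs (λ x y → f x y + g x y) ≡ ∑∑ xs f + ∑∑ xs g
  ∑∑-+ f g xs = trans (∑-cong (λ x → ∑-+ (f x) (g x) xs) xs)
    (∑-+ (λ x → ∑ xs (f x)) (λ x → ∑ xs (g x)) xs)

  ∑∑-*ˡ : ∀ c (f : A → A → ℤ) xs → ∑∑ xs (λ x y → c * f x y) ≡ c * ∑∑ xs f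
  ∑∑-*ˡ c f xs = trans (∑-cong (λ x → ∑-*ˡ c (f x) xs) xs) (∑-*ˡ c (λ x → ∑ xs (f x)) xs)

  0≤* : ∀ {a b} → 0ℤ ≤ a → 0ℤ ≤ b → 0ℤ ≤ a * b
  0≤* {+ m} {+ n} _ _ = subst (0ℤ ≤_) (pos-* m n) (+≤+ Data.Nat.z≤n)

  1≤ι : ∀ {P : Set} (P? : Dec P) → P → 1ℤ ≤ ι (does P?)
  1≤ι (yes _) _ = ≤-refl
  1≤ι (no ¬p) p = contradiction p ¬p

  1≤* : ∀ {a b} → 1ℤ ≤ a → 1ℤ ≤ b → 1ℤ ≤ a * b
  1≤* {+ m} {+ n} (+≤+ 1≤m) (+≤+ 1≤n) = subst (1ℤ ≤_) (pos-* m n) (+≤+ (ℕ.*-mono-≤ 1≤m 1≤n))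

-- The pattern for t = 2 and its decidability.

module Patterns where

  open import Data.Fin using (Fin)
  import Data.Fin.Properties as Fin
  open import Data.Product using (∃-syntax; _×_; _,_)
  open import Data.Unit using (⊤; tt)
  open import Data.Vec using (Vec; []; _∷_)
  open import Data.Vec.Relation.Unary.AllPairs using (allPairs?)
  open import Data.Vec.Relation.Unary.Unique.Propositional using (Unique)
  open import Relation.Binary.PropositionalEquality
  open import Relation.Nullary using (Dec; yes; no; _×-dec_; ¬?)

  opposite-involutive : ∀ c → opposite (opposite c) ≡ c
  opposite-involutive red  = refl
  opposite-involutive blue = refl

  ≢⇒opposite : ∀ {c d} → c ≢ d → c ≡ opposite d
  ≢⇒opposite {red}  {red}  c≢d with () ← c≢d refl
  ≢⇒opposite {red}  {blue} c≢d = refl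
  ≢⇒opposite {blue} {red}  c≢d = refl
  ≢⇒opposite {blue} {blue} c≢d with () ← c≢d refl

  opposite≢ : ∀ {c d} → c ≡ opposite d → c ≢ d
  opposite≢ {d = red}  () refl
  opposite≢ {d = blue} () refl

  module _ {A : Set} (col : A → A → Colour) (c : Colour) where

    -- Only tuples of length 4 matter: Ok col c (a ∷ a′ ∷ b ∷ b′ ∷ []) says that
    -- aa′ and bb′ are the only pairs of colour c.
    Compatible : ∀ {r} → A → Vec A r → Set
    Compatible v []                = ⊤
    Compatible v (b ∷ [])          = col v b ≡ c
    Compatible v (b ∷ b′ ∷ [])     = col v b ≡ opposite c × col v b′ ≡ opposite c
    Compatible v (a ∷ b ∷ b′ ∷ []) = col v a ≡ c × col v b ≡ opposite c × col v b′ ≡ opposite c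
    Compatible v (_ ∷ _ ∷ _ ∷ _ ∷ _) = ⊤

    Ok : ∀ {r} → Vec A r → Set
    Ok []      = ⊤
    Ok (v ∷ p) = Compatible v p × Ok p

    compatible? : ∀ {r} v (p : Vec A r) → Dec (Compatible v p)
    compatible? v []                = yes tt
    compatible? v (b ∷ [])          = col v b ≟ᶜ c
    compatible? v (b ∷ b′ ∷ [])     = (col v b ≟ᶜ opposite c) ×-dec (col v b′ ≟ᶜ opposite c)
    compatible? v (a ∷ b ∷ b′ ∷ []) =
      (col v a ≟ᶜ c) ×-dec (col v b ≟ᶜ opposite c) ×-dec (col v b′ ≟ᶜ opposite c)
    compatible? v (_ ∷ _ ∷ _ ∷ _ ∷ _) = yes tt

    ok? : ∀ {r} (p : Vec A r) → Dec (Ok p)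
    ok? []      = yes tt
    ok? (v ∷ p) = compatible? v p ×-dec ok? p

  Pattern : ∀ {s} → (Fin s → Fin s → Colour) → Set
  Pattern {s} col = ∃[ c ] ∃[ p ] (Unique {n = 4} p × Ok col c p)

  unique? : ∀ {s r} (p : Vec (Fin s) r) → Dec (Unique p)
  unique? = allPairs? (λ i j → ¬? (i Fin.≟ j))

  pattern? : ∀ {s} (col : Fin s → Fin s → Colour) → Dec (Pattern col)
  pattern? {s} col with search red | search blue
    where
    search : ∀ c → Dec (∃[ i ] ∃[ j ] ∃[ k ] ∃[ l ]
                        (Unique (i ∷ j ∷ k ∷ l ∷ []) × Ok col c (i ∷ j ∷ k ∷ l ∷ [])))
    search c = Fin.any? λ i → Fin.any? λ j → Fin.any? λ k → Fin.any? λ l →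
      unique? _ ×-dec ok? col c (i ∷ j ∷ k ∷ l ∷ [])
  ... | yes (i , j , k , l , p) | _ = yes (red , i ∷ j ∷ k ∷ l ∷ [] , p)
  ... | no _ | yes (i , j , k , l , p) = yes (blue , i ∷ j ∷ k ∷ l ∷ [] , p)
  ... | no ¬r | no ¬b = no λ where
    (red  , i ∷ j ∷ k ∷ l ∷ [] , p) → ¬r (i , j , k , l , p)
    (blue , i ∷ j ∷ k ∷ l ∷ [] , p) → ¬b (i , j , k , l , p)

-- Pattern-free colourings are almost split.

-- The set K below is a red clique that admits neither an extension by one vertex nor an exchange of one
-- vertex for two.  Then the outer vertices with at least two blue neighbours in K form a blue clique, so do
-- the others, and the red edges in between almost all vanish.
module AlmostSplit {s} (col : Fin (suc s) → Fin (suc s) → Colour)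
                   (symm : ∀ i j → col i j ≡ col j i) where

  open import Data.Bool using (Bool; true; false; _∧_; _∨_; not; if_then_else_)
  open import Data.Fin using () renaming (zero to fzero)
  open import Data.Integer.Tactic.RingSolver using (solve-∀)
  import Data.Bool.Properties as Bool
  open import Data.Empty using (⊥; ⊥-elim)
  import Data.Fin.Properties as Fin
  import Data.Integer as ℤ
  import Data.Integer.Properties as ℤ
  open import Data.List using (allFin; length)
  open import Data.Product using (∃-syntax; _×_; _,_; proj₁; proj₂)
  open import Data.Sum using (_⊎_; inj₁; inj₂)
  open import Data.Unit using (tt)
  open import Data.Vec using ([]; _∷_)
  open import Data.Vec.Relation.Unary.All using ([]; _∷_)
  open import Data.Vec.Relation.Unary.AllPairs using ([]; _∷_)
  open import Function using (_∘_; case_of_)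
  open import Algebra.Properties.AbelianGroup ℤ.+-0-abelianGroup using (∙-cancelʳ)
  open import Relation.Binary.PropositionalEquality
  open import Relation.Nullary using (¬_; Dec; yes; no; does; _×-dec_; _→-dec_; ¬?)
  open Patterns
  open IntegerSums

  V : Set
  V = Fin (suc s)


  size : (V → Bool) → ℤ.ℤ
  size p = ∑ (allFin (suc s)) (ι ∘ p)

  size≤ : ∀ p → size p ℤ.≤ ℤ.+ suc s
  size≤ p = ℤ.≤-trans (∑-mono (ι≤1 ∘ p) (allFin (suc s)))
    (ℤ.≤-reflexive (trans (∑-allFin-const (suc s) ℤ.1ℤ) (ℤ.*-identityʳ (ℤ.+ suc s))))
    where
    ι≤1 : ∀ b → ι b ℤ.≤ ℤ.1ℤ
    ι≤1 true  = ℤ.≤-refl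
    ι≤1 false = ℤ.+≤+ Data.Nat.z≤n

  RedClique : (V → Bool) → Set
  RedClique p = ∀ {i j} → i ≢ j → p i ≡ true → p j ≡ true → col i j ≡ red

  Extension : (V → Bool) → Set
  Extension p = ∃[ x ] (p x ≡ false × (∀ z → p z ≡ true → col x z ≡ red))

  AllRedBut : (V → Bool) → V → V → Set
  AllRedBut p z x = ∀ w → p w ≡ true → w ≢ z → col x w ≡ red

  Exchange : (V → Bool) → Set
  Exchange p = ∃[ x ] ∃[ y ] ∃[ z ]
    (p x ≡ false × p y ≡ false × x ≢ y × col x y ≡ red × p z ≡ true × AllRedBut p z x × AllRedBut p z y)

  extension? : ∀ p → Dec (Extension p)
  extension? p = Fin.any? λ x → (p x Bool.≟ false) ×-dec
    Fin.all? λ z → (p z Bool.≟ true) →-dec (col x z ≟ᶜ red)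

  allRedBut? : ∀ p z x → Dec (AllRedBut p z x)
  allRedBut? p z x = Fin.all? λ w → (p w Bool.≟ true) →-dec (¬? (w Fin.≟ z) →-dec (col x w ≟ᶜ red))

  exchange? : ∀ p → Dec (Exchange p)
  exchange? p = Fin.any? λ x → Fin.any? λ y → Fin.any? λ z →
    (p x Bool.≟ false) ×-dec (p y Bool.≟ false) ×-dec ¬? (x Fin.≟ y) ×-dec (col x y ≟ᶜ red) ×-dec
    (p z Bool.≟ true) ×-dec allRedBut? p z x ×-dec allRedBut? p z y

  is : V → V → ℤ.ℤ
  is x i = ι (does (i Fin.≟ x))

  extend : (p : V → Bool) → RedClique p → Extension p →
           ∃[ q ] (RedClique q × size q ≡ ℤ.suc (size p))
  extend p clique (x , x∉p , x-red) = q , q-clique , size-q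
    where
    q : V → Bool
    q i = does (i Fin.≟ x) ∨ p i
    q-clique : RedClique q
    q-clique {i} {j} i≢j qi qj with i Fin.≟ x | j Fin.≟ x
    ... | yes refl | yes refl = ⊥-elim (i≢j refl)
    ... | yes refl | no _     = x-red j qj
    ... | no _     | yes refl = trans (symm i j) (x-red i qi)
    ... | no _     | no _     = clique i≢j qi qj
    pointwise : ∀ i → ι (q i) ≡ ι (does (i Fin.≟ x)) ℤ.+ ι (p i)
    pointwise i with i Fin.≟ x
    ... | yes refl rewrite x∉p = refl
    ... | no _                 = sym (ℤ.+-identityˡ _)
    size-q : size q ≡ ℤ.suc (size p)
    size-q = trans (∑-cong pointwise (allFin (suc s)))
      (trans (∑-+ (is x) (ι ∘ p) (allFin (suc s))) (cong (ℤ._+ size p) (∑-Kronecker x)))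

  exchange : (p : V → Bool) → RedClique p → Exchange p →
             ∃[ q ] (RedClique q × size q ≡ ℤ.suc (size p))
  exchange p clique (x , y , z , x∉p , y∉p , x≢y , xy-red , z∈p , x-red , y-red) = q , q-clique , size-q
    where
    q : V → Bool
    q i = does (i Fin.≟ x) ∨ does (i Fin.≟ y) ∨ (p i ∧ not (does (i Fin.≟ z)))
    data View (i : V) : Set where
      is-x : i ≡ x → View i
      is-y : i ≡ y → View i
      in-p : p i ≡ true → i ≢ z → View i
    view : ∀ i → q i ≡ true → View i
    view i qi with i Fin.≟ x | i Fin.≟ y | p i in pi | i Fin.≟ z
    ... | yes e | _     | _    | _    = is-x e
    ... | no _  | yes e | _    | _    = is-y e
    ... | no _  | no _  | true | no n = in-p pi n
    q-clique : RedClique q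
    q-clique {i} {j} i≢j qi qj with view i qi | view j qj
    ... | is-x refl  | is-x refl  = ⊥-elim (i≢j refl)
    ... | is-x refl  | is-y refl  = xy-red
    ... | is-x refl  | in-p pj n  = x-red j pj n
    ... | is-y refl  | is-x refl  = trans (symm y x) xy-red
    ... | is-y refl  | is-y refl  = ⊥-elim (i≢j refl)
    ... | is-y refl  | in-p pj n  = y-red j pj n
    ... | in-p pi n  | is-x refl  = trans (symm i x) (x-red i pi n)
    ... | in-p pi n  | is-y refl  = trans (symm i y) (y-red i pi n)
    ... | in-p pi _  | in-p pj _  = clique i≢j pi pj
    -- The indicator of `z` is added on the left, so that deleting `z` needs no subtraction.
    pointwise : ∀ i → ι (q i) ℤ.+ ι (does (i Fin.≟ z)) ≡
                      ι (does (i Fin.≟ x)) ℤ.+ (ι (does (i Fin.≟ y)) ℤ.+ ι (p i))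
    pointwise i with i Fin.≟ x | i Fin.≟ y | i Fin.≟ z
    ... | yes refl | yes refl | _        = ⊥-elim (x≢y refl)
    ... | yes refl | no _     | yes refl with () ← trans (sym x∉p) z∈p
    ... | yes refl | no _     | no _     rewrite x∉p = refl
    ... | no _     | yes refl | yes refl with () ← trans (sym y∉p) z∈p
    ... | no _     | yes refl | no _     rewrite y∉p = refl
    ... | no _     | no _     | yes refl rewrite z∈p = refl
    ... | no _     | no _     | no _     with p i
    ...   | true  = refl
    ...   | false = refl
    size-q : size q ≡ ℤ.suc (size p)
    size-q = ∙-cancelʳ ℤ.1ℤ (size q) (ℤ.suc (size p)) (begin
      size q ℤ.+ ℤ.1ℤ  ≡⟨ cong (ℤ._+_ (size q)) (∑-Kronecker z) ⟨
      size q ℤ.+ ∑ L (is z) ≡⟨ ∑-+ (ι ∘ q) (is z) L ⟨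
      ∑ L (λ i → ι (q i) ℤ.+ is z i) ≡⟨ ∑-cong pointwise L ⟩
      ∑ L (λ i → is x i ℤ.+ (is y i ℤ.+ ι (p i))) ≡⟨ ∑-+ (is x) (λ i → is y i ℤ.+ ι (p i)) L ⟩
      ∑ L (is x) ℤ.+ ∑ L (λ i → is y i ℤ.+ ι (p i)) ≡⟨ cong₂ ℤ._+_ (∑-Kronecker x) (∑-+ (is y) (ι ∘ p) L) ⟩
      ℤ.1ℤ ℤ.+ (∑ L (is y) ℤ.+ size p) ≡⟨ cong (λ e → ℤ.1ℤ ℤ.+ (e ℤ.+ size p)) (∑-Kronecker y) ⟩
      ℤ.suc (ℤ.suc (size p)) ≡⟨ ℤ.+-comm ℤ.1ℤ (ℤ.suc (size p)) ⟩
      ℤ.suc (size p) ℤ.+ ℤ.1ℤ ∎)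
      where
      open ≡-Reasoning
      L = allFin (suc s)

  record Saturated : Set where
    field
      K            : V → Bool
      clique       : RedClique K
      no-extension : ¬ Extension K
      no-exchange  : ¬ Exchange K

  -- Either move raises the size by one and no size exceeds `suc s`, so `suc s` units of fuel
  -- suffice; the invariant is that size plus fuel stays at least `suc s`.
  saturated : Saturated
  saturated = grow (suc s) (λ _ → false) (λ _ ())
    (ℤ.≤-reflexive (sym (trans (cong (ℤ._+ ℤ.+ suc s)
       (trans (∑-const ℤ.0ℤ (allFin (suc s))) (ℤ.*-zeroʳ (ℤ.+ length (allFin (suc s)))))) (ℤ.+-identityˡ _))))
    where
    grow : ∀ fuel p → RedClique p → ℤ.+ suc s ℤ.≤ size p ℤ.+ ℤ.+ fuel → Saturated
    improve : ∀ fuel p → ℤ.+ suc s ℤ.≤ size p ℤ.+ ℤ.+ fuel →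
              ∃[ q ] (RedClique q × size q ≡ ℤ.suc (size p)) → Saturated
    grow fuel p clique le with extension? p | exchange? p
    ... | yes e | _     = improve fuel p le (extend p clique e)
    ... | no _  | yes e = improve fuel p le (exchange p clique e)
    ... | no ¬e | no ¬x = record { K = p ; clique = clique ; no-extension = ¬e ; no-exchange = ¬x }
    improve zero p le (q , _ , eq) = ⊥-elim (ℤ.<-irrefl refl
      (ℤ.<-≤-trans (ℤ.suc[i]≤j⇒i<j (subst (ℤ._≤ ℤ.+ suc s) eq (size≤ q)))
                   (subst (ℤ.+ suc s ℤ.≤_) (ℤ.+-identityʳ (size p)) le)))
    improve (suc fuel) p le (q , q-clique , eq) = grow fuel q q-clique
      (ℤ.≤-trans le (ℤ.≤-reflexive (trans (shift (size p) (ℤ.+ fuel)) (cong (ℤ._+ ℤ.+ fuel) (sym eq)))))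
      where
      shift : ∀ a b → a ℤ.+ ℤ.suc b ≡ ℤ.suc a ℤ.+ b
      shift a b = trans (sym (ℤ.+-assoc a ℤ.1ℤ b)) (cong (ℤ._+ b) (ℤ.+-comm a ℤ.1ℤ))

  private variable
    i j x x′ y y′ : V

  -- If the two given neighbours of `x` are joined to `x′` by the opposite colour as well, then
  -- `xx′` and the edge between them are the only edges of colour `c`; likewise with `x` and `x′`
  -- exchanged. Otherwise `x` has an opposite neighbour `u` with `x′u` of colour `c`, and `x′` has
  -- such a `v`; then `xu` and `x′v` are the only edges of the opposite colour.
  double : ∀ c (U : V → Set) → (∀ {u v} → U u → U v → u ≢ v → col u v ≡ c) →
           x ≢ x′ → col x x′ ≡ c → ¬ U x → ¬ U x′ →
           ∀ {u₁ u₂ u₃ u₄} → U u₁ → U u₂ → U u₃ → U u₄ → u₁ ≢ u₂ → u₃ ≢ u₄ →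
           col x u₁ ≡ opposite c → col x u₂ ≡ opposite c →
           col x′ u₃ ≡ opposite c → col x′ u₄ ≡ opposite c → Pattern col
  double {x} {x′} c U U-clique x≢x′ xx′ x∉U x′∉U U₁ U₂ U₃ U₄ u₁≢u₂ u₃≢u₄ xu₁ xu₂ x′u₃ x′u₄
    = result (common x′ U₁ U₂ u₁≢u₂ xu₁ xu₂) (common x U₃ U₄ u₃≢u₄ x′u₃ x′u₄)
    where
    _∉U⇒≢_ : ∀ {v u} → ¬ U v → U u → v ≢ u
    (v∉U ∉U⇒≢ Uu) refl = v∉U Uu
    common : ∀ w {v v′ y} → U v → U v′ → v ≢ v′ → col y v ≡ opposite c → col y v′ ≡ opposite c →
             (∃[ u ] ∃[ u′ ] (U u × U u′ × u ≢ u′ × col y u ≡ opposite c × col y u′ ≡ opposite c ×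
                              col w u ≡ opposite c × col w u′ ≡ opposite c)) ⊎
             (∃[ u ] (U u × col y u ≡ opposite c × col w u ≡ c))
    common w {v} {v′} Uv Uv′ v≢v′ yv yv′ with col w v ≟ᶜ c | col w v′ ≟ᶜ c
    ... | yes wv | _      = inj₂ (v , Uv , yv , wv)
    ... | no _   | yes wv = inj₂ (v′ , Uv′ , yv′ , wv)
    ... | no n   | no n′  = inj₁ (v , v′ , Uv , Uv′ , v≢v′ , yv , yv′ , ≢⇒opposite n , ≢⇒opposite n′)
    monochromatic : ∀ {u u′} → U u → U u′ → u ≢ u′ → col x u ≡ opposite c → col x u′ ≡ opposite c →
                    col x′ u ≡ opposite c → col x′ u′ ≡ opposite c → Pattern col
    monochromatic {u} {u′} Uu Uu′ u≢u′ xu xu′ x′u x′u′ = c , x ∷ x′ ∷ u ∷ u′ ∷ [] ,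
      (x≢x′ ∷ (x∉U ∉U⇒≢ Uu) ∷ (x∉U ∉U⇒≢ Uu′) ∷ []) ∷ ((x′∉U ∉U⇒≢ Uu) ∷ (x′∉U ∉U⇒≢ Uu′) ∷ []) ∷
        (u≢u′ ∷ []) ∷ [] ∷ [] ,
      (xx′ , xu , xu′) , (x′u , x′u′) , U-clique Uu Uu′ u≢u′ , tt , tt
    result : _ → _ → Pattern col
    result (inj₁ (u , u′ , Uu , Uu′ , u≢u′ , xu , xu′ , x′u , x′u′)) _ =
      monochromatic Uu Uu′ u≢u′ xu xu′ x′u x′u′
    result _ (inj₁ (u , u′ , Uu , Uu′ , u≢u′ , x′u , x′u′ , xu , xu′)) =
      monochromatic Uu Uu′ u≢u′ xu xu′ x′u x′u′
    result (inj₂ (u , Uu , xu , x′u)) (inj₂ (v , Uv , x′v , xv)) =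
      opposite c , x ∷ u ∷ x′ ∷ v ∷ [] ,
      ((x∉U ∉U⇒≢ Uu) ∷ x≢x′ ∷ (x∉U ∉U⇒≢ Uv) ∷ []) ∷ ((λ e → (x′∉U ∉U⇒≢ Uu) (sym e)) ∷ u≢v ∷ []) ∷
        ((x′∉U ∉U⇒≢ Uv) ∷ []) ∷ [] ∷ [] ,
      (xu , back xx′ , back xv) , (back (trans (symm u x′) x′u) , back (U-clique Uu Uv u≢v)) , x′v , tt , tt
      where
      back : ∀ {d} → d ≡ c → d ≡ opposite (opposite c)
      back e = trans e (sym (opposite-involutive c))
      u≢v : u ≢ v
      u≢v refl = opposite≢ xu xv

  module _ (¬pattern : ¬ Pattern col) (saturated-clique : Saturated) where

    open Saturated saturated-clique

    OuterEdge : V → V → Set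
    OuterEdge x y = K x ≡ false × K y ≡ false × x ≢ y × col x y ≡ red

    opaque
      outerEdge? : ∀ x y → Dec (OuterEdge x y)
      outerEdge? x y = (K x Bool.≟ false) ×-dec (K y Bool.≟ false) ×-dec ¬? (x Fin.≟ y) ×-dec (col x y ≟ᶜ red)

    OuterEdge-sym : OuterEdge x y → OuterEdge y x
    OuterEdge-sym {x} {y} (Ox , Oy , x≢y , xy) = Oy , Ox , x≢y ∘ sym , trans (symm y x) xy

    -- Two is the number of neighbours that `double` asks for. By maximality of `K`, an outer vertex
    -- that is not deficient has exactly one blue neighbour in `K`.
    Deficient : V → Set
    Deficient x = ∃[ z ] ∃[ z′ ] (z ≢ z′ × K z ≡ true × K z′ ≡ true × col x z ≡ blue × col x z′ ≡ blue)

    opaque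
      deficient? : ∀ x → Dec (Deficient x)
      deficient? x = Fin.any? λ z → Fin.any? λ z′ → ¬? (z Fin.≟ z′) ×-dec
        (K z Bool.≟ true) ×-dec (K z′ Bool.≟ true) ×-dec (col x z ≟ᶜ blue) ×-dec (col x z′ ≟ᶜ blue)

    ∉K : K x ≡ false → ¬ K x ≡ true
    ∉K x∉K x∈K with () ← trans (sym x∉K) x∈K

    deficient-edge : OuterEdge x y → Deficient x → ¬ Deficient y
    deficient-edge (Ox , Oy , x≢y , xy) (_ , _ , z≢z′ , Kz , Kz′ , xz , xz′) (_ , _ , w≢w′ , Kw , Kw′ , yw , yw′) =
      ¬pattern (double red (λ u → K u ≡ true) (λ Ku Kv u≢v → clique u≢v Ku Kv)
        x≢y xy (∉K Ox) (∉K Oy) Kz Kz′ Kw Kw′ z≢z′ w≢w′ xz xz′ yw yw′)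

    blue-into-K : K x ≡ false → ∃[ z ] (K z ≡ true × col x z ≡ blue)
    blue-into-K {x} Ox with Fin.any? (λ z → (K z Bool.≟ true) ×-dec (col x z ≟ᶜ blue))
    ... | yes found = found
    ... | no none   = ⊥-elim (no-extension (x , Ox , λ z Kz → ≢⇒opposite (λ xz → none (z , Kz , xz))))

    red-elsewhere : ∀ {z} → ¬ Deficient x → K z ≡ true → col x z ≡ blue → AllRedBut K z x
    red-elsewhere {x} {z} nd Kz xz w Kw w≢z = ≢⇒opposite (λ xw → nd (w , z , w≢z , Kw , Kz , xw , xz))

    -- Each end would have a single blue neighbour in `K`. A common one permits an exchange; two
    -- different ones give two disjoint blue edges with only red ones between them.
    deficient-endpoint : OuterEdge x y → ¬ Deficient x → ¬ Deficient y → ⊥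
    deficient-endpoint {x} {y} (Ox , Oy , x≢y , xy) ndx ndy
      with blue-into-K Ox | blue-into-K Oy
    ... | z , Kz , xz | w , Kw , yw with z Fin.≟ w
    ... | yes refl = no-exchange (x , y , z , Ox , Oy , x≢y , xy , Kz ,
                                  red-elsewhere ndx Kz xz , red-elsewhere ndy Kw yw)
    ... | no z≢w = ¬pattern (blue , x ∷ z ∷ y ∷ w ∷ [] ,
        ((Ox ≢K Kz) ∷ x≢y ∷ (Ox ≢K Kw) ∷ []) ∷ ((Oy ≢K Kz) ∘ sym ∷ z≢w ∷ []) ∷ ((Oy ≢K Kw) ∷ []) ∷ [] ∷ [] ,
        (xz , xy , red-elsewhere ndx Kz xz w Kw (z≢w ∘ sym)) ,
        (trans (symm z y) (red-elsewhere ndy Kw yw z Kz z≢w) , clique z≢w Kz Kw) , yw , tt , tt)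
      where
      _≢K_ : ∀ {u v} → K u ≡ false → K v ≡ true → u ≢ v
      (Ou ≢K Kv) refl = ∉K Ou Kv

    Branching : V → Set
    Branching x = K x ≡ false × ¬ Deficient x × ∃[ y ] ∃[ y′ ] (y ≢ y′ × OuterEdge x y × OuterEdge x y′)

    opaque
      branching? : ∀ x → Dec (Branching x)
      branching? x = (K x Bool.≟ false) ×-dec ¬? (deficient? x) ×-dec
        Fin.any? λ y → Fin.any? λ y′ → ¬? (y Fin.≟ y′) ×-dec outerEdge? x y ×-dec outerEdge? x y′

    -- Red outer edges run only between deficient and non-deficient vertices, so both classes are
    -- blue cliques. Two branching vertices therefore meet the hypotheses of `double` with the
    -- colours swapped and the deficient outer vertices as `U`.
    branching-unique : Branching x → Branching x′ → x ≡ x′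
    branching-unique {x} {x′} (Ox , ndx , y₁ , y₂ , y₁≢y₂ , e₁ , e₂) (Ox′ , ndx′ , y₃ , y₄ , y₃≢y₄ , e₃ , e₄)
      with x Fin.≟ x′
    ... | yes x≡x′ = x≡x′
    ... | no x≢x′  = ⊥-elim (¬pattern (double blue U U-clique x≢x′ xx′
            (ndx ∘ proj₂) (ndx′ ∘ proj₂) (inU ndx e₁) (inU ndx e₂) (inU ndx′ e₃) (inU ndx′ e₄)
            y₁≢y₂ y₃≢y₄ (red-edge e₁) (red-edge e₂) (red-edge e₃) (red-edge e₄)))
      where
      U : V → Set
      U y = K y ≡ false × Deficient y
      U-clique : ∀ {u v} → U u → U v → u ≢ v → col u v ≡ blue
      U-clique (Ou , du) (Ov , dv) u≢v = ≢⇒opposite (λ uv → deficient-edge (Ou , Ov , u≢v , uv) du dv)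
      xx′ : col x x′ ≡ blue
      xx′ = ≢⇒opposite (λ r → deficient-endpoint (Ox , Ox′ , x≢x′ , r) ndx ndx′)
      red-edge : ∀ {u v} → OuterEdge u v → col u v ≡ red
      red-edge (_ , _ , _ , uv) = uv
      inU : ∀ {u v} → ¬ Deficient u → OuterEdge u v → U v
      inU {v = v} ndu e@(_ , Ov , _) with deficient? v
      ... | yes dv = Ov , dv
      ... | no ndv = ⊥-elim (deficient-endpoint e ndu ndv)

    opaque
      centre : ∃[ c ] (∀ {x} → Branching x → x ≡ c)
      centre with Fin.any? branching?
      ... | yes (c , bc) = c , λ bx → branching-unique bx bc
      -- Without branching vertices the claim is vacuous, and any vertex serves as default.
      ... | no none      = fzero , λ bx → ⊥-elim (none (_ , bx))

    opaque
      neighbour : ∀ x → ∃[ y ] (¬ Branching x → ¬ Deficient x → ∀ {j} → OuterEdge x j → j ≡ y)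
      neighbour x with Fin.any? (outerEdge? x)
      ... | no none     = x , λ _ _ e → ⊥-elim (none (_ , e))
      ... | yes (y , e) = y , λ nb nd {j} e′ → case j Fin.≟ y of λ where
              (yes j≡y) → j≡y
              (no j≢y)  → ⊥-elim (nb (proj₁ e , nd , j , y , j≢y , e′ , e))

    L = allFin (suc s)
    c₀ = proj₁ centre
    ν : V → V
    ν x = proj₁ (neighbour x)

    δ : V → V → ℤ.ℤ
    δ a b = ι (does (a Fin.≟ b))

    ∑∑-graph : ∀ (f : V → V) → ∑ L (λ i → ∑ L (λ j → δ j (f i))) ≡ ℤ.+ suc s
    ∑∑-graph f = trans (∑-cong (λ i → ∑-Kronecker (f i)) L)
      (trans (∑-allFin-const (suc s) ℤ.1ℤ) (ℤ.*-identityʳ (ℤ.+ suc s)))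

    outer : V → V → ℤ.ℤ
    outer i j = ι (does (outerEdge? i j))

    δ-refl : ∀ {a b} → a ≡ b → δ a b ≡ ℤ.1ℤ
    δ-refl {a} refl with a Fin.≟ a
    ... | yes _  = refl
    ... | no a≢a = ⊥-elim (a≢a refl)

    0≤δ : ∀ a b → ℤ.0ℤ ℤ.≤ δ a b
    0≤δ a b = 0≤ι (does (a Fin.≟ b))

    -- A red outer edge has a non-deficient end. If that end branches it is `c₀`; if not, the other
    -- end is its only red outer neighbour, given by `ν`. The bound is symmetric because either end
    -- may be the non-deficient one, and each of its four terms sums to `suc s`.
    outer≤ : ∀ i j → outer i j ℤ.≤ (δ i c₀ ℤ.+ δ j (ν i)) ℤ.+ (δ j c₀ ℤ.+ δ i (ν j))
    outer≤ i j with outerEdge? i j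
    ... | no _  = ℤ.+-mono-≤ (ℤ.+-mono-≤ (0≤δ i c₀) (0≤δ j (ν i))) (ℤ.+-mono-≤ (0≤δ j c₀) (0≤δ i (ν j)))
    ... | yes e = by-deficiency (deficient? i)
      where
      half : ∀ {u v} → OuterEdge u v → ¬ Deficient u → ℤ.1ℤ ℤ.≤ δ u c₀ ℤ.+ δ v (ν u)
      half {u} {v} e nd with branching? u
      ... | yes b = ℤ.+-mono-≤ (ℤ.≤-reflexive (sym (δ-refl (proj₂ centre b)))) (0≤δ v (ν u))
      ... | no nb = ℤ.+-mono-≤ (0≤δ u c₀) (ℤ.≤-reflexive (sym (δ-refl (proj₂ (neighbour u) nb nd e))))
      by-deficiency : Dec (Deficient i) →
                      ℤ.1ℤ ℤ.≤ (δ i c₀ ℤ.+ δ j (ν i)) ℤ.+ (δ j c₀ ℤ.+ δ i (ν j))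
      by-deficiency (no nd) = ℤ.+-mono-≤ (half e nd) (ℤ.+-mono-≤ (0≤δ j c₀) (0≤δ i (ν j)))
      by-deficiency (yes d) = ℤ.+-mono-≤ (ℤ.+-mono-≤ (0≤δ i c₀) (0≤δ j (ν i)))
                                         (half (OuterEdge-sym e) (deficient-edge e d))

    ∑∑-outer : ∑∑ L outer ℤ.≤ ℤ.+ 4 ℤ.* ℤ.+ suc s
    ∑∑-outer = begin
      ∑∑ L outer ≤⟨ ∑-mono (λ i → ∑-mono (outer≤ i) L) L ⟩
      ∑∑ L (λ i j → (δ i c₀ ℤ.+ δ j (ν i)) ℤ.+ (δ j c₀ ℤ.+ δ i (ν j)))
        ≡⟨ trans (∑∑-+ (λ i j → δ i c₀ ℤ.+ δ j (ν i)) (λ i j → δ j c₀ ℤ.+ δ i (ν j)) L)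
             (cong₂ ℤ._+_ (∑∑-+ (λ i j → δ i c₀) (λ i j → δ j (ν i)) L) (∑∑-+ (λ i j → δ j c₀) (λ i j → δ i (ν j)) L)) ⟩
      (∑∑ L (λ i j → δ i c₀) ℤ.+ ∑∑ L (λ i j → δ j (ν i))) ℤ.+ (∑∑ L (λ i j → δ j c₀) ℤ.+ ∑∑ L (λ i j → δ i (ν j)))
        ≡⟨ cong₂ ℤ._+_ (cong₂ ℤ._+_ (trans (∑-swap (λ i j → δ i c₀) L L) (∑∑-graph (λ _ → c₀))) (∑∑-graph ν))
                       (cong₂ ℤ._+_ (∑∑-graph (λ _ → c₀)) (trans (∑-swap (λ i j → δ i (ν j)) L L) (∑∑-graph ν))) ⟩
      (S ℤ.+ S) ℤ.+ (S ℤ.+ S) ≡⟨ four S ⟩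
      ℤ.+ 4 ℤ.* S ∎
      where
      open ℤ.≤-Reasoning
      S = ℤ.+ suc s
      four : ∀ a → (a ℤ.+ a) ℤ.+ (a ℤ.+ a) ≡ ℤ.+ 4 ℤ.* a
      four = solve-∀

    -- The colour that is nearly absent on the vertex's own side, so that agreement with it comes
    -- almost only from crossing pairs.
    target : Bool → Colour
    target b = if b then blue else red

    -- With signs, the number of ordered crossing pairs is half of S² minus the square of the sum of
    -- the signs, hence at most S²/2 whatever the sizes of the two sides.
    sign : Bool → ℤ.ℤ
    sign b = if b then ℤ.1ℤ else ℤ.-1ℤ

    agree : Colour → Colour → ℤ.ℤ
    agree c d = ι (does (c ≟ᶜ d))

    -- A crossing pair agrees with the target of exactly one of its ends, which gives 2 on both
    -- sides. A pair on one side agrees with both targets or with neither, and `e` pays for the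
    -- former.
    agreements≤ : ∀ a b c e → ℤ.0ℤ ℤ.≤ e → (a ≡ b → c ≡ target a → ℤ.1ℤ ℤ.≤ e) →
      ℤ.+ 2 ℤ.* (agree c (target a) ℤ.+ agree c (target b)) ℤ.≤
      (ℤ.1ℤ ℤ.+ ℤ.-1ℤ ℤ.* (sign a ℤ.* sign b)) ℤ.+ ℤ.+ 4 ℤ.* e
    agreements≤ a b c e 0≤e 1≤e = cases a b c 1≤e
      where
      0≤4e : ℤ.0ℤ ℤ.≤ ℤ.+ 4 ℤ.* e
      0≤4e = ℤ.*-monoˡ-≤-nonNeg (ℤ.+ 4) 0≤e
      2≤2+4e : ℤ.+ 2 ℤ.≤ ℤ.+ 2 ℤ.+ ℤ.+ 4 ℤ.* e
      2≤2+4e = ℤ.+-monoʳ-≤ (ℤ.+ 2) 0≤4e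
      0≤0+4e : ℤ.0ℤ ℤ.≤ ℤ.0ℤ ℤ.+ ℤ.+ 4 ℤ.* e
      0≤0+4e = ℤ.+-monoʳ-≤ ℤ.0ℤ 0≤4e
      4≤0+4e : ℤ.1ℤ ℤ.≤ e → ℤ.+ 4 ℤ.≤ ℤ.0ℤ ℤ.+ ℤ.+ 4 ℤ.* e
      4≤0+4e 1≤e = ℤ.+-monoʳ-≤ ℤ.0ℤ (ℤ.*-monoˡ-≤-nonNeg (ℤ.+ 4) 1≤e)
      cases : ∀ a b c → (a ≡ b → c ≡ target a → ℤ.1ℤ ℤ.≤ e) →
        ℤ.+ 2 ℤ.* (agree c (target a) ℤ.+ agree c (target b)) ℤ.≤
        (ℤ.1ℤ ℤ.+ ℤ.-1ℤ ℤ.* (sign a ℤ.* sign b)) ℤ.+ ℤ.+ 4 ℤ.* e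
      cases true  true  red  _   = 0≤0+4e
      cases true  true  blue 1≤e = 4≤0+4e (1≤e refl refl)
      cases true  false red  _   = 2≤2+4e
      cases true  false blue _   = 2≤2+4e
      cases false true  red  _   = 2≤2+4e
      cases false true  blue _   = 2≤2+4e
      cases false false red  1≤e = 4≤0+4e (1≤e refl refl)
      cases false false blue _   = 0≤0+4e

    κ : V → Colour
    κ = target ∘ K

    count : V → V → ℤ.ℤ
    count i j = agree (col i j) (κ i)

    -- The first term pays for the diagonal, whose colour is arbitrary.
    excess : V → V → ℤ.ℤ
    excess i j = δ j i ℤ.+ outer i j

    count≤ : ∀ i j → ℤ.+ 2 ℤ.* (count i j ℤ.+ count j i) ℤ.≤
      (ℤ.1ℤ ℤ.+ ℤ.-1ℤ ℤ.* (sign (K i) ℤ.* sign (K j))) ℤ.+ ℤ.+ 4 ℤ.* excess i j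
    count≤ i j rewrite symm j i = agreements≤ (K i) (K j) (col i j) (excess i j)
      (ℤ.+-mono-≤ (0≤δ j i) 0≤outer) 1≤excess
      where
      0≤outer : ℤ.0ℤ ℤ.≤ outer i j
      0≤outer = 0≤ι (does (outerEdge? i j))
      1≤excess : K i ≡ K j → col i j ≡ target (K i) → ℤ.1ℤ ℤ.≤ excess i j
      1≤excess Ki≡Kj cij with j Fin.≟ i | K i in Ki | K j in Kj
      ... | yes refl | _     | _     = ℤ.+-monoʳ-≤ ℤ.1ℤ 0≤outer
      ... | no j≢i   | true  | true  with () ← trans (sym cij) (clique (j≢i ∘ sym) Ki Kj)
      ... | no j≢i   | false | false = ℤ.+-monoʳ-≤ ℤ.0ℤ (1≤ι (outerEdge? i j) (Ki , Kj , j≢i ∘ sym , cij))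

    -- The 20 is 4 (1 + 4): one S for the diagonal and four for the red outer pairs. The square of
    -- the sum of the signs is dropped.
    ∑∑-count : ℤ.+ 4 ℤ.* ∑∑ L count ℤ.≤ ℤ.+ suc s ℤ.* ℤ.+ suc s ℤ.+ ℤ.+ 20 ℤ.* ℤ.+ suc s
    ∑∑-count = begin
      ℤ.+ 4 ℤ.* T ≡⟨ double-T T ⟩
      ℤ.+ 2 ℤ.* (T ℤ.+ T)
        ≡⟨ cong (λ z → ℤ.+ 2 ℤ.* (T ℤ.+ z)) (∑-swap count L L) ⟩
      ℤ.+ 2 ℤ.* (T ℤ.+ ∑∑ L (λ i j → count j i))
        ≡⟨ trans (∑∑-*ˡ (ℤ.+ 2) (λ i j → count i j ℤ.+ count j i) L) (cong (ℤ.+ 2 ℤ.*_) (∑∑-+ count (λ i j → count j i) L)) ⟨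
      ∑∑ L (λ i j → ℤ.+ 2 ℤ.* (count i j ℤ.+ count j i))
        ≤⟨ ∑-mono (λ i → ∑-mono (count≤ i) L) L ⟩
      ∑∑ L (λ i j → (ℤ.1ℤ ℤ.+ ℤ.-1ℤ ℤ.* (sign (K i) ℤ.* sign (K j))) ℤ.+ ℤ.+ 4 ℤ.* excess i j)
        ≡⟨ trans (∑∑-+ (λ i j → ℤ.1ℤ ℤ.+ ℤ.-1ℤ ℤ.* signs i j) (λ i j → ℤ.+ 4 ℤ.* excess i j) L) (cong₂ ℤ._+_
             (trans (∑∑-+ (λ _ _ → ℤ.1ℤ) (λ i j → ℤ.-1ℤ ℤ.* signs i j) L)
               (cong₂ ℤ._+_ ∑∑-1 (trans (∑∑-*ˡ ℤ.-1ℤ signs L) (cong (ℤ.-1ℤ ℤ.*_) ∑∑-sign))))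
             (trans (∑∑-*ˡ (ℤ.+ 4) excess L) (cong (ℤ.+ 4 ℤ.*_) (trans (∑∑-+ (λ i j → δ j i) outer L)
               (cong (ℤ._+ ∑∑ L outer) (∑∑-graph (λ i → i))))))) ⟩
      (S ℤ.* S ℤ.+ ℤ.-1ℤ ℤ.* (Σσ ℤ.* Σσ)) ℤ.+ ℤ.+ 4 ℤ.* (S ℤ.+ ∑∑ L outer)
        ≤⟨ ℤ.+-mono-≤ (ℤ.+-monoʳ-≤ (S ℤ.* S) (-square≤0 Σσ))
                      (ℤ.*-monoˡ-≤-nonNeg (ℤ.+ 4) (ℤ.+-monoʳ-≤ S ∑∑-outer)) ⟩
      (S ℤ.* S ℤ.+ ℤ.0ℤ) ℤ.+ ℤ.+ 4 ℤ.* (S ℤ.+ ℤ.+ 4 ℤ.* S) ≡⟨ collect S ⟩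
      S ℤ.* S ℤ.+ ℤ.+ 20 ℤ.* S ∎
      where
      open ℤ.≤-Reasoning
      S = ℤ.+ suc s
      T = ∑∑ L count
      Σσ = ∑ L (sign ∘ K)
      signs : V → V → ℤ.ℤ
      signs i j = sign (K i) ℤ.* sign (K j)
      double-T : ∀ t → ℤ.+ 4 ℤ.* t ≡ ℤ.+ 2 ℤ.* (t ℤ.+ t)
      double-T = solve-∀
      collect : ∀ S → (S ℤ.* S ℤ.+ ℤ.0ℤ) ℤ.+ ℤ.+ 4 ℤ.* (S ℤ.+ ℤ.+ 4 ℤ.* S) ≡ S ℤ.* S ℤ.+ ℤ.+ 20 ℤ.* S
      collect = solve-∀
      ∑∑-1 : ∑∑ L (λ _ _ → ℤ.1ℤ) ≡ S ℤ.* S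
      ∑∑-1 = trans (∑-cong (λ _ → trans (∑-allFin-const (suc s) ℤ.1ℤ) (ℤ.*-identityʳ S)) L)
                   (∑-allFin-const (suc s) S)
      ∑∑-sign : ∑∑ L signs ≡ Σσ ℤ.* Σσ
      ∑∑-sign = trans (∑-cong (λ i → trans (∑-*ˡ (sign (K i)) (sign ∘ K) L) (ℤ.*-comm (sign (K i)) Σσ)) L)
                      (∑-*ˡ Σσ (sign ∘ K) L)
      -square≤0 : ∀ z → ℤ.-1ℤ ℤ.* (z ℤ.* z) ℤ.≤ ℤ.0ℤ
      -square≤0 z = subst (ℤ._≤ ℤ.0ℤ) (sym (ℤ.-1*i≡-i (z ℤ.* z))) (ℤ.neg-mono-≤ (0≤square z))

  almostSplit : ¬ Pattern col → ∃[ κ ]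
    ℤ.+ 4 ℤ.* ∑ (allFin (suc s)) (λ i → ∑ (allFin (suc s)) (λ j → ι (does (col i j ≟ᶜ κ i)))) ℤ.≤
    ℤ.+ suc s ℤ.* ℤ.+ suc s ℤ.+ ℤ.+ 20 ℤ.* ℤ.+ suc s
  almostSplit ¬pattern = κ ¬pattern saturated , ∑∑-count ¬pattern saturated

-- Sums over all tuples: marginals and second moments.

module Tuples {A : Set} (xs : List A) where

  open import Data.Fin using (punchOut)
  open import Data.Fin.Properties using (punchOut-injective)
  import Data.Integer as ℤ
  import Data.Integer.Properties as ℤ
  open import Data.List using (List; []; _∷_; length; cartesianProductWith)
  open import Data.Nat using (_+_; _^_)
  open import Data.Vec as Vec using (Vec; []; _∷_; lookup; removeAt; tabulate)
  open import Data.Vec.Properties using (removeAt-punchOut; tabulate-cong)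
  open import Function using (_∘_)
  open import Function.Definitions using (Injective)
  open import Relation.Binary.PropositionalEquality
  open IntegerSums

  -- The tail is the outer loop, so all extensions of one tuple are consecutive; the blow-up counts
  -- them tail by tail.
  tuples : ∀ r → List (Vec A r)
  tuples zero    = [] ∷ []
  tuples (suc r) = cartesianProductWith (λ p v → v ∷ p) (tuples r) xs

  private
    N : ℕ
    N = length xs

  ∑-tuples-suc : ∀ r (f : Vec A (suc r) → ℤ.ℤ) →
                 ∑ (tuples (suc r)) f ≡ ∑ xs (λ v → ∑ (tuples r) (λ p → f (v ∷ p)))
  ∑-tuples-suc r f = trans (∑-product f (λ p v → v ∷ p) (tuples r) xs)
                           (∑-swap (λ p v → f (v ∷ p)) (tuples r) xs)

  ∑-tuples-const : ∀ r c → ∑ (tuples r) (λ _ → c) ≡ ℤ.+ (N ^ r) ℤ.* c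
  ∑-tuples-const zero    c = trans (ℤ.+-identityʳ c) (sym (ℤ.*-identityˡ c))
  ∑-tuples-const (suc r) c = begin
    ∑ (tuples (suc r)) (λ _ → c)              ≡⟨ ∑-tuples-suc r (λ _ → c) ⟩
    ∑ xs (λ v → ∑ (tuples r) (λ _ → c))       ≡⟨ ∑-cong (λ _ → ∑-tuples-const r c) xs ⟩
    ∑ xs (λ v → ℤ.+ (N ^ r) ℤ.* c)            ≡⟨ ∑-const (ℤ.+ (N ^ r) ℤ.* c) xs ⟩
    ℤ.+ N ℤ.* (ℤ.+ (N ^ r) ℤ.* c)             ≡⟨ ℤ.*-assoc (ℤ.+ N) (ℤ.+ (N ^ r)) c ⟨
    ℤ.+ N ℤ.* ℤ.+ (N ^ r) ℤ.* c               ≡⟨ cong (ℤ._* c) (ℤ.pos-* N (N ^ r)) ⟨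
    ℤ.+ (N ^ suc r) ℤ.* c                     ∎
    where open ≡-Reasoning

  -- A change in the order of summation: any coordinate may be drawn first, independently of the
  -- others.
  ∑-removeAt : ∀ {s} (i : Fin (suc s)) (H : A → Vec A s → ℤ.ℤ) →
    ∑ (tuples (suc s)) (λ x → H (lookup x i) (removeAt x i)) ≡ ∑ xs (λ v → ∑ (tuples s) (H v))
  ∑-removeAt {s} Fin.zero H = ∑-tuples-suc s (λ x → H (lookup x Fin.zero) (removeAt x Fin.zero))
  ∑-removeAt {suc s} (Fin.suc i) H = begin
    ∑ (tuples (suc (suc s))) (λ x → H (lookup x (Fin.suc i)) (removeAt x (Fin.suc i)))
      ≡⟨ ∑-tuples-suc (suc s) (λ x → H (lookup x (Fin.suc i)) (removeAt x (Fin.suc i))) ⟩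
    ∑ xs (λ u → ∑ (tuples (suc s)) (λ p → H (lookup p i) (removeAt (u ∷ p) (Fin.suc i))))
      ≡⟨ ∑-cong (λ u → ∑-cong (λ { (_ ∷ _) → refl }) (tuples (suc s))) xs ⟩
    ∑ xs (λ u → ∑ (tuples (suc s)) (λ p → H (lookup p i) (u ∷ removeAt p i)))
      ≡⟨ ∑-cong (λ u → ∑-removeAt i (λ v q → H v (u ∷ q))) xs ⟩
    ∑ xs (λ u → ∑ xs (λ v → ∑ (tuples s) (λ q → H v (u ∷ q))))
      ≡⟨ ∑-swap (λ u v → ∑ (tuples s) (λ q → H v (u ∷ q))) xs xs ⟩
    ∑ xs (λ v → ∑ xs (λ u → ∑ (tuples s) (λ q → H v (u ∷ q))))
      ≡⟨ ∑-cong (λ v → ∑-tuples-suc s (H v)) xs ⟨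
    ∑ xs (λ v → ∑ (tuples (suc s)) (H v)) ∎
    where open ≡-Reasoning

  -- Distinct positions of a uniform tuple form a uniform tuple. Position `e 0` is removed first,
  -- and `punchOut` renumbers the remaining ones in the shorter tuple.
  ∑-marginal : ∀ r s (e : Fin r → Fin (r + s)) → Injective _≡_ _≡_ e → (F : Vec A r → ℤ.ℤ) →
    ∑ (tuples (r + s)) (λ x → F (tabulate (lookup x ∘ e))) ≡ ℤ.+ (N ^ s) ℤ.* ∑ (tuples r) F
  ∑-marginal zero    s e inj F = trans (∑-tuples-const s (F [])) (cong (ℤ.+ (N ^ s) ℤ.*_) (sym (ℤ.+-identityʳ (F []))))
  ∑-marginal (suc r) s e inj F = begin
    ∑ (tuples (suc r + s)) (λ x → F (lookup x i ∷ tabulate (λ k → lookup x (e (Fin.suc k)))))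
      ≡⟨ ∑-cong (λ x → cong (λ p → F (lookup x i ∷ p))
                             (tabulate-cong (λ k → sym (removeAt-punchOut x (i≢ k))))) (tuples (suc r + s)) ⟩
    ∑ (tuples (suc r + s)) (λ x → F (lookup x i ∷ tabulate (lookup (removeAt x i) ∘ e′)))
      ≡⟨ ∑-removeAt i (λ v y → F (v ∷ tabulate (lookup y ∘ e′))) ⟩
    ∑ xs (λ v → ∑ (tuples (r + s)) (λ y → F (v ∷ tabulate (lookup y ∘ e′))))
      ≡⟨ ∑-cong (λ v → ∑-marginal r s e′ inj′ (λ p → F (v ∷ p))) xs ⟩
    ∑ xs (λ v → ℤ.+ (N ^ s) ℤ.* ∑ (tuples r) (λ p → F (v ∷ p)))
      ≡⟨ ∑-*ˡ (ℤ.+ (N ^ s)) (λ v → ∑ (tuples r) (λ p → F (v ∷ p))) xs ⟩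
    ℤ.+ (N ^ s) ℤ.* ∑ xs (λ v → ∑ (tuples r) (λ p → F (v ∷ p)))
      ≡⟨ cong (ℤ.+ (N ^ s) ℤ.*_) (∑-tuples-suc r F) ⟨
    ℤ.+ (N ^ s) ℤ.* ∑ (tuples (suc r)) F ∎
    where
    open ≡-Reasoning
    i = e Fin.zero
    i≢ : ∀ k → i ≢ e (Fin.suc k)
    i≢ k eq with () ← inj eq
    e′ : Fin r → Fin (r + s)
    e′ k = punchOut (i≢ k)
    inj′ : Injective _≡_ _≡_ e′
    inj′ {k} {l} eq with refl ← inj (punchOut-injective (i≢ k) (i≢ l) eq) = refl

  total : ∀ {s} → (A → ℤ.ℤ) → Vec A s → ℤ.ℤ
  total f []      = ℤ.0ℤ
  total f (v ∷ x) = f v ℤ.+ total f x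

  total-removeAt : ∀ {s} f (x : Vec A (suc s)) i → total f x ≡ f (lookup x i) ℤ.+ total f (removeAt x i)
  total-removeAt f (v ∷ x)         Fin.zero    = refl
  total-removeAt f (v ∷ x@(_ ∷ _)) (Fin.suc i) =
    trans (cong (ℤ._+_ (f v)) (total-removeAt f x i)) (exchange (f v) (f (lookup x i)) (total f (removeAt x i)))
    where
    open import Data.Integer.Tactic.RingSolver using (solve-∀)
    exchange : ∀ a b c → a ℤ.+ (b ℤ.+ c) ≡ b ℤ.+ (a ℤ.+ c)
    exchange = solve-∀

  total-lookup : ∀ {s} f (x : Vec A s) → total f x ≡ ∑ (Data.List.allFin s) (f ∘ lookup x)
  total-lookup f []              = refl
  total-lookup {suc s} f (v ∷ x) =
    trans (cong (ℤ._+_ (f v)) (total-lookup f x)) (sym (∑-allFin-suc {s} (f ∘ lookup (v ∷ x))))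

  -- The cross terms of the square vanish because f is centred.
  secondMoment : ∀ f → ∑ xs f ≡ ℤ.0ℤ → (∀ v → f v ℤ.* f v ℤ.≤ ℤ.+ N ℤ.* ℤ.+ N) → ∀ s c →
    ∑ (tuples s) (λ x → (c ℤ.+ total f x) ℤ.* (c ℤ.+ total f x)) ℤ.≤
    ℤ.+ (N ^ s) ℤ.* (c ℤ.* c ℤ.+ ℤ.+ s ℤ.* (ℤ.+ N ℤ.* ℤ.+ N))
  secondMoment f centred f²≤N² = go
    where
    open ℤ.≤-Reasoning
    open import Data.Integer.Tactic.RingSolver using (solve-∀)
    N² = ℤ.+ N ℤ.* ℤ.+ N
    sq : ℤ.ℤ → ℤ.ℤ
    sq z = z ℤ.* z
    expand : ∀ c z M → (c ℤ.+ z) ℤ.* (c ℤ.+ z) ℤ.+ M ≡ (c ℤ.* c ℤ.+ M ℤ.+ z ℤ.* z) ℤ.+ (c ℤ.+ c) ℤ.* z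
    expand = solve-∀
    regroup : ∀ n p c N² s → p ℤ.* (n ℤ.* (c ℤ.* c ℤ.+ s ℤ.* N² ℤ.+ N²) ℤ.+ (c ℤ.+ c) ℤ.* ℤ.0ℤ) ≡
              n ℤ.* p ℤ.* (c ℤ.* c ℤ.+ (ℤ.1ℤ ℤ.+ s) ℤ.* N²)
    regroup = solve-∀
    base : ∀ c N² → (c ℤ.+ ℤ.0ℤ) ℤ.* (c ℤ.+ ℤ.0ℤ) ℤ.+ ℤ.0ℤ ≡ ℤ.1ℤ ℤ.* (c ℤ.* c ℤ.+ ℤ.0ℤ ℤ.* N²)
    base = solve-∀
    -- The induction varies the offset `c`, which collects the values already drawn.
    go : ∀ s c → ∑ (tuples s) (λ x → sq (c ℤ.+ total f x)) ℤ.≤ ℤ.+ (N ^ s) ℤ.* (c ℤ.* c ℤ.+ ℤ.+ s ℤ.* N²)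
    go zero    c = ℤ.≤-reflexive (base c N²)
    go (suc s) c = begin
      ∑ (tuples (suc s)) (λ x → sq (c ℤ.+ total f x))
        ≡⟨ ∑-tuples-suc s (λ x → sq (c ℤ.+ total f x)) ⟩
      ∑ xs (λ v → ∑ (tuples s) (λ x → sq (c ℤ.+ (f v ℤ.+ total f x))))
        ≡⟨ ∑-cong (λ v → ∑-cong (λ x → cong sq (sym (ℤ.+-assoc c (f v) (total f x)))) (tuples s)) xs ⟩
      ∑ xs (λ v → ∑ (tuples s) (λ x → sq ((c ℤ.+ f v) ℤ.+ total f x)))
        ≤⟨ ∑-mono (λ v → go s (c ℤ.+ f v)) xs ⟩
      ∑ xs (λ v → p ℤ.* (sq (c ℤ.+ f v) ℤ.+ ℤ.+ s ℤ.* N²))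
        ≡⟨ ∑-*ˡ p (λ v → sq (c ℤ.+ f v) ℤ.+ ℤ.+ s ℤ.* N²) xs ⟩
      p ℤ.* ∑ xs (λ v → sq (c ℤ.+ f v) ℤ.+ ℤ.+ s ℤ.* N²)
        ≡⟨ cong (p ℤ.*_) (trans (∑-cong (λ v → expand c (f v) (ℤ.+ s ℤ.* N²)) xs)
             (∑-+ (λ v → c ℤ.* c ℤ.+ ℤ.+ s ℤ.* N² ℤ.+ sq (f v)) (λ v → (c ℤ.+ c) ℤ.* f v) xs)) ⟩
      p ℤ.* (∑ xs (λ v → c ℤ.* c ℤ.+ ℤ.+ s ℤ.* N² ℤ.+ sq (f v)) ℤ.+ ∑ xs (λ v → (c ℤ.+ c) ℤ.* f v))
        ≡⟨ cong (λ z → p ℤ.* (∑ xs (λ v → c ℤ.* c ℤ.+ ℤ.+ s ℤ.* N² ℤ.+ sq (f v)) ℤ.+ z))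
                (trans (∑-*ˡ (c ℤ.+ c) f xs) (cong ((c ℤ.+ c) ℤ.*_) centred)) ⟩
      p ℤ.* (∑ xs (λ v → c ℤ.* c ℤ.+ ℤ.+ s ℤ.* N² ℤ.+ sq (f v)) ℤ.+ (c ℤ.+ c) ℤ.* ℤ.0ℤ)
        ≤⟨ ℤ.*-monoˡ-≤-nonNeg p (ℤ.+-monoˡ-≤ ((c ℤ.+ c) ℤ.* ℤ.0ℤ)
             (∑-mono (λ v → ℤ.+-monoʳ-≤ (c ℤ.* c ℤ.+ ℤ.+ s ℤ.* N²) (f²≤N² v)) xs)) ⟩
      p ℤ.* (∑ xs (λ v → c ℤ.* c ℤ.+ ℤ.+ s ℤ.* N² ℤ.+ N²) ℤ.+ (c ℤ.+ c) ℤ.* ℤ.0ℤ)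
        ≡⟨ cong (λ z → p ℤ.* (z ℤ.+ (c ℤ.+ c) ℤ.* ℤ.0ℤ)) (∑-const (c ℤ.* c ℤ.+ ℤ.+ s ℤ.* N² ℤ.+ N²) xs) ⟩
      p ℤ.* (ℤ.+ N ℤ.* (c ℤ.* c ℤ.+ ℤ.+ s ℤ.* N² ℤ.+ N²) ℤ.+ (c ℤ.+ c) ℤ.* ℤ.0ℤ)
        ≡⟨ regroup (ℤ.+ N) p c N² (ℤ.+ s) ⟩
      ℤ.+ N ℤ.* p ℤ.* (c ℤ.* c ℤ.+ ℤ.+ suc s ℤ.* N²)
        ≡⟨ cong (ℤ._* (c ℤ.* c ℤ.+ ℤ.+ suc s ℤ.* N²)) (ℤ.pos-* N (N ^ s)) ⟨
      ℤ.+ (N ^ suc s) ℤ.* (c ℤ.* c ℤ.+ ℤ.+ suc s ℤ.* N²) ∎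
      where p = ℤ.+ (N ^ s)

-- Balanced colourings contain a positive density of patterns.

module Density {n} (G : ColouredK (suc n)) where

  open import Data.Bool using (true; false)
  import Data.Fin.Properties as Fin
  import Data.Integer as ℤ
  import Data.Integer.Properties as ℤ
  open import Data.Integer.Tactic.RingSolver using (solve-∀)
  open import Data.List using (List; []; _∷_; allFin; length; filter)
  open import Data.List.Membership.Propositional using (_∈_)
  open import Data.List.Membership.Propositional.Properties using (∈-allFin; ∈-cartesianProductWith⁺)
  open import Data.List.Properties using (length-tabulate)
  open import Data.List.Relation.Unary.Any using (here)
  import Data.Nat as ℕ
  import Data.Nat.Properties as ℕ
  open import Data.Product using (_,_; proj₁; proj₂; ∃-syntax)
  open import Data.Sum using (inj₁; inj₂)
  open import Data.Vec as Vec using (Vec; []; _∷_; lookup; removeAt; tabulate)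
  import Data.Vec.Properties as Vec
  open import Data.Vec.Relation.Unary.Unique.Propositional using (Unique)
  open import Data.Vec.Relation.Unary.Unique.Propositional.Properties using (lookup-injective)
  open import Function using (_∘_; id)
  open import Relation.Binary.PropositionalEquality
  open import Relation.Nullary using (¬_; yes; no; does)
  open IntegerSums
  open Patterns

  V : Set
  V = Fin (suc n)

  vs : List V
  vs = allFin (suc n)

  open Tuples vs

  ∈-tuples : ∀ {m r} (p : Vec (Fin m) r) → p ∈ Tuples.tuples (allFin m) r
  ∈-tuples []      = here refl
  ∈-tuples (v ∷ p) = ∈-cartesianProductWith⁺ (λ p v → v ∷ p) (∈-tuples p) (∈-allFin v)

  N : ℤ.ℤ
  N = ℤ.+ suc n

  0≤+ : ∀ {m} → ℤ.0ℤ ℤ.≤ ℤ.+ m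
  0≤+ = ℤ.+≤+ ℕ.z≤n

  |vs| : length vs ≡ suc n
  |vs| = length-tabulate id

  has : Colour → V → V → ℤ.ℤ
  has c v w = ι (does (colour G v w ≟ᶜ c))

  -- Includes the diagonal pair if its value happens to be `c`. This can only raise the count above
  -- `degree`, so lower bounds carry over.
  deg : Colour → V → ℤ.ℤ
  deg c v = ∑ vs (has c v)

  0≤deg : ∀ c v → ℤ.0ℤ ℤ.≤ deg c v
  0≤deg c v = ∑-nonneg (λ w → 0≤ι (does (colour G v w ≟ᶜ c))) vs

  deg≤N : ∀ c v → deg c v ℤ.≤ N
  deg≤N c v = ℤ.≤-trans (∑-mono (λ w → ι≤1 (does (colour G v w ≟ᶜ c))) vs)
    (ℤ.≤-reflexive (trans (∑-allFin-const (suc n) ℤ.1ℤ) (ℤ.*-identityʳ N)))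
    where
    ι≤1 : ∀ b → ι b ℤ.≤ ℤ.1ℤ
    ι≤1 true  = ℤ.≤-refl
    ι≤1 false = ℤ.+≤+ ℕ.z≤n

  -- The indicator minus its mean, multiplied by `N` to remain an integer.
  centredHas : Colour → V → V → ℤ.ℤ
  centredHas c v w = N ℤ.* has c v w ℤ.+ ℤ.-1ℤ ℤ.* deg c v

  ∑-centredHas : ∀ c v → ∑ vs (centredHas c v) ≡ ℤ.0ℤ
  ∑-centredHas c v = begin
    ∑ vs (centredHas c v)
      ≡⟨ ∑-+ (λ w → N ℤ.* has c v w) (λ _ → ℤ.-1ℤ ℤ.* deg c v) vs ⟩
    ∑ vs (λ w → N ℤ.* has c v w) ℤ.+ ∑ vs (λ _ → ℤ.-1ℤ ℤ.* deg c v)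
      ≡⟨ cong₂ ℤ._+_ (∑-*ˡ N (has c v) vs) (∑-allFin-const (suc n) (ℤ.-1ℤ ℤ.* deg c v)) ⟩
    N ℤ.* deg c v ℤ.+ N ℤ.* (ℤ.-1ℤ ℤ.* deg c v)
      ≡⟨ cancel N (deg c v) ⟩
    ℤ.0ℤ ∎
    where
    open ≡-Reasoning
    cancel : ∀ N d → N ℤ.* d ℤ.+ N ℤ.* (ℤ.-1ℤ ℤ.* d) ≡ ℤ.0ℤ
    cancel = solve-∀

  square-mono : ∀ {a b} → ℤ.0ℤ ℤ.≤ a → a ℤ.≤ b → a ℤ.* a ℤ.≤ b ℤ.* b
  square-mono {a} {b} 0≤a a≤b = ℤ.≤-trans
    (ℤ.*-monoˡ-≤-nonNeg a {{ℤ.nonNegative 0≤a}} a≤b)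
    (ℤ.*-monoʳ-≤-nonNeg b {{ℤ.nonNegative (ℤ.≤-trans 0≤a a≤b)}} a≤b)

  centredHas²≤ : ∀ c v w → centredHas c v w ℤ.* centredHas c v w ℤ.≤ N ℤ.* N
  centredHas²≤ c v w with does (colour G v w ≟ᶜ c)
  ... | false = subst (ℤ._≤ N ℤ.* N) (square N (deg c v)) (square-mono (0≤deg c v) (deg≤N c v))
    where
    square : ∀ N d → d ℤ.* d ≡ (N ℤ.* ℤ.0ℤ ℤ.+ ℤ.-1ℤ ℤ.* d) ℤ.* (N ℤ.* ℤ.0ℤ ℤ.+ ℤ.-1ℤ ℤ.* d)
    square = solve-∀
  ... | true = square-mono 0≤N-d N-d≤N
    where
    rearrange : ∀ N d → N ℤ.- d ≡ N ℤ.* ℤ.1ℤ ℤ.+ ℤ.-1ℤ ℤ.* d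
    rearrange = solve-∀
    0≤N-d : ℤ.0ℤ ℤ.≤ N ℤ.* ℤ.1ℤ ℤ.+ ℤ.-1ℤ ℤ.* deg c v
    0≤N-d = subst (ℤ.0ℤ ℤ.≤_) (rearrange N (deg c v)) (ℤ.i≤j⇒0≤j-i (deg≤N c v))
    N-d≤N : N ℤ.* ℤ.1ℤ ℤ.+ ℤ.-1ℤ ℤ.* deg c v ℤ.≤ N
    N-d≤N = subst (ℤ._≤ N) (rearrange N (deg c v))
      (ℤ.≤-trans (ℤ.+-monoʳ-≤ N (ℤ.neg-mono-≤ (0≤deg c v))) (ℤ.≤-reflexive (ℤ.+-identityʳ N)))

  -- `N` times the degree of position `i` inside the sample, less the sample size times `deg`.
  -- Position `i` itself is among the summands.
  deviation : ∀ {s} → Vec V s → Colour → Fin s → ℤ.ℤ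
  deviation x c i = total (centredHas c (lookup x i)) x

  sq : ℤ.ℤ → ℤ.ℤ
  sq z = z ℤ.* z

  -- The vertex at position `i` selects the centred function and is also one of its arguments. Drawn
  -- first, it contributes the fixed offset `f v v`, and the other positions are independent of it.
  ∑-deviation² : ∀ s c i → ∑ (tuples (suc s)) (λ x → sq (deviation x c i)) ℤ.≤
                 ℤ.+ (suc n ℕ.^ suc s) ℤ.* (ℤ.+ suc s ℤ.* (N ℤ.* N))
  ∑-deviation² s c i = begin
    ∑ (tuples (suc s)) (λ x → sq (deviation x c i))
      ≡⟨ ∑-cong (λ x → cong sq (total-removeAt (centredHas c (lookup x i)) x i)) (tuples (suc s)) ⟩
    ∑ (tuples (suc s)) (λ x → H (lookup x i) (removeAt x i))
      ≡⟨ ∑-removeAt i H ⟩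
    ∑ vs (λ v → ∑ (tuples s) (H v))
      ≤⟨ ∑-mono (λ v → subst (λ M → ∑ (tuples s) (H v) ℤ.≤ ℤ.+ (M ℕ.^ s) ℤ.* (sq (f v v) ℤ.+ ℤ.+ s ℤ.* (ℤ.+ M ℤ.* ℤ.+ M)))
                  |vs| (secondMoment (f v) (∑-centredHas c v) (f²≤ v) s (f v v))) vs ⟩
    ∑ vs (λ v → P ℤ.* (sq (f v v) ℤ.+ ℤ.+ s ℤ.* (N ℤ.* N)))
      ≤⟨ ∑-mono (λ v → ℤ.*-monoˡ-≤-nonNeg P (ℤ.+-monoˡ-≤ (ℤ.+ s ℤ.* (N ℤ.* N)) (centredHas²≤ c v v))) vs ⟩
    ∑ vs (λ v → P ℤ.* (N ℤ.* N ℤ.+ ℤ.+ s ℤ.* (N ℤ.* N)))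
      ≡⟨ ∑-allFin-const (suc n) (P ℤ.* (N ℤ.* N ℤ.+ ℤ.+ s ℤ.* (N ℤ.* N))) ⟩
    N ℤ.* (P ℤ.* (N ℤ.* N ℤ.+ ℤ.+ s ℤ.* (N ℤ.* N)))
      ≡⟨ regroup N P (ℤ.+ s) ⟩
    N ℤ.* P ℤ.* (ℤ.+ suc s ℤ.* (N ℤ.* N))
      ≡⟨ cong (ℤ._* (ℤ.+ suc s ℤ.* (N ℤ.* N))) (ℤ.pos-* (suc n) (suc n ℕ.^ s)) ⟨
    ℤ.+ (suc n ℕ.^ suc s) ℤ.* (ℤ.+ suc s ℤ.* (N ℤ.* N)) ∎
    where
    open ℤ.≤-Reasoning
    P = ℤ.+ (suc n ℕ.^ s)
    f = centredHas c
    H : V → Vec V s → ℤ.ℤ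
    H v y = sq (f v v ℤ.+ total (f v) y)
    f²≤ : ∀ v w → f v w ℤ.* f v w ℤ.≤ ℤ.+ length vs ℤ.* ℤ.+ length vs
    f²≤ v w = subst (λ M → f v w ℤ.* f v w ℤ.≤ ℤ.+ M ℤ.* ℤ.+ M) (sym |vs|) (centredHas²≤ c v w)
    regroup : ∀ N P s → N ℤ.* (P ℤ.* (N ℤ.* N ℤ.+ s ℤ.* (N ℤ.* N))) ≡ N ℤ.* P ℤ.* ((ℤ.1ℤ ℤ.+ s) ℤ.* (N ℤ.* N))
    regroup = solve-∀

  module _ (k s : ℕ) (balanced : ∀ v c → (ℤ.+ k ℤ.+ ℤ.+ 4) ℤ.* N ℤ.≤ ℤ.+ 4 ℤ.* ℤ.+ k ℤ.* deg c v)
           (large : ℤ.+ 16 ℤ.* (ℤ.+ k ℤ.* ℤ.+ k) ℤ.≤ ℤ.+ suc s)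
           (large′ : ℤ.+ 10 ℤ.* ℤ.+ k ℤ.≤ ℤ.+ suc s) where

    S : ℤ.ℤ
    S = ℤ.+ suc s

    is : List (Fin (suc s))
    is = allFin (suc s)

    col : Vec V (suc s) → Fin (suc s) → Fin (suc s) → Colour
    col x i j = colour G (lookup x i) (lookup x j)

    -- The colours supplied by `almostSplit` depend on the sample, whereas the moment bound is for a
    -- fixed colour; hence both colours are added.
    totalDeviation² : Vec V (suc s) → ℤ.ℤ
    totalDeviation² x = ∑ is (λ i → sq (deviation x red i) ℤ.+ sq (deviation x blue i))

    deviation-sampleDegree : ∀ x c i → N ℤ.* ∑ is (λ j → ι (does (col x i j ≟ᶜ c))) ≡
                             S ℤ.* deg c (lookup x i) ℤ.+ deviation x c i
    deviation-sampleDegree x c i = sym (begin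
      S ℤ.* d ℤ.+ total (centredHas c v) x
        ≡⟨ cong (ℤ._+_ (S ℤ.* d)) (total-lookup (centredHas c v) x) ⟩
      S ℤ.* d ℤ.+ ∑ is (λ j → N ℤ.* h j ℤ.+ ℤ.-1ℤ ℤ.* d)
        ≡⟨ cong (ℤ._+_ (S ℤ.* d)) (∑-+ (λ j → N ℤ.* h j) (λ _ → ℤ.-1ℤ ℤ.* d) is) ⟩
      S ℤ.* d ℤ.+ (∑ is (λ j → N ℤ.* h j) ℤ.+ ∑ is (λ _ → ℤ.-1ℤ ℤ.* d))
        ≡⟨ cong (λ z → S ℤ.* d ℤ.+ z) (cong₂ ℤ._+_ (∑-*ˡ N h is) (∑-allFin-const (suc s) (ℤ.-1ℤ ℤ.* d))) ⟩
      S ℤ.* d ℤ.+ (N ℤ.* ∑ is h ℤ.+ S ℤ.* (ℤ.-1ℤ ℤ.* d))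
        ≡⟨ cancel S d (N ℤ.* ∑ is h) ⟩
      N ℤ.* ∑ is h ∎)
      where
      open ≡-Reasoning
      v = lookup x i
      d = deg c v
      h : Fin (suc s) → ℤ.ℤ
      h j = has c v (lookup x j)
      cancel : ∀ S d z → S ℤ.* d ℤ.+ (z ℤ.+ S ℤ.* (ℤ.-1ℤ ℤ.* d)) ≡ z
      cancel = solve-∀

    -- With a = Σᵢ aᵢ the sum of the deviations in the colours chosen by almostSplit, balancedness forces
    -- −2ka ≥ S²N; then AM-GM, as (2kaᵢ + SN)² ≥ 0.
    deviates : ∀ x → ¬ Pattern (col x) →
               S ℤ.* S ℤ.* S ℤ.* (N ℤ.* N) ℤ.≤ ℤ.+ 4 ℤ.* (ℤ.+ k ℤ.* ℤ.+ k) ℤ.* totalDeviation² x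
    deviates x ¬pattern = ℤ.≤-trans (amgm (∑-nonneg (λ i → 0≤square (ℤ.+ 2 ℤ.* K ℤ.* a i ℤ.+ S ℤ.* N)) is))
        (ℤ.*-monoˡ-≤-nonNeg (ℤ.+ 4 ℤ.* (K ℤ.* K)) {{4K²≥0}} (∑-mono a²≤ is))
      where
      open ℤ.≤-Reasoning
      K = ℤ.+ k
      4K²≥0 : ℤ.NonNegative (ℤ.+ 4 ℤ.* (K ℤ.* K))
      4K²≥0 = ℤ.nonNegative (0≤* {ℤ.+ 4} 0≤+ (0≤square K))
      split = AlmostSplit.almostSplit (col x) (λ i j → symmetric G (lookup x i) (lookup x j)) ¬pattern
      κ = proj₁ split
      a : Fin (suc s) → ℤ.ℤ
      a i = deviation x (κ i) i
      A = ∑ is a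
      a²≤ : ∀ i → sq (a i) ℤ.≤ sq (deviation x red i) ℤ.+ sq (deviation x blue i)
      a²≤ i with κ i
      ... | red  = ℤ.≤-trans (ℤ.≤-reflexive (sym (ℤ.+-identityʳ _)))
                     (ℤ.+-monoʳ-≤ (sq (deviation x red i)) (0≤square (deviation x blue i)))
      ... | blue = ℤ.≤-trans (ℤ.≤-reflexive (sym (ℤ.+-identityˡ _)))
                     (ℤ.+-monoˡ-≤ (sq (deviation x blue i)) (0≤square (deviation x red i)))
      h : Fin (suc s) → ℤ.ℤ
      h i = ∑ is (λ j → ι (does (col x i j ≟ᶜ κ i)))
      row : ∀ i → S ℤ.* ((K ℤ.+ ℤ.+ 4) ℤ.* N) ℤ.+ ℤ.+ 4 ℤ.* K ℤ.* a i ℤ.≤ ℤ.+ 4 ℤ.* K ℤ.* N ℤ.* h i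
      row i = begin
        S ℤ.* ((K ℤ.+ ℤ.+ 4) ℤ.* N) ℤ.+ ℤ.+ 4 ℤ.* K ℤ.* a i
          ≤⟨ ℤ.+-monoˡ-≤ (ℤ.+ 4 ℤ.* K ℤ.* a i) (ℤ.*-monoˡ-≤-nonNeg S (balanced (lookup x i) (κ i))) ⟩
        S ℤ.* (ℤ.+ 4 ℤ.* K ℤ.* deg (κ i) (lookup x i)) ℤ.+ ℤ.+ 4 ℤ.* K ℤ.* a i
          ≡⟨ factor S K (deg (κ i) (lookup x i)) (a i) ⟩
        ℤ.+ 4 ℤ.* K ℤ.* (S ℤ.* deg (κ i) (lookup x i) ℤ.+ a i)
          ≡⟨ cong (ℤ.+ 4 ℤ.* K ℤ.*_) (deviation-sampleDegree x (κ i) i) ⟨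
        ℤ.+ 4 ℤ.* K ℤ.* (N ℤ.* h i)
          ≡⟨ ℤ.*-assoc (ℤ.+ 4 ℤ.* K) N (h i) ⟨
        ℤ.+ 4 ℤ.* K ℤ.* N ℤ.* h i ∎
        where
        factor : ∀ S K d a → S ℤ.* (ℤ.+ 4 ℤ.* K ℤ.* d) ℤ.+ ℤ.+ 4 ℤ.* K ℤ.* a ≡ ℤ.+ 4 ℤ.* K ℤ.* (S ℤ.* d ℤ.+ a)
        factor = solve-∀
      summed : S ℤ.* (S ℤ.* ((K ℤ.+ ℤ.+ 4) ℤ.* N)) ℤ.+ ℤ.+ 4 ℤ.* K ℤ.* A ℤ.≤
               K ℤ.* N ℤ.* (S ℤ.* S ℤ.+ ℤ.+ 20 ℤ.* S)
      summed = begin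
        S ℤ.* (S ℤ.* ((K ℤ.+ ℤ.+ 4) ℤ.* N)) ℤ.+ ℤ.+ 4 ℤ.* K ℤ.* A
          ≡⟨ cong₂ ℤ._+_ (∑-allFin-const (suc s) (S ℤ.* ((K ℤ.+ ℤ.+ 4) ℤ.* N))) (∑-*ˡ (ℤ.+ 4 ℤ.* K) a is) ⟨
        ∑ is (λ _ → S ℤ.* ((K ℤ.+ ℤ.+ 4) ℤ.* N)) ℤ.+ ∑ is (λ i → ℤ.+ 4 ℤ.* K ℤ.* a i)
          ≡⟨ ∑-+ (λ _ → S ℤ.* ((K ℤ.+ ℤ.+ 4) ℤ.* N)) (λ i → ℤ.+ 4 ℤ.* K ℤ.* a i) is ⟨
        ∑ is (λ i → S ℤ.* ((K ℤ.+ ℤ.+ 4) ℤ.* N) ℤ.+ ℤ.+ 4 ℤ.* K ℤ.* a i)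
          ≤⟨ ∑-mono row is ⟩
        ∑ is (λ i → ℤ.+ 4 ℤ.* K ℤ.* N ℤ.* h i)
          ≡⟨ ∑-*ˡ (ℤ.+ 4 ℤ.* K ℤ.* N) h is ⟩
        ℤ.+ 4 ℤ.* K ℤ.* N ℤ.* ∑ is h
          ≡⟨ factor K N (∑ is h) ⟩
        K ℤ.* N ℤ.* (ℤ.+ 4 ℤ.* ∑ is h)
          ≤⟨ ℤ.*-monoˡ-≤-nonNeg (K ℤ.* N) {{KN≥0}} (proj₂ split) ⟩
        K ℤ.* N ℤ.* (S ℤ.* S ℤ.+ ℤ.+ 20 ℤ.* S) ∎
        where
        factor : ∀ K N h → ℤ.+ 4 ℤ.* K ℤ.* N ℤ.* h ≡ K ℤ.* N ℤ.* (ℤ.+ 4 ℤ.* h)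
        factor = solve-∀
        KN≥0 : ℤ.NonNegative (K ℤ.* N)
        KN≥0 = ℤ.nonNegative {K ℤ.* N} (0≤* {K} {N} 0≤+ 0≤+)
      -- 4S²N + 4ka ≤ 20kSN ≤ 2S²N
      drift : S ℤ.* S ℤ.* N ℤ.+ ℤ.+ 2 ℤ.* K ℤ.* A ℤ.≤ ℤ.0ℤ
      drift = ℤ.*-cancelˡ-≤-pos _ _ (ℤ.+ 2) (ℤ.0≤i-j⇒j≤i (subst (ℤ.0ℤ ℤ.≤_)
        (combine S K N A) (ℤ.+-mono-≤ (ℤ.i≤j⇒0≤j-i summed)
          (0≤* {ℤ.+ 2} 0≤+ (0≤* {S} 0≤+ (0≤* {N} 0≤+ (ℤ.i≤j⇒0≤j-i large′)))))))
        where
        combine : ∀ S K N A →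
          (K ℤ.* N ℤ.* (S ℤ.* S ℤ.+ ℤ.+ 20 ℤ.* S) ℤ.- (S ℤ.* (S ℤ.* ((K ℤ.+ ℤ.+ 4) ℤ.* N)) ℤ.+ ℤ.+ 4 ℤ.* K ℤ.* A)) ℤ.+
          ℤ.+ 2 ℤ.* (S ℤ.* (N ℤ.* (S ℤ.- ℤ.+ 10 ℤ.* K))) ≡
          ℤ.+ 2 ℤ.* ℤ.0ℤ ℤ.- ℤ.+ 2 ℤ.* (S ℤ.* S ℤ.* N ℤ.+ ℤ.+ 2 ℤ.* K ℤ.* A)
        combine = solve-∀
      amgm : ℤ.0ℤ ℤ.≤ ∑ is (λ i → sq (ℤ.+ 2 ℤ.* K ℤ.* a i ℤ.+ S ℤ.* N)) →
             S ℤ.* S ℤ.* S ℤ.* (N ℤ.* N) ℤ.≤ ℤ.+ 4 ℤ.* (K ℤ.* K) ℤ.* ∑ is (sq ∘ a)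
      amgm 0≤ = ℤ.0≤i-j⇒j≤i (subst (ℤ.0ℤ ℤ.≤_) (combine S K N A (∑ is (sq ∘ a)))
        (ℤ.+-mono-≤ (subst (ℤ.0ℤ ℤ.≤_) expanded 0≤)
          (0≤* {ℤ.+ 2} 0≤+ (0≤* {S} 0≤+ (0≤* {N} 0≤+ (ℤ.i≤j⇒0≤j-i drift))))))
        where
        combine : ∀ S K N A Q →
          (ℤ.+ 4 ℤ.* (K ℤ.* K) ℤ.* Q ℤ.+ (ℤ.+ 4 ℤ.* K ℤ.* (S ℤ.* N) ℤ.* A ℤ.+ S ℤ.* (S ℤ.* N ℤ.* (S ℤ.* N)))) ℤ.+
          ℤ.+ 2 ℤ.* (S ℤ.* (N ℤ.* (ℤ.0ℤ ℤ.- (S ℤ.* S ℤ.* N ℤ.+ ℤ.+ 2 ℤ.* K ℤ.* A)))) ≡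
          ℤ.+ 4 ℤ.* (K ℤ.* K) ℤ.* Q ℤ.- S ℤ.* S ℤ.* S ℤ.* (N ℤ.* N)
        combine = solve-∀
        expand : ∀ K S N a → (ℤ.+ 2 ℤ.* K ℤ.* a ℤ.+ S ℤ.* N) ℤ.* (ℤ.+ 2 ℤ.* K ℤ.* a ℤ.+ S ℤ.* N) ≡
          ℤ.+ 4 ℤ.* (K ℤ.* K) ℤ.* (a ℤ.* a) ℤ.+ (ℤ.+ 4 ℤ.* K ℤ.* (S ℤ.* N) ℤ.* a ℤ.+ S ℤ.* N ℤ.* (S ℤ.* N))
        expand = solve-∀
        c₁ = ℤ.+ 4 ℤ.* (K ℤ.* K)
        c₂ = ℤ.+ 4 ℤ.* K ℤ.* (S ℤ.* N)
        c₃ = S ℤ.* N ℤ.* (S ℤ.* N)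
        expanded : ∑ is (λ i → sq (ℤ.+ 2 ℤ.* K ℤ.* a i ℤ.+ S ℤ.* N)) ≡
          c₁ ℤ.* ∑ is (sq ∘ a) ℤ.+ (c₂ ℤ.* A ℤ.+ S ℤ.* c₃)
        expanded = trans (∑-cong (λ i → expand K S N (a i)) is)
          (trans (∑-+ (λ i → c₁ ℤ.* sq (a i)) (λ i → c₂ ℤ.* a i ℤ.+ c₃) is)
          (cong₂ ℤ._+_ (∑-*ˡ c₁ (sq ∘ a) is)
            (trans (∑-+ (λ i → c₂ ℤ.* a i) (λ _ → c₃) is) (cong₂ ℤ._+_ (∑-*ˡ c₂ a is) (∑-allFin-const (suc s) c₃)))))

  module _ (K S N P Q S⁴ M N⁴ : ℤ.ℤ) where

    private
      T = S ℤ.* S ℤ.* S ℤ.* (N ℤ.* N)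

    -- The first term on the right of the averaged inequality is 8 K² S² N² P. As 16 K² ≤ S, it is
    -- at most half of P T with T = S³ N², so the pattern term carries the other half; then T Q
    -- cancels. This is where the sample size must be quadratic in `k`.
    divideAverage : ℤ.+ 16 ℤ.* (K ℤ.* K) ℤ.≤ S → ℤ.0ℤ ℤ.≤ P → P ≡ N⁴ ℤ.* Q → ℤ.Positive (T ℤ.* Q) →
      P ℤ.* T ℤ.≤ ℤ.+ 4 ℤ.* (K ℤ.* K) ℤ.* (S ℤ.* (P ℤ.* (S ℤ.* (N ℤ.* N)) ℤ.+ P ℤ.* (S ℤ.* (N ℤ.* N)))) ℤ.+
                  T ℤ.* (S⁴ ℤ.* (Q ℤ.* M)) →
      N⁴ ℤ.≤ ℤ.+ 2 ℤ.* (S⁴ ℤ.* M)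
    divideAverage large 0≤P P≡N⁴Q TQ>0 averaged =
      ℤ.*-cancelˡ-≤-pos N⁴ (ℤ.+ 2 ℤ.* (S⁴ ℤ.* M)) (T ℤ.* Q) {{TQ>0}} (ℤ.0≤i-j⇒j≤i (subst (ℤ.0ℤ ℤ.≤_)
        (trans (combine K S N P (S⁴ ℤ.* (Q ℤ.* M)))
               (trans (cong (λ z → ℤ.+ 2 ℤ.* (T ℤ.* (S⁴ ℤ.* (Q ℤ.* M))) ℤ.- z ℤ.* T) P≡N⁴Q)
                      (regroup T Q S⁴ M N⁴)))
        (ℤ.+-mono-≤ (0≤* {ℤ.+ 2} 0≤+ (ℤ.i≤j⇒0≤j-i averaged))
                    (0≤* (0≤* (0≤* 0≤P (0≤square S)) (0≤square N)) (ℤ.i≤j⇒0≤j-i large)))))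
      where
      combine : ∀ K S N P Z →
        ℤ.+ 2 ℤ.* ((ℤ.+ 4 ℤ.* (K ℤ.* K) ℤ.* (S ℤ.* (P ℤ.* (S ℤ.* (N ℤ.* N)) ℤ.+ P ℤ.* (S ℤ.* (N ℤ.* N)))) ℤ.+
                    S ℤ.* S ℤ.* S ℤ.* (N ℤ.* N) ℤ.* Z) ℤ.- P ℤ.* (S ℤ.* S ℤ.* S ℤ.* (N ℤ.* N))) ℤ.+
        P ℤ.* (S ℤ.* S) ℤ.* (N ℤ.* N) ℤ.* (S ℤ.- ℤ.+ 16 ℤ.* (K ℤ.* K)) ≡
        ℤ.+ 2 ℤ.* (S ℤ.* S ℤ.* S ℤ.* (N ℤ.* N) ℤ.* Z) ℤ.- P ℤ.* (S ℤ.* S ℤ.* S ℤ.* (N ℤ.* N))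
      combine = solve-∀
      regroup : ∀ T Q S⁴ M N⁴ → ℤ.+ 2 ℤ.* (T ℤ.* (S⁴ ℤ.* (Q ℤ.* M))) ℤ.- N⁴ ℤ.* Q ℤ.* T ≡
                T ℤ.* Q ℤ.* (ℤ.+ 2 ℤ.* (S⁴ ℤ.* M)) ℤ.- T ℤ.* Q ℤ.* N⁴
      regroup = solve-∀

  -- Entries of the tuple may coincide, in which case diagonal values are read. Samples with
  -- repeated vertices make this unavoidable, and the extraction copes with it.
  isPattern : Colour → Vec V 4 → ℤ.ℤ
  isPattern c p = ι (does (ok? (colour G) c p))

  -- The sample size 1 + s₃ is a variable rather than 4 + s, lest the list of its index tuples unfold.
  module _ (k s₃ s : ℕ) (s₃≡3+s : s₃ ≡ 3 ℕ.+ s) (balanced : ∀ v c → (ℤ.+ k ℤ.+ ℤ.+ 4) ℤ.* N ℤ.≤ ℤ.+ 4 ℤ.* ℤ.+ k ℤ.* deg c v)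
           (large : ℤ.+ 16 ℤ.* (ℤ.+ k ℤ.* ℤ.+ k) ℤ.≤ ℤ.+ suc s₃)
           (large′ : ℤ.+ 10 ℤ.* ℤ.+ k ℤ.≤ ℤ.+ suc s₃) where

    private
      S′ K T P Q S⁴ : ℤ.ℤ
      S′ = ℤ.+ suc s₃
      K  = ℤ.+ k
      T  = S′ ℤ.* S′ ℤ.* S′ ℤ.* (N ℤ.* N)
      P  = ℤ.+ (suc n ℕ.^ suc s₃)
      Q  = ℤ.+ (suc n ℕ.^ s)
      S⁴ = ℤ.+ (suc s₃ ℕ.^ 4)
      is′ : List (Fin (suc s₃))
      is′ = allFin (suc s₃)
      indices : List (Vec (Fin (suc s₃)) 4)
      indices = Tuples.tuples is′ 4
      samples : List (Vec V (suc s₃))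
      samples = tuples (suc s₃)

    anyPattern : Vec V 4 → ℤ.ℤ
    anyPattern p = isPattern red p ℤ.+ isPattern blue p

    0≤anyPattern : ∀ p → ℤ.0ℤ ℤ.≤ anyPattern p
    0≤anyPattern p = ℤ.+-mono-≤ (0≤ι (does (ok? (colour G) red p))) (0≤ι (does (ok? (colour G) blue p)))

    -- The factor masks index tuples with a repeated position, since `∑-marginal` requires distinct
    -- ones.
    sampleTerm : Vec V (suc s₃) → Vec (Fin (suc s₃)) 4 → ℤ.ℤ
    sampleTerm x p = ι (does (unique? p)) ℤ.* anyPattern (tabulate (lookup x ∘ lookup p))

    0≤sampleTerm : ∀ x p → ℤ.0ℤ ℤ.≤ sampleTerm x p
    0≤sampleTerm x p = 0≤* (0≤ι (does (unique? p))) (0≤anyPattern (tabulate (lookup x ∘ lookup p)))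

    samplePatterns : Vec V (suc s₃) → ℤ.ℤ
    samplePatterns x = ∑ indices (sampleTerm x)

    patternful : ∀ x → Pattern (col k s₃ balanced large large′ x) → ℤ.1ℤ ℤ.≤ samplePatterns x
    patternful x (c , p@(_ ∷ _ ∷ _ ∷ _ ∷ []) , u , o) =
      ℤ.≤-trans 1≤term (∑-term (0≤sampleTerm x) (∈-tuples p))
      where
      q : Vec V 4
      q = tabulate (lookup x ∘ lookup p)
      found : ∀ c → Ok (colour G) c q → ℤ.1ℤ ℤ.≤ isPattern c q
      found c = 1≤ι (ok? (colour G) c q)
      1≤any : ∀ c → Ok (colour G) c q → ℤ.1ℤ ℤ.≤ anyPattern q
      1≤any red  o = ℤ.+-mono-≤ (found red o) (0≤ι (does (ok? (colour G) blue q)))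
      1≤any blue o = ℤ.+-mono-≤ (0≤ι (does (ok? (colour G) red q))) (found blue o)
      1≤term : ℤ.1ℤ ℤ.≤ sampleTerm x p
      1≤term = 1≤* {ι (does (unique? p))} {anyPattern q} (1≤ι (unique? p) u) (1≤any c o)

    Dev : Vec V (suc s₃) → ℤ.ℤ
    Dev = totalDeviation² k s₃ balanced large large′

    0≤Dev : ∀ x → ℤ.0ℤ ℤ.≤ Dev x
    0≤Dev x = ∑-nonneg (λ i → ℤ.+-mono-≤ (0≤square (deviation x red i)) (0≤square (deviation x blue i))) is′

    0≤T : ℤ.0ℤ ℤ.≤ T
    0≤T = 0≤* {S′ ℤ.* S′ ℤ.* S′} {N ℤ.* N} (0≤* {S′ ℤ.* S′} {S′} (0≤square S′) 0≤+) (0≤square N)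

    0≤4K² : ℤ.0ℤ ℤ.≤ ℤ.+ 4 ℤ.* (K ℤ.* K)
    0≤4K² = 0≤* {ℤ.+ 4} 0≤+ (0≤square K)

    -- Both alternatives are merged into one linear inequality, which can be summed over all
    -- samples.
    deviates-or-patternful : ∀ x → T ℤ.≤ ℤ.+ 4 ℤ.* (K ℤ.* K) ℤ.* Dev x ℤ.+ T ℤ.* samplePatterns x
    deviates-or-patternful x with pattern? (col k s₃ balanced large large′ x)
    ... | yes found = subst₂ ℤ._≤_ (trans (ℤ.+-identityˡ (T ℤ.* ℤ.1ℤ)) (ℤ.*-identityʳ T)) refl
            (ℤ.+-mono-≤ (0≤* 0≤4K² (0≤Dev x)) (ℤ.*-monoˡ-≤-nonNeg T {{ℤ.nonNegative 0≤T}} (patternful x found)))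
    ... | no none   = subst₂ ℤ._≤_ (ℤ.+-identityʳ T) refl
            (ℤ.+-mono-≤ (deviates k s₃ balanced large large′ x none)
              (0≤* 0≤T (∑-nonneg (0≤sampleTerm x) indices)))

    ∑-Dev : ∑ samples Dev ℤ.≤ S′ ℤ.* (P ℤ.* (S′ ℤ.* (N ℤ.* N)) ℤ.+ P ℤ.* (S′ ℤ.* (N ℤ.* N)))
    ∑-Dev = begin
      ∑ samples Dev
        ≡⟨ ∑-swap (λ x i → sq (deviation x red i) ℤ.+ sq (deviation x blue i)) samples is′ ⟩
      ∑ is′ (λ i → ∑ samples (λ x → sq (deviation x red i) ℤ.+ sq (deviation x blue i)))
        ≡⟨ ∑-cong (λ i → ∑-+ (λ x → sq (deviation x red i)) (λ x → sq (deviation x blue i)) samples) is′ ⟩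
      ∑ is′ (λ i → ∑ samples (λ x → sq (deviation x red i)) ℤ.+ ∑ samples (λ x → sq (deviation x blue i)))
        ≤⟨ ∑-mono (λ i → ℤ.+-mono-≤ (∑-deviation² s₃ red i) (∑-deviation² s₃ blue i)) is′ ⟩
      ∑ is′ (λ _ → P ℤ.* (S′ ℤ.* (N ℤ.* N)) ℤ.+ P ℤ.* (S′ ℤ.* (N ℤ.* N)))
        ≡⟨ ∑-allFin-const (suc s₃) (P ℤ.* (S′ ℤ.* (N ℤ.* N)) ℤ.+ P ℤ.* (S′ ℤ.* (N ℤ.* N))) ⟩
      S′ ℤ.* (P ℤ.* (S′ ℤ.* (N ℤ.* N)) ℤ.+ P ℤ.* (S′ ℤ.* (N ℤ.* N))) ∎
      where open ℤ.≤-Reasoning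

    M : ℤ.ℤ
    M = ∑ (tuples 4) anyPattern

    ∑-samplePatterns : ∑ samples samplePatterns ℤ.≤ S⁴ ℤ.* (Q ℤ.* M)
    ∑-samplePatterns = begin
      ∑ samples samplePatterns                          ≡⟨ ∑-swap sampleTerm samples indices ⟩
      ∑ indices (λ p → ∑ samples (λ x → sampleTerm x p)) ≤⟨ ∑-mono term≤ indices ⟩
      ∑ indices (λ _ → Q ℤ.* M)                         ≡⟨ Tuples.∑-tuples-const is′ 4 (Q ℤ.* M) ⟩
      ℤ.+ (length is′ ℕ.^ 4) ℤ.* (Q ℤ.* M)
        ≡⟨ cong (λ l → ℤ.+ (l ℕ.^ 4) ℤ.* (Q ℤ.* M)) (length-tabulate {n = suc s₃} id) ⟩
      S⁴ ℤ.* (Q ℤ.* M)                                  ∎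
      where
      open ℤ.≤-Reasoning
      ∑-marginal′ : ∀ {s₃} → s₃ ≡ 3 ℕ.+ s → (p : Vec (Fin (suc s₃)) 4) → Unique p →
        ∑ (tuples (suc s₃)) (λ x → anyPattern (tabulate (lookup x ∘ lookup p))) ≡ Q ℤ.* M
      ∑-marginal′ refl p u = trans (∑-marginal 4 s (lookup p) (λ {i} {j} → lookup-injective u i j) anyPattern)
                                   (cong (λ l → ℤ.+ (l ℕ.^ s) ℤ.* M) |vs|)
      term≤ : ∀ p → ∑ samples (λ x → sampleTerm x p) ℤ.≤ Q ℤ.* M
      term≤ p with unique? p
      ... | no _  = ℤ.≤-trans (ℤ.≤-reflexive (trans (∑-const ℤ.0ℤ samples) (ℤ.*-zeroʳ (ℤ.+ length samples))))
                      (0≤* {Q} 0≤+ (∑-nonneg 0≤anyPattern (tuples 4)))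
      ... | yes u = ℤ.≤-reflexive (trans
              (∑-cong (λ x → ℤ.*-identityˡ (anyPattern (tabulate (lookup x ∘ lookup p)))) samples)
              (∑-marginal′ s₃≡3+s p u))

    N⁴≤ : ℤ.+ (suc n ℕ.^ 4) ℤ.≤ ℤ.+ 2 ℤ.* (S⁴ ℤ.* M)
    N⁴≤ = divideAverage K S′ N P Q S⁴ M (ℤ.+ (suc n ℕ.^ 4)) large 0≤+ P≡N⁴Q TQ>0 averaged
      where
      P≡N⁴Q : P ≡ ℤ.+ (suc n ℕ.^ 4) ℤ.* Q
      P≡N⁴Q = trans (cong ℤ.+_ (trans (cong (λ m → suc n ℕ.^ suc m) s₃≡3+s) (ℕ.^-distribˡ-+-* (suc n) 4 s))) (ℤ.pos-* (suc n ℕ.^ 4) (suc n ℕ.^ s))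
      averaged : P ℤ.* T ℤ.≤ ℤ.+ 4 ℤ.* (K ℤ.* K) ℤ.* (S′ ℤ.* (P ℤ.* (S′ ℤ.* (N ℤ.* N)) ℤ.+ P ℤ.* (S′ ℤ.* (N ℤ.* N)))) ℤ.+
                             T ℤ.* (S⁴ ℤ.* (Q ℤ.* M))
      averaged = begin
        P ℤ.* T
          ≡⟨ cong (λ l → ℤ.+ (l ℕ.^ suc s₃) ℤ.* T) |vs| ⟨
        ℤ.+ (length vs ℕ.^ suc s₃) ℤ.* T
          ≡⟨ ∑-tuples-const (suc s₃) T ⟨
        ∑ samples (λ _ → T)
          ≤⟨ ∑-mono deviates-or-patternful samples ⟩
        ∑ samples (λ x → 4K² ℤ.* Dev x ℤ.+ T ℤ.* samplePatterns x)
          ≡⟨ ∑-+ (λ x → 4K² ℤ.* Dev x) (λ x → T ℤ.* samplePatterns x) samples ⟩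
        ∑ samples (λ x → 4K² ℤ.* Dev x) ℤ.+ ∑ samples (λ x → T ℤ.* samplePatterns x)
          ≡⟨ cong₂ ℤ._+_ (∑-*ˡ 4K² Dev samples) (∑-*ˡ T samplePatterns samples) ⟩
        4K² ℤ.* ∑ samples Dev ℤ.+ T ℤ.* ∑ samples samplePatterns
          ≤⟨ ℤ.+-mono-≤ (ℤ.*-monoˡ-≤-nonNeg 4K² {{ℤ.nonNegative 0≤4K²}} ∑-Dev)
                        (ℤ.*-monoˡ-≤-nonNeg T {{ℤ.nonNegative 0≤T}} ∑-samplePatterns) ⟩
        _ ∎
        where
        open ℤ.≤-Reasoning
        4K² = ℤ.+ 4 ℤ.* (K ℤ.* K)
      TQ>0 : ℤ.Positive (T ℤ.* Q)
      TQ>0 = subst ℤ.Positive (trans (ℤ.pos-* t (suc n ℕ.^ s)) (cong (ℤ._* Q) (sym T≡t)))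
        (ℤ.positive (ℤ.+<+ (ℕ.*-mono-≤ {1} {t} {1} (ℕ.s≤s ℕ.z≤n) (ℕ.m^n>0 (suc n) s))))
        where
        t : ℕ
        t = suc s₃ ℕ.* suc s₃ ℕ.* suc s₃ ℕ.* (suc n ℕ.* suc n)
        T≡t : T ≡ ℤ.+ t
        T≡t = refl

    -- The constant doubles from 2 to 4 because only the more frequent of the two pattern colours is
    -- kept.
    patternsDense : ∃[ c ] suc n ℕ.^ 4 ℕ.≤ 4 ℕ.* suc s₃ ℕ.^ 4 ℕ.* length (filter (ok? (colour G) c) (tuples 4))
    patternsDense = choose (ℕ.≤-total (l red) (l blue))
      where
      l : Colour → ℕ
      l c = length (filter (ok? (colour G) c) (tuples 4))
      σ⁴ = suc s₃ ℕ.^ 4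
      M≡ : M ≡ ℤ.+ (l red ℕ.+ l blue)
      M≡ = trans (∑-+ (isPattern red) (isPattern blue) (tuples 4))
        (trans (cong₂ ℤ._+_ (∑-filter (ok? (colour G) red) (tuples 4)) (∑-filter (ok? (colour G) blue) (tuples 4)))
               (sym (ℤ.pos-+ (l red) (l blue))))
      dense : suc n ℕ.^ 4 ℕ.≤ 2 ℕ.* (σ⁴ ℕ.* (l red ℕ.+ l blue))
      dense = ℤ.drop‿+≤+ (subst (ℤ.+ (suc n ℕ.^ 4) ℤ.≤_)
        (trans (cong (λ z → ℤ.+ 2 ℤ.* (S⁴ ℤ.* z)) M≡)
          (trans (cong (ℤ.+ 2 ℤ.*_) (sym (ℤ.pos-* σ⁴ (l red ℕ.+ l blue)))) (sym (ℤ.pos-* 2 (σ⁴ ℕ.* (l red ℕ.+ l blue)))))) N⁴≤)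
      bound : ∀ m → l red ℕ.+ l blue ℕ.≤ m ℕ.+ m → suc n ℕ.^ 4 ℕ.≤ 4 ℕ.* σ⁴ ℕ.* m
      bound m le = begin
        suc n ℕ.^ 4                            ≤⟨ dense ⟩
        2 ℕ.* (σ⁴ ℕ.* (l red ℕ.+ l blue))      ≤⟨ ℕ.*-monoʳ-≤ 2 (ℕ.*-monoʳ-≤ σ⁴ le) ⟩
        2 ℕ.* (σ⁴ ℕ.* (m ℕ.+ m))               ≡⟨ regroup σ⁴ m ⟩
        4 ℕ.* σ⁴ ℕ.* m                         ∎
        where
        open ℕ.≤-Reasoning
        open import Data.Nat.Tactic.RingSolver using () renaming (solve-∀ to solve-ℕ)
        regroup : ∀ a m → 2 ℕ.* (a ℕ.* (m ℕ.+ m)) ≡ 4 ℕ.* a ℕ.* m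
        regroup = solve-ℕ
      choose : _ → _
      choose (inj₁ r≤b) = blue , bound (l blue) (ℕ.+-monoˡ-≤ (l blue) r≤b)
      choose (inj₂ b≤r) = red  , bound (l red)  (ℕ.+-monoʳ-≤ (l red)  b≤r)

-- Double counting, Markov's inequality and dense bipartite relations.

module ListCounting where

  open import Data.List using (List; []; _∷_; map; length; filter; cartesianProductWith)
  open import Data.List.Properties using (filter-++; length-++; length-filter)
  open import Data.List.Relation.Binary.Sublist.Propositional using (_⊆_; []; _∷_; _∷ʳ_; ⊆-refl; ⊆-trans)
  open import Data.List.Relation.Binary.Sublist.Propositional.Properties using (filter-⊆; All-resp-⊆)
  open import Data.List.Relation.Unary.All as All using (All; []; _∷_)
  open import Data.List.Relation.Unary.All.Properties using (all-filter)
  open import Data.List.Relation.Unary.AllPairs using (AllPairs; []; _∷_)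
  open import Data.Nat
  open import Data.Nat.ListAction using (sum)
  open import Data.Nat.Properties
  open import Data.Nat.Tactic.RingSolver using (solve-∀)
  open import Data.Product using (∃-syntax; _×_; _,_)
  open import Data.Sum using (inj₁; inj₂)
  open import Function using (_∘_)
  open import Relation.Binary.PropositionalEquality
  open import Relation.Nullary using (¬_; yes; no; does; ¬?)
  open import Relation.Unary using (Decidable)
  open import Data.Bool using (true; false)

  private variable
    A B C : Set

  AllPairs-⊆ : ∀ {R : A → A → Set} {xs ys} → xs ⊆ ys → AllPairs R ys → AllPairs R xs
  AllPairs-⊆ []         []       = []
  AllPairs-⊆ (_ ∷ʳ s)   (_ ∷ rs) = AllPairs-⊆ s rs
  AllPairs-⊆ (refl ∷ s) (r ∷ rs) = All-resp-⊆ s r ∷ AllPairs-⊆ s rs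

  length-filter-¬ : ∀ {P : A → Set} (P? : Decidable P) xs →
                    length xs ≡ length (filter P? xs) + length (filter (¬? ∘ P?) xs)
  length-filter-¬ P? []       = refl
  length-filter-¬ P? (x ∷ xs) with does (P? x)
  ... | true  = cong suc (length-filter-¬ P? xs)
  ... | false = trans (cong suc (length-filter-¬ P? xs)) (sym (+-suc _ _))

  length-filter-map : ∀ {P : B → Set} (P? : Decidable P) (f : A → B) xs →
                      length (filter P? (map f xs)) ≡ length (filter (P? ∘ f) xs)
  length-filter-map P? f []       = refl
  length-filter-map P? f (x ∷ xs) with does (P? (f x))
  ... | true  = cong suc (length-filter-map P? f xs)
  ... | false = length-filter-map P? f xs

  length-filter-product : ∀ {P : C → Set} (P? : Decidable P) (f : A → B → C) xs ys →
    length (filter P? (cartesianProductWith f xs ys)) ≡ sum (map (λ x → length (filter (P? ∘ f x) ys)) xs)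
  length-filter-product P? f []       ys = refl
  length-filter-product P? f (x ∷ xs) ys =
    trans (cong length (filter-++ P? (map (f x) ys) _))
      (trans (length-++ (filter P? (map (f x) ys)))
        (cong₂ _+_ (length-filter-map P? (f x) ys) (length-filter-product P? f xs ys)))

  sum-map-0 : ∀ (xs : List A) → sum (map (λ _ → 0) xs) ≡ 0
  sum-map-0 []       = refl
  sum-map-0 (x ∷ xs) = sum-map-0 xs

  halve : ∀ x y z {w} → w ≤ x + x → x ≤ y * z → w ≤ 2 * y * z
  halve x y z {w} w≤ x≤ = ≤-trans w≤ (≤-trans (+-mono-≤ x≤ x≤) (≤-reflexive (twice y z)))
    where
    twice : ∀ y z → y * z + y * z ≡ 2 * y * z
    twice = solve-∀

  shuffle : ∀ x y z {w} → w ≡ y + z → x + w ≡ y + (x + z)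
  shuffle x y z refl = exchange x y z
    where
    exchange : ∀ x y z → x + (y + z) ≡ y + (x + z)
    exchange = solve-∀

  module _ {ρ : A → B → Set} (ρ? : ∀ a → Decidable (ρ a)) where

    degree-in : List A → B → ℕ
    degree-in as b = length (filter (λ a → ρ? a b) as)

    sum-degree-∷ : ∀ a as bs → sum (map (degree-in (a ∷ as)) bs) ≡
                   length (filter (ρ? a) bs) + sum (map (degree-in as) bs)
    sum-degree-∷ a as []       = refl
    sum-degree-∷ a as (b ∷ bs) with does (ρ? a b)
    ... | true  = cong suc (shuffle (degree-in as b) (length (filter (ρ? a) bs)) (sum (map (degree-in as) bs)) (sum-degree-∷ a as bs))
    ... | false = shuffle (degree-in as b) (length (filter (ρ? a) bs)) (sum (map (degree-in as) bs)) (sum-degree-∷ a as bs)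

    doubleCount : ∀ as bs → sum (map (degree-in as) bs) ≡ sum (map (λ a → length (filter (ρ? a) bs)) as)
    doubleCount []       bs = sum-map-0 bs
    doubleCount (a ∷ as) bs = trans (sum-degree-∷ a as bs) (cong (length (filter (ρ? a) bs) +_) (doubleCount as bs))

    -- Pigeonhole over the 2^|as| possible neighbourhoods in as.
    commonProfile : ∀ as bs → ∃[ as′ ] ∃[ bs′ ] (as′ ⊆ as × bs′ ⊆ bs × length bs ≤ 2 ^ length as * length bs′ ×
                    All (λ b → All (λ a → ρ a b) as′ × degree-in as b ≤ length as′) bs′)
    commonProfile []       bs = [] , bs , [] , ⊆-refl , ≤-reflexive (sym (*-identityˡ (length bs))) ,
                                All.universal (λ _ → [] , z≤n) bs
    commonProfile (a ∷ as) bs with ≤-total (length (filter (ρ? a) bs)) (length (filter (¬? ∘ ρ? a) bs))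
    ... | inj₁ ≤no with as′ , bs′ , as′⊆ , bs′⊆ , len , prof ← commonProfile as (filter (¬? ∘ ρ? a) bs) =
      as′ , bs′ , (a ∷ʳ as′⊆) , ⊆-trans bs′⊆ (filter-⊆ (¬? ∘ ρ? a) bs) ,
      halve (length (filter (¬? ∘ ρ? a) bs)) (2 ^ length as) (length bs′)
        (≤-trans (≤-reflexive (length-filter-¬ (ρ? a) bs)) (+-monoˡ-≤ _ ≤no)) len ,
      All.zipWith reject (prof , All-resp-⊆ bs′⊆ (all-filter (¬? ∘ ρ? a) bs))
      where
      reject : ∀ {b} → (All (λ a → ρ a b) as′ × degree-in as b ≤ length as′) × ¬ ρ a b →
               All (λ a → ρ a b) as′ × degree-in (a ∷ as) b ≤ length as′
      reject {b} ((ps , d) , ¬ab) with ρ? a b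
      ... | yes ab with () ← ¬ab ab
      ... | no _ = ps , d
    ... | inj₂ ≤yes with as′ , bs′ , as′⊆ , bs′⊆ , len , prof ← commonProfile as (filter (ρ? a) bs) =
      a ∷ as′ , bs′ , (refl ∷ as′⊆) , ⊆-trans bs′⊆ (filter-⊆ (ρ? a) bs) ,
      halve (length (filter (ρ? a) bs)) (2 ^ length as) (length bs′)
        (≤-trans (≤-reflexive (length-filter-¬ (ρ? a) bs)) (+-monoʳ-≤ _ ≤yes)) len ,
      All.zipWith accept (prof , All-resp-⊆ bs′⊆ (all-filter (ρ? a) bs))
      where
      accept : ∀ {b} → (All (λ a → ρ a b) as′ × degree-in as b ≤ length as′) × ρ a b →
               All (λ a → ρ a b) (a ∷ as′) × degree-in (a ∷ as) b ≤ suc (length as′)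
      accept {b} ((ps , d) , ab) with ρ? a b
      ... | yes _  = ab ∷ ps , s≤s d
      ... | no ¬ab with () ← ¬ab ab

  sum≤-split : ∀ {P : A → Set} (P? : Decidable P) (f : A → ℕ) B D → (∀ x → f x ≤ B) → (∀ {x} → ¬ P x → D * f x ≤ B) →
               ∀ xs → D * sum (map f xs) ≤ D * length (filter P? xs) * B + length xs * B
  sum≤-split P? f B D f≤B Df≤B []       = ≤-trans (≤-reflexive (*-zeroʳ D)) z≤n
  sum≤-split P? f B D f≤B Df≤B (x ∷ xs) with ih ← sum≤-split P? f B D f≤B Df≤B xs | P? x
  ... | yes _ = begin
    D * (f x + sum (map f xs))               ≤⟨ *-monoʳ-≤ D (+-monoˡ-≤ (sum (map f xs)) (f≤B x)) ⟩
    D * (B + sum (map f xs))                 ≡⟨ *-distribˡ-+ D B (sum (map f xs)) ⟩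
    D * B + D * sum (map f xs)               ≤⟨ +-monoʳ-≤ (D * B) ih ⟩
    D * B + (D * g * B + length xs * B)      ≤⟨ m≤m+n _ B ⟩
    D * B + (D * g * B + length xs * B) + B  ≡⟨ regroup D B g (length xs) ⟩
    D * suc g * B + suc (length xs) * B      ∎
    where
    open ≤-Reasoning
    g = length (filter P? xs)
    regroup : ∀ D B g l → D * B + (D * g * B + l * B) + B ≡ D * (1 + g) * B + (1 + l) * B
    regroup = solve-∀
  ... | no ¬p = begin
    D * (f x + sum (map f xs))         ≡⟨ *-distribˡ-+ D (f x) (sum (map f xs)) ⟩
    D * f x + D * sum (map f xs)       ≤⟨ +-mono-≤ (Df≤B ¬p) ih ⟩
    B + (D * g * B + length xs * B)    ≡⟨ regroup B (D * g * B) (length xs * B) ⟩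
    D * g * B + (B + length xs * B)    ∎
    where
    open ≤-Reasoning
    g = length (filter P? xs)
    regroup : ∀ x y z → x + (y + z) ≡ y + (x + z)
    regroup = solve-∀

  -- Markov's inequality for B − f.
  markov : ∀ (f : A → ℕ) B D xs → .{{NonZero B}} → (∀ x → f x ≤ B) →
           length xs * B ≤ D * sum (map f xs) →
           length xs ≤ 2 * D * length (filter (λ x → B ≤? 2 * D * f x) xs)
  markov f B D xs f≤B avg = *-cancelʳ-≤ (length xs) (2 * D * good) B (+-cancelʳ-≤ (length xs * B) _ _ (begin
      length xs * B + length xs * B            ≤⟨ +-mono-≤ avg avg ⟩
      D * sum (map f xs) + D * sum (map f xs)  ≡⟨ twice D (sum (map f xs)) ⟩
      2 * D * sum (map f xs)
        ≤⟨ sum≤-split (λ x → B ≤? 2 * D * f x) f B (2 * D) f≤B (λ B≰ → <⇒≤ (≰⇒> B≰)) xs ⟩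
      2 * D * good * B + length xs * B         ∎))
    where
    open ≤-Reasoning
    good = length (filter (λ x → B ≤? 2 * D * f x) xs)
    twice : ∀ a b → a * b + a * b ≡ 2 * a * b
    twice = solve-∀

  sum-map-≥ : ∀ (f : A → ℕ) D b xs → All (λ x → b ≤ D * f x) xs → length xs * b ≤ D * sum (map f xs)
  sum-map-≥ f D b []       []       = z≤n
  sum-map-≥ f D b (x ∷ xs) (p ∷ ps) =
    ≤-trans (+-mono-≤ p (sum-map-≥ f D b xs ps)) (≤-reflexive (sym (*-distribˡ-+ D (f x) (sum (map f xs)))))

  -- By double counting and `markov`, at least |bs|/(2D) elements of `bs` have |as|/(2D) or more
  -- neighbours in `as`. A 2^-|as| proportion of those share one neighbourhood, which is taken as
  -- `as′`; the degree of any one of them shows that it has at least `q` elements.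
  completeBipartite : ∀ {ρ : A → B → Set} (ρ? : ∀ a → Decidable (ρ a)) D q as bs →
    0 < length as → 0 < length bs → 2 * D * q ≤ length as → .{{NonZero D}} →
    All (λ a → length bs ≤ D * length (filter (ρ? a) bs)) as →
    ∃[ as′ ] ∃[ bs′ ] (as′ ⊆ as × bs′ ⊆ bs × q ≤ length as′ ×
      length bs ≤ 2 * D * (2 ^ length as * length bs′) × All (λ b → All (λ a → ρ a b) as′) bs′)
  completeBipartite {ρ = ρ} ρ? D q as bs 0<as 0<bs 2Dq≤ dense = finish (commonProfile ρ? as good)
    where
    instance
      as≢0 : NonZero (length as)
      as≢0 = >-nonZero 0<as
    good = filter (λ b → length as ≤? 2 * D * degree-in ρ? as b) bs
    good-dense : length bs ≤ 2 * D * length good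
    good-dense = markov (degree-in ρ? as) (length as) D bs
      (λ b → length-filter (λ a → ρ? a b) as)
      (≤-trans (≤-reflexive (*-comm (length bs) (length as)))
        (≤-trans (sum-map-≥ (λ a → length (filter (ρ? a) bs)) D (length bs) as dense)
                 (≤-reflexive (cong (D *_) (sym (doubleCount ρ? as bs))))))
    finish : _ → _
    finish (as′ , bs′ , as′⊆ , bs′⊆ , len , prof) =
      as′ , bs′ , as′⊆ , ⊆-trans bs′⊆ (filter-⊆ _ bs) , q≤ , size≤ , All.map (λ (ps , _) → ps) prof
      where
      size≤ : length bs ≤ 2 * D * (2 ^ length as * length bs′)
      size≤ = ≤-trans good-dense (*-monoʳ-≤ (2 * D) len)
      witness : ∀ bs′ → 0 < length bs′ → bs′ ⊆ good →
                All (λ b → All (λ a → ρ a b) as′ × degree-in ρ? as b ≤ length as′) bs′ →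
                length as ≤ 2 * D * length as′
      witness (b ∷ _) _ s ((_ , d) ∷ _) with p ∷ _ ← All-resp-⊆ s (all-filter (λ b → length as ≤? 2 * D * degree-in ρ? as b) bs) =
        ≤-trans p (*-monoʳ-≤ (2 * D) d)
      -- The lower bound on `as′` is read off a member of `bs′`, so one must exist.
      nonempty : 0 < length bs′
      nonempty = n≢0⇒n>0 λ eq → <-irrefl refl (<-≤-trans 0<bs (≤-trans size≤ (≤-reflexive
        (trans (cong (λ l → 2 * D * (2 ^ length as * l)) eq)
          (trans (cong (2 * D *_) (*-zeroʳ (2 ^ length as))) (*-zeroʳ (2 * D)))))))
      instance
        2D≢0 : NonZero (2 * D)
        2D≢0 = m*n≢0 2 D
      q≤ : q ≤ length as′
      q≤ = *-cancelˡ-≤ (2 * D) (≤-trans 2Dq≤ (witness bs′ nonempty bs′⊆ prof))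

-- Sizes needed along the blow-up.

module CliqueSize where

  open import Data.Nat
  open import Data.Nat.Properties
  open import Data.Nat.Tactic.RingSolver using (solve-∀)
  open import Relation.Binary.PropositionalEquality

  -- One level down the density drops from 1/D to 1/(2D), and `completeBipartite` at that density
  -- needs 4Dq tuples to leave `q`. The recursion composes this demand over `r` levels.
  cliqueSize : ℕ → ℕ → ℕ → ℕ
  cliqueSize zero    D q = q
  cliqueSize (suc r) D q = cliqueSize r (2 * D) (4 * D * q)

  q≤cliqueSize : ∀ r D q → .{{NonZero D}} → q ≤ cliqueSize r D q
  q≤cliqueSize zero    D q = ≤-refl
  q≤cliqueSize (suc r) D q = ≤-trans (m≤n*m q (4 * D) {{m*n≢0 4 D}}) (q≤cliqueSize r (2 * D) (4 * D * q) {{m*n≢0 2 D}})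

  -- The same recursion on binary logarithms, with `D` equal to `2 ^ d` and `q` multiplied by
  -- `2 ^ e`.
  cliqueSizeExponent : ℕ → ℕ → ℕ → ℕ
  cliqueSizeExponent zero    d e = e
  cliqueSizeExponent (suc r) d e = cliqueSizeExponent r (suc d) (2 + (d + e))

  cliqueSize-pow : ∀ r d e q → cliqueSize r (2 ^ d) (2 ^ e * q) ≡ 2 ^ cliqueSizeExponent r d e * q
  cliqueSize-pow zero    d e q = refl
  cliqueSize-pow (suc r) d e q =
    trans (cong (cliqueSize r (2 * 2 ^ d)) (trans (regroup (2 ^ d) (2 ^ e) q)
            (cong (λ z → 2 * (2 * z) * q) (sym (^-distribˡ-+-* 2 d e)))))
          (cliqueSize-pow r (suc d) (2 + (d + e)) q)
    where
    regroup : ∀ a b q → 4 * a * (b * q) ≡ 2 * (2 * (a * b)) * q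
    regroup = solve-∀

-- Blowing a dense pattern up to monochromatic cliques.

module BlowUp {n} (G : ColouredK n) where

  import Data.Fin.Properties as Fin
  open import Data.List using (List; []; _∷_; map; length; filter; allFin; take; zipWith; replicate; cartesianProductWith)
  open import Data.List.Membership.Propositional using (_∈_)
  open import Data.List.Properties using (length-++; length-map; length-tabulate; length-take; length-zipWith; length-replicate; length-filter)
  open import Data.List.Relation.Binary.Sublist.Propositional using (_⊆_; _∷_; ⊆-trans; lookup)
  import Data.List.Relation.Binary.Sublist.Propositional as Sublist
  open import Data.List.Relation.Binary.Sublist.Propositional.Properties using (filter-⊆; take-⊆; All-resp-⊆)
  open import Data.List.Relation.Unary.All as All using (All; []; _∷_)
  open import Data.List.Relation.Unary.All.Properties using (all-filter; replicate⁺)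
  open import Data.List.Relation.Unary.AllPairs using (AllPairs; []; _∷_)
  open import Data.List.Relation.Unary.Any using (here; there)
  open import Data.List.Relation.Unary.Unique.Propositional using (Unique)
  open import Data.List.Relation.Unary.Unique.Propositional.Properties using (allFin⁺)
  open import Data.Nat
  open import Data.Nat.ListAction using (sum)
  open import Data.Nat.Properties
  open import Data.Nat.Tactic.RingSolver using (solve-∀)
  open import Data.Product using (∃-syntax; _×_; _,_; proj₁; proj₂)
  open import Data.Sum using (_⊎_; inj₁; inj₂)
  open import Data.Unit using (⊤; tt)
  open import Data.Vec using (Vec; []; _∷_)
  open import Function using (_∘_; id)
  open import Relation.Binary.PropositionalEquality
  open import Relation.Nullary using (Dec; yes; no; ¬?)
  open import Relation.Unary using (Decidable)
  open ListCounting
  open CliqueSize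
  open Patterns

  V : Set
  V = Fin n

  open Tuples (allFin n)

  Mono : Colour → V → V → Set
  Mono c u v = u ≢ v × colour G u v ≡ c

  -- Erdős-Szekeres with the power `2 ^ (a + b)` in place of the binomial coefficient: it halves
  -- when either target drops by one.
  ramsey : ∀ a b (W : List V) → Unique W → 2 ^ (a + b) ≤ length W →
           (∃[ Q ] (Q ⊆ W × length Q ≡ a × AllPairs (Mono red) Q)) ⊎
           (∃[ Q ] (Q ⊆ W × length Q ≡ b × AllPairs (Mono blue) Q))
  ramsey zero    b       W u le = inj₁ ([] , Sublist.minimum W , refl , [])
  ramsey (suc a) zero    W u le = inj₂ ([] , Sublist.minimum W , refl , [])
  ramsey (suc a) (suc b) [] u le with () ← <⇒≱ (m^n>0 2 (suc a + suc b)) le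
  ramsey (suc a) (suc b) (v ∷ W) (v∉W ∷ u) le = split (2 ^ (a + suc b) ≤? length R)
    where
    red?   = λ w → colour G v w ≟ᶜ red
    R B : List V
    R = filter red? W
    B = filter (¬? ∘ red?) W
    extend : ∀ {c Q S} → S ⊆ W → All (λ w → colour G v w ≡ c) S → Q ⊆ S → AllPairs (Mono c) Q → AllPairs (Mono c) (v ∷ Q)
    extend S⊆W col Q⊆S pairs =
      All.zipWith id (All-resp-⊆ (⊆-trans Q⊆S S⊆W) v∉W , All-resp-⊆ Q⊆S col) ∷ pairs
    R⊆W : R ⊆ W
    R⊆W = filter-⊆ red? W
    B⊆W : B ⊆ W
    B⊆W = filter-⊆ (¬? ∘ red?) W
    inRed : 2 ^ (a + suc b) ≤ length R → _
    inRed le with ramsey a (suc b) R (AllPairs-⊆ R⊆W u) le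
    ... | inj₁ (Q , Q⊆R , len , pairs) = inj₁ (v ∷ Q , refl ∷ ⊆-trans Q⊆R R⊆W , cong suc len ,
                                              extend R⊆W (all-filter red? W) Q⊆R pairs)
    ... | inj₂ (Q , Q⊆R , len , pairs) = inj₂ (Q , _ Sublist.∷ʳ ⊆-trans Q⊆R R⊆W , len , pairs)
    inBlue : 2 ^ (suc a + b) ≤ length B → _
    inBlue le with ramsey (suc a) b B (AllPairs-⊆ B⊆W u) le
    ... | inj₁ (Q , Q⊆B , len , pairs) = inj₁ (Q , _ Sublist.∷ʳ ⊆-trans Q⊆B B⊆W , len , pairs)
    ... | inj₂ (Q , Q⊆B , len , pairs) = inj₂ (v ∷ Q , refl ∷ ⊆-trans Q⊆B B⊆W , cong suc len ,
            extend B⊆W (All.map ≢⇒opposite (all-filter (¬? ∘ red?) W)) Q⊆B pairs)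
    split : Dec (2 ^ (a + suc b) ≤ length R) → _
    split (yes le′) = inRed le′
    -- The strict shortfall of `R` makes up for the vertex `v` lost from the list.
    split (no R<)   = inBlue (subst (λ e → 2 ^ e ≤ length B) (+-suc a b)
                      (+-cancelˡ-≤ (length R) _ _ (s≤s⁻¹ (begin
        suc (length R) + 2 ^ (a + suc b)       ≤⟨ +-monoˡ-≤ (2 ^ (a + suc b)) (≰⇒> R<) ⟩
        2 ^ (a + suc b) + 2 ^ (a + suc b)      ≡⟨ cong (2 ^ (a + suc b) +_) (+-identityʳ (2 ^ (a + suc b))) ⟨
        2 ^ (suc a + suc b)                    ≤⟨ le ⟩
        suc (length W)                         ≡⟨ cong suc (length-filter-¬ red? W) ⟩
        suc (length R + length B)              ∎))))
      where open ≤-Reasoning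

  monochromaticClique : ∀ q (W : List V) → Unique W → 2 ^ (q + q) ≤ length W →
    ∃[ c ] ∃[ Q ] (Q ⊆ W × length Q ≡ q × AllPairs (Mono c) Q)
  monochromaticClique q W u le with ramsey q q W u le
  ... | inj₁ found = red  , found
  ... | inj₂ found = blue , found

  module _ (κ : Colour) where

    -- Entries of one tuple are also tested against the later entries of the other, so positions may
    -- be filled from different tuples without changing the colours in between.
    Linked : ∀ {r} → Vec Colour r → Vec V r → Vec V r → Set
    Linked []       []      []      = ⊤
    Linked (c ∷ cs) (v ∷ p) (w ∷ q) =
      Mono c v w × (Compatible (colour G) κ v q × Compatible (colour G) κ w p) × Linked cs p q

    -- Every `w` in `Q` extends every `p` in `L`. Matching the two lists in parallel therefore
    -- retains all cross relations, while every new tuple gets its own clique vertex.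
    linked-zip : ∀ {r} (M : Vec V (suc r) → Set) → (∀ {p} → M p → Ok (colour G) κ p) → ∀ c cs Q L →
      AllPairs (Mono c) Q → AllPairs (Linked cs) L → (∀ {w p} → w ∈ Q → p ∈ L → M (w ∷ p)) →
      All M (zipWith _∷_ Q L) × AllPairs (Linked (c ∷ cs)) (zipWith _∷_ Q L)
    linked-zip M M⇒Ok c cs []      L       _          _          m = [] , []
    linked-zip M M⇒Ok c cs (w ∷ Q) []      _          _          m = [] , []
    linked-zip M M⇒Ok c cs (w ∷ Q) (p ∷ L) (wQ ∷ mono) (pL ∷ links) m
      with ms , rest ← linked-zip M M⇒Ok c cs Q L mono links (λ w∈ p∈ → m (there w∈) (there p∈)) =
      m (here refl) (here refl) ∷ ms ,
      heads Q L wQ pL (λ p∈ → proj₁ (M⇒Ok (m (here refl) (there p∈))))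
                      (λ w∈ → proj₁ (M⇒Ok (m (there w∈) (here refl)))) ∷ rest
      where
      heads : ∀ Q L → All (Mono c w) Q → All (Linked cs p) L →
              (∀ {p′} → p′ ∈ L → Compatible (colour G) κ w p′) → (∀ {w′} → w′ ∈ Q → Compatible (colour G) κ w′ p) →
              All (Linked (c ∷ cs) (w ∷ p)) (zipWith _∷_ Q L)
      heads []       L        _          _          f g = []
      heads (w′ ∷ Q) []       _          _          f g = []
      heads (w′ ∷ Q) (p′ ∷ L) (ww′ ∷ wQ) (pp′ ∷ pL) f g =
        (ww′ , (f (here refl) , g (here refl)) , pp′) ∷ heads Q L wQ pL (f ∘ there) (g ∘ there)

    linked-[] : ∀ (L : List (Vec V 0)) → AllPairs (Linked []) L
    linked-[] []      = []
    linked-[] ([] ∷ L) = All.universal (λ { [] → tt }) L ∷ linked-[] L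

    -- Nikiforov's induction: blow up the (r−1)-tuples with many extensions, then find a clique among
    -- the common extensions of a positive proportion of the blow-up.
    blowUp : ∀ r D q → .{{NonZero D}} → .{{NonZero q}} → (M : Vec V r → Set) (M? : Decidable M) →
      (∀ {p} → M p → Ok (colour G) κ p) → n ^ r ≤ D * length (filter M? (tuples r)) →
      2 ^ (3 * cliqueSize r D q) ≤ n →
      ∃[ cs ] ∃[ L ] (length L ≡ q × All M L × AllPairs (Linked cs) L)
    blowUp zero D q M M? M⇒Ok dense large = [] , replicate q [] , length-replicate q , replicate⁺ q M[] , linked-[] (replicate q [])
      where
      M[] : M []
      M[] with M? []
      ... | yes m = m
      ... | no _ with () ← ≤-trans dense (≤-reflexive (*-zeroʳ D))
    blowUp (suc r) D q M M? M⇒Ok dense large = extend (blowUp r (2 * D) (4 * D * q) {{D′≢0}} {{q′≢0}} good good? good⇒Ok good-dense large)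
      where
      open ≤-Reasoning
      vs = allFin n
      |vs| : length vs ≡ n
      |vs| = length-tabulate id
      instance
        n≢0 : NonZero n
        n≢0 = >-nonZero (≤-trans (m^n>0 2 (3 * cliqueSize (suc r) D q)) large)
        D′≢0 : NonZero (2 * D)
        D′≢0 = m*n≢0 2 D
        4D≢0 : NonZero (4 * D)
        4D≢0 = m*n≢0 4 D
        q′≢0 : NonZero (4 * D * q)
        q′≢0 = m*n≢0 (4 * D) q
      extensions : Vec V r → ℕ
      extensions p = length (filter (λ v → M? (v ∷ p)) vs)
      -- The induction continues with this predicate, which is why `M` is arbitrary. It still
      -- implies `Ok`: as `n` is positive, a good tuple has an extension in `M`, and the tail of an
      -- `Ok` tuple is `Ok`.
      good : Vec V r → Set
      good p = n ≤ 2 * D * extensions p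
      good? : Decidable good
      good? p = n ≤? 2 * D * extensions p
      good⇒Ok : ∀ {p} → good p → Ok (colour G) κ p
      good⇒Ok {p} g with filter (λ v → M? (v ∷ p)) vs | all-filter (λ v → M? (v ∷ p)) vs
      ... | []    | _     with () ← <⇒≱ (>-nonZero⁻¹ n) (≤-trans g (≤-reflexive (*-zeroʳ (2 * D))))
      ... | _ ∷ _ | m ∷ _ = proj₂ (M⇒Ok m)
      |tuples| : ∀ r → length (tuples r) ≡ n ^ r
      |tuples| zero    = refl
      |tuples| (suc r) = trans (length-product (tuples r) vs) (trans (cong₂ _*_ (|tuples| r) |vs|) (*-comm (n ^ r) n))
        where
        length-product : ∀ {A B C : Set} {f : A → B → C} xs ys →
                         length (cartesianProductWith f xs ys) ≡ length xs * length ys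
        length-product []       ys = refl
        length-product {f = f} (x ∷ xs) ys = trans (length-++ (map (f x) ys))
          (cong₂ _+_ (length-map (f x) ys) (length-product xs ys))
      good-dense : n ^ r ≤ 2 * D * length (filter good? (tuples r))
      good-dense = subst (_≤ 2 * D * length (filter good? (tuples r))) (|tuples| r)
        (markov extensions n D (tuples r)
          (λ p → ≤-trans (length-filter (λ v → M? (v ∷ p)) vs) (≤-reflexive |vs|)) (begin
            length (tuples r) * n               ≡⟨ cong (_* n) (|tuples| r) ⟩
            n ^ r * n                           ≡⟨ *-comm (n ^ r) n ⟩
            n ^ suc r                           ≤⟨ dense ⟩
            D * length (filter M? (tuples (suc r)))
              ≡⟨ cong (D *_) (length-filter-product M? (λ p v → v ∷ p) (tuples r) vs) ⟩
            D * sum (map extensions (tuples r)) ∎))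
      m = 4 * D * q
      extend : _ → _
      extend (cs , L , |L| , goodL , links) = result (completeBipartite {ρ = λ p v → M (v ∷ p)} (λ p v → M? (v ∷ p)) (2 * D) q L vs
          (subst (0 <_) (sym |L|) (>-nonZero⁻¹ m)) (subst (0 <_) (sym |vs|) (>-nonZero⁻¹ n))
          (≤-reflexive (trans (cong (_* q) (twice D)) (sym |L|)))
          (All.map (λ {p} → subst (_≤ 2 * D * extensions p) (sym |vs|)) goodL))
        where
        twice : ∀ D → 2 * (2 * D) ≡ 4 * D
        twice = solve-∀
        result : _ → _
        result (L′ , W , L′⊆L , W⊆vs , q≤L′ , |W|≥ , ms) =
          found (monochromaticClique q W (AllPairs-⊆ W⊆vs (allFin⁺ n)) 2^2q≤W)
          where
          m≤2^m : ∀ m → m ≤ 2 ^ m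
          m≤2^m zero    = z≤n
          m≤2^m (suc m) = ≤-trans (+-mono-≤ (m^n>0 2 m) (m≤2^m m)) (≤-reflexive (cong (2 ^ m +_) (sym (+-identityʳ (2 ^ m)))))
          -- Of the three factors `2 ^ m` in `n`, one is lost to the pigeonhole over neighbourhoods
          -- and one covers `4 * D`, which is at most `m`; the third remains for Ramsey, since 2q ≤
          -- m.
          2^2q≤W : 2 ^ (q + q) ≤ length W
          2^2q≤W = ≤-trans (^-monoʳ-≤ 2 2q≤m) (*-cancelˡ-≤ (2 ^ m * 2 ^ m) {{m*n≢0 (2 ^ m) (2 ^ m) {{m^n≢0 2 m}} {{m^n≢0 2 m}}}} (begin
            2 ^ m * 2 ^ m * 2 ^ m                 ≡⟨ cube m ⟨
            2 ^ (3 * m)                           ≤⟨ ^-monoʳ-≤ 2 (*-monoʳ-≤ 3 (q≤cliqueSize r (2 * D) m)) ⟩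
            2 ^ (3 * cliqueSize r (2 * D) m)      ≤⟨ large ⟩
            n                                     ≡⟨ |vs| ⟨
            length vs                             ≤⟨ |W|≥ ⟩
            2 * (2 * D) * (2 ^ length L * length W) ≡⟨ cong₂ (λ a l → a * (2 ^ l * length W)) (twice D) |L| ⟩
            4 * D * (2 ^ m * length W)            ≤⟨ *-monoˡ-≤ (2 ^ m * length W) (≤-trans (m≤m*n (4 * D) q) (m≤2^m m)) ⟩
            2 ^ m * (2 ^ m * length W)            ≡⟨ *-assoc (2 ^ m) (2 ^ m) (length W) ⟨
            2 ^ m * 2 ^ m * length W              ∎))
            where
            cube : ∀ m → 2 ^ (3 * m) ≡ 2 ^ m * 2 ^ m * 2 ^ m
            cube m = trans (^-distribˡ-+-* 2 m (m + (m + 0))) (trans (cong (2 ^ m *_)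
              (trans (^-distribˡ-+-* 2 m (m + 0)) (cong (λ e → 2 ^ m * 2 ^ e) (+-identityʳ m)))) (sym (*-assoc (2 ^ m) (2 ^ m) (2 ^ m))))
            2q≤m : q + q ≤ m
            2q≤m = ≤-trans (≤-reflexive (double q)) (*-monoˡ-≤ q (≤-trans (s≤s (s≤s z≤n)) (*-monoʳ-≤ 4 (>-nonZero⁻¹ D))))
              where
              double : ∀ q → q + q ≡ 2 * q
              double = solve-∀
          found : _ → _
          found (c , Q , Q⊆W , |Q| , mono)
            with ms′ , links′ ← linked-zip M M⇒Ok c cs Q (take q L′) mono
                   (AllPairs-⊆ (⊆-trans (take-⊆ q L′) L′⊆L) links)
                   (λ w∈ p∈ → All.lookup (All.lookup ms (lookup Q⊆W w∈)) (lookup (take-⊆ q L′) p∈)) =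
            c ∷ cs , zipWith _∷_ Q (take q L′) ,
            trans (length-zipWith _∷_ Q (take q L′))
              (trans (cong₂ _⊓_ |Q| (trans (length-take q L′) (m≤n⇒m⊓n≡m q≤L′))) (⊓-idem q)) ,
            ms′ , links′

Split : ∀ {n} → ColouredK n → ℕ → Set
Split {n} G t =
  Σ[ A ∈ Subset n ] Σ[ B ∈ Subset n ] Σ[ c ∈ Colour ]
    (∣ A ∣ ≡ t × ∣ B ∣ ≡ t × Disjoint A B ×
     AllInside G c A × AllInside G c B × AllBetween G (opposite c) A B)

-- Subsets from duplicate-free lists.

module ListSubset where

  open import Data.Fin using (zero; suc)
  import Data.Fin.Properties as Fin
  open import Data.Fin.Subset using (⊥; _∈_; _∉_; inside; outside)
  open import Data.Fin.Subset.Properties using (∉⊥; ∣⊥∣≡0)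
  open import Data.List using (List; []; _∷_; length)
  import Data.List.Membership.Propositional as List
  open import Data.List.Relation.Unary.All as All using ([]; _∷_)
  open import Data.List.Relation.Unary.AllPairs using ([]; _∷_)
  open import Data.List.Relation.Unary.Any using (here; there)
  open import Data.List.Relation.Unary.Unique.Propositional using (Unique)
  open import Data.Vec using ([]; _∷_; _[_]≔_)
  open import Data.Vec.Properties using (lookup∘update′; []=⇒lookup; lookup⇒[]=)
  open import Data.Vec.Base using (here; there)
  open import Relation.Binary.PropositionalEquality
  open import Relation.Nullary using (yes; no; contradiction)

  fromList : ∀ {n} → List (Fin n) → Subset n
  fromList []       = ⊥
  fromList (v ∷ xs) = fromList xs [ v ]≔ inside

  ∈-fromList⁻ : ∀ {n} (xs : List (Fin n)) {v} → v ∈ fromList xs → v List.∈ xs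
  ∈-fromList⁻ []       v∈ = contradiction v∈ ∉⊥
  ∈-fromList⁻ (x ∷ xs) {v} v∈ with v Fin.≟ x
  ... | yes refl = here refl
  ... | no v≢x   = there (∈-fromList⁻ xs (lookup⇒[]= v (fromList xs)
                     (trans (sym (lookup∘update′ v≢x (fromList xs) inside)) ([]=⇒lookup v∈))))

  ∣insert∣ : ∀ {n} (p : Subset n) v → v ∉ p → ∣ p [ v ]≔ inside ∣ ≡ suc ∣ p ∣
  ∣insert∣ (inside  ∷ p) zero    v∉p = contradiction here v∉p
  ∣insert∣ (outside ∷ p) zero    v∉p = refl
  ∣insert∣ (inside  ∷ p) (suc v) v∉p = cong suc (∣insert∣ p v (λ v∈p → v∉p (there v∈p)))
  ∣insert∣ (outside ∷ p) (suc v) v∉p = ∣insert∣ p v (λ v∈p → v∉p (there v∈p))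

  ∣fromList∣ : ∀ {n} {xs : List (Fin n)} → Unique xs → ∣ fromList xs ∣ ≡ length xs
  ∣fromList∣ {n} {[]}     []       = ∣⊥∣≡0 n
  ∣fromList∣ {n} {x ∷ xs} (x∉ ∷ u) = trans
    (∣insert∣ (fromList xs) x (λ x∈ → All.lookup x∉ (∈-fromList⁻ xs x∈) refl)) (cong suc (∣fromList∣ u))

-- Two of the four cliques form the required configuration.

module Extraction {n} (G : ColouredK n) (κ : Colour) where

  open import Data.Empty using (⊥-elim)
  open import Data.Fin.Patterns using (0F; 1F; 2F; 3F)
  open import Data.Fin.Subset using (_∈_)
  open import Data.List using (List; []; _∷_; length; map)
  import Data.List.Membership.Propositional as List
  open import Data.List.Membership.Propositional.Properties using (∈-map⁻)
  open import Data.List.Properties using (length-map)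
  open import Data.List.Relation.Unary.All as All using (All; []; _∷_)
  open import Data.List.Relation.Unary.AllPairs as AllPairs using (AllPairs; []; _∷_)
  open import Data.List.Relation.Unary.AllPairs.Properties using (map⁺)
  open import Data.List.Relation.Unary.Any using (here; there)
  open import Data.Nat.Properties using (suc-injective)
  open import Data.Product using (_,_; proj₁; proj₂)
  open import Data.Sum using (_⊎_; inj₁; inj₂)
  open import Data.Vec using (Vec; []; _∷_; lookup)
  open import Relation.Binary.PropositionalEquality
  open import Relation.Nullary using (yes; no)
  open Patterns
  open ListSubset
  open BlowUp G

  private
    κ̄ = opposite κ

  related : ∀ {A : Set} {R : A → A → Set} {xs x y} → AllPairs R xs → x List.∈ xs → y List.∈ xs →
            x ≡ y ⊎ R x y ⊎ R y x
  related (r ∷ rs) (here refl) (here refl) = inj₁ refl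
  related (r ∷ rs) (here refl) (there y∈)  = inj₂ (inj₁ (All.lookup r y∈))
  related (r ∷ rs) (there x∈)  (here refl) = inj₂ (inj₂ (All.lookup r x∈))
  related (r ∷ rs) (there x∈)  (there y∈)  = related rs x∈ y∈

  module _ {c₀ c₁ c₂ c₃ : Colour} where

    Linked₄ : Vec V 4 → Vec V 4 → Set
    Linked₄ = Linked κ (c₀ ∷ c₁ ∷ c₂ ∷ c₃ ∷ [])

    column : Fin 4 → Vec V 4 → V
    column i p = lookup p i

    Inside : Fin 4 → Colour → Set
    Inside i c = ∀ {p q} → Linked₄ p q → Mono c (column i p) (column i q)

    -- A link is directed along the list, so it has to supply both diagonals.
    Between : Fin 4 → Fin 4 → Colour → Set
    Between i j c = (∀ {p} → Ok (colour G) κ p → colour G (column i p) (column j p) ≡ c) ×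
                    (∀ {p q} → Linked₄ p q → colour G (column i p) (column j q) ≡ c ×
                                             colour G (column i q) (column j p) ≡ c)

    -- The tuple p₀ is only used to see that the columns i and j are disjoint: a common vertex v would
    -- make p₀ᵢv both of colour c and of the opposite colour.
    split : ∀ {t} i j c → Inside i c → Inside j c → Between i j (opposite c) →
            ∀ {L} → length L ≡ suc t → All (Ok (colour G) κ) L → AllPairs Linked₄ L → Split G t
    split {t} i j c in-i in-j (same , cross) {p₀ ∷ L} len oks links =
      side i , side j , c , ∣side∣ i in-i , ∣side∣ j in-j , disjoint ,
      all-inside i in-i , all-inside j in-j , all-between
      where
      side : Fin 4 → Subset n
      side i = fromList (map (column i) L)
      ∈-side : ∀ {i v} → v ∈ side i → Σ[ p ∈ Vec V 4 ] (p List.∈ L × v ≡ column i p)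
      ∈-side {i} v∈ = ∈-map⁻ (column i) (∈-fromList⁻ (map (column i) L) v∈)
      ∣side∣ : ∀ i {c} → Inside i c → ∣ side i ∣ ≡ t
      ∣side∣ i ins = trans (∣fromList∣ (map⁺ (AllPairs.map (λ l → proj₁ (ins l)) (AllPairs.tail links))))
                           (trans (length-map (column i) L) (suc-injective len))
      between : ∀ {p q} → p List.∈ (p₀ ∷ L) → q List.∈ (p₀ ∷ L) → colour G (column i p) (column j q) ≡ opposite c
      between p∈ q∈ with related links p∈ q∈
      ... | inj₁ refl     = same (All.lookup oks p∈)
      ... | inj₂ (inj₁ l) = proj₁ (cross l)
      ... | inj₂ (inj₂ l) = proj₂ (cross l)
      all-between : AllBetween G (opposite c) (side i) (side j)
      all-between u∈ v∈ with p , p∈ , refl ← ∈-side u∈ | q , q∈ , refl ← ∈-side v∈ = between (there p∈) (there q∈)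
      all-inside : ∀ i {c} → Inside i c → AllInside G c (side i)
      all-inside i ins u∈ v∈ u≢v with p , p∈ , refl ← ∈-side u∈ | q , q∈ , refl ← ∈-side v∈
        with related (AllPairs.tail links) p∈ q∈
      ... | inj₁ refl     = ⊥-elim (u≢v refl)
      ... | inj₂ (inj₁ l) = proj₂ (ins l)
      ... | inj₂ (inj₂ l) = trans (symmetric G _ _) (proj₂ (ins l))
      disjoint : Disjoint (side i) (side j)
      disjoint v∈A v∈B with p , p∈ , refl ← ∈-side v∈A | q , q∈ , eq ← ∈-side v∈B =
        opposite≢ (trans (cong (colour G (column i p₀)) eq) (between (here refl) (there q∈)))
                  (proj₂ (in-i (All.lookup (AllPairs.head links) p∈)))

    inside₀ : Inside 0F c₀
    inside₀ {_ ∷ _ ∷ _ ∷ _ ∷ []} {_ ∷ _ ∷ _ ∷ _ ∷ []} (m , _) = m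
    inside₁ : Inside 1F c₁
    inside₁ {_ ∷ _ ∷ _ ∷ _ ∷ []} {_ ∷ _ ∷ _ ∷ _ ∷ []} (_ , _ , m , _) = m
    inside₂ : Inside 2F c₂
    inside₂ {_ ∷ _ ∷ _ ∷ _ ∷ []} {_ ∷ _ ∷ _ ∷ _ ∷ []} (_ , _ , _ , _ , m , _) = m
    inside₃ : Inside 3F c₃
    inside₃ {_ ∷ _ ∷ _ ∷ _ ∷ []} {_ ∷ _ ∷ _ ∷ _ ∷ []} (_ , _ , _ , _ , _ , _ , m , _) = m

    between₀₁ : Between 0F 1F κ
    between₀₁ = (λ { {_ ∷ _ ∷ _ ∷ _ ∷ []} ((e , _) , _) → e }) ,
      λ { {_ ∷ _ ∷ _ ∷ _ ∷ []} {_ ∷ _ ∷ _ ∷ _ ∷ []} (_ , ((e , _) , (e′ , _)) , _) → e , e′ }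
    between₀₂ : Between 0F 2F κ̄
    between₀₂ = (λ { {_ ∷ _ ∷ _ ∷ _ ∷ []} ((_ , e , _) , _) → e }) ,
      λ { {_ ∷ _ ∷ _ ∷ _ ∷ []} {_ ∷ _ ∷ _ ∷ _ ∷ []} (_ , ((_ , e , _) , (_ , e′ , _)) , _) → e , e′ }
    between₀₃ : Between 0F 3F κ̄
    between₀₃ = (λ { {_ ∷ _ ∷ _ ∷ _ ∷ []} ((_ , _ , e) , _) → e }) ,
      λ { {_ ∷ _ ∷ _ ∷ _ ∷ []} {_ ∷ _ ∷ _ ∷ _ ∷ []} (_ , ((_ , _ , e) , (_ , _ , e′)) , _) → e , e′ }
    between₁₂ : Between 1F 2F κ̄
    between₁₂ = (λ { {_ ∷ _ ∷ _ ∷ _ ∷ []} (_ , (e , _) , _) → e }) ,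
      λ { {_ ∷ _ ∷ _ ∷ _ ∷ []} {_ ∷ _ ∷ _ ∷ _ ∷ []} (_ , _ , _ , ((e , _) , (e′ , _)) , _) → e , e′ }
    between₁₃ : Between 1F 3F κ̄
    between₁₃ = (λ { {_ ∷ _ ∷ _ ∷ _ ∷ []} (_ , (_ , e) , _) → e }) ,
      λ { {_ ∷ _ ∷ _ ∷ _ ∷ []} {_ ∷ _ ∷ _ ∷ _ ∷ []} (_ , _ , _ , ((_ , e) , (_ , e′)) , _) → e , e′ }
    between₂₃ : Between 2F 3F κ
    between₂₃ = (λ { {_ ∷ _ ∷ _ ∷ _ ∷ []} (_ , _ , e , _) → e }) ,
      λ { {_ ∷ _ ∷ _ ∷ _ ∷ []} {_ ∷ _ ∷ _ ∷ _ ∷ []} (_ , _ , _ , _ , _ , (e , e′) , _) → e , e′ }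

  -- If columns 0, 1 (or 2, 3) both have the colour opposite to κ they form the pattern themselves;
  -- otherwise a column of colour κ from each of the two pairs does.
  extract : ∀ {t} (cs : Vec Colour 4) {L} → length L ≡ suc t → All (Ok (colour G) κ) L → AllPairs (Linked κ cs) L → Split G t
  extract (c₀ ∷ c₁ ∷ c₂ ∷ c₃ ∷ []) len oks links
    with c₀ ≟ᶜ κ | c₁ ≟ᶜ κ | c₂ ≟ᶜ κ | c₃ ≟ᶜ κ
  ... | no n₀    | no n₁    | _        | _
    with refl ← ≢⇒opposite n₀ | refl ← ≢⇒opposite n₁ =
    split 0F 1F κ̄ inside₀ inside₁ (subst (Between 0F 1F) (sym (opposite-involutive κ)) between₀₁) len oks links
  ... | yes refl | _        | yes refl | _        = split 0F 2F κ inside₀ inside₂ between₀₂ len oks links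
  ... | yes refl | _        | no _     | yes refl = split 0F 3F κ inside₀ inside₃ between₀₃ len oks links
  ... | no _     | yes refl | yes refl | _        = split 1F 2F κ inside₁ inside₂ between₁₂ len oks links
  ... | no _     | yes refl | no _     | yes refl = split 1F 3F κ inside₁ inside₃ between₁₃ len oks links
  ... | _        | _        | no n₂    | no n₃
    with refl ← ≢⇒opposite n₂ | refl ← ≢⇒opposite n₃ =
    split 2F 3F κ̄ inside₂ inside₃ (subst (Between 2F 3F) (sym (opposite-involutive κ)) between₂₃) len oks links

-- The theorem over the natural numbers, with explicit exponents.

module Finite where

  import Data.Fin.Properties as Fin
  import Data.Integer as ℤ
  import Data.Integer.Properties as ℤ
  open import Data.List using ([]; _∷_; length; filter; allFin)
  open import Data.Nat
  open import Data.Nat.Properties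
  open import Data.Nat.Tactic.RingSolver using (solve-∀)
  open import Data.Product using (_,_; proj₂; ∃-syntax)
  open import Relation.Binary.PropositionalEquality
  open import Relation.Nullary using (yes; no; ¬?; _×-dec_; contradiction)
  open import Relation.Unary using (Decidable)
  open Patterns
  open CliqueSize

  length-filter-mono : ∀ {A : Set} {P Q : A → Set} (P? : Decidable P) (Q? : Decidable Q) → (∀ {x} → P x → Q x) →
                       ∀ xs → length (filter P? xs) ≤ length (filter Q? xs)
  length-filter-mono P? Q? P⇒Q []       = z≤n
  length-filter-mono P? Q? P⇒Q (x ∷ xs) with length-filter-mono P? Q? P⇒Q xs | P? x | Q? x
  ... | ih | yes _ | yes _ = s≤s ih
  ... | ih | yes p | no ¬q = contradiction (P⇒Q p) ¬q
  ... | ih | no _  | yes _ = m≤n⇒m≤1+n ih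
  ... | ih | no _  | no _  = ih

  -- 16k² meets the second-moment requirement and exceeds 10k as well; the 4 guarantees four
  -- distinct positions.
  sampleSize : ℕ → ℕ
  sampleSize k = 4 + 16 * (k * k)

  -- Every colour class has at least (1/4 + 1/k) n edges at every vertex.
  Balanced : ∀ {n} → ColouredK n → ℕ → Set
  Balanced {n} G k = ∀ v c → (k + 4) * n ≤ 4 * k * degree G c v

  splitsIfDense : ∀ {n} (G : ColouredK n) κ D t → .{{NonZero D}} →
    n ^ 4 ≤ D * length (filter (ok? (colour G) κ) (Tuples.tuples (allFin n) 4)) →
    2 ^ (3 * cliqueSize 4 D (suc t)) ≤ n → Split G t
  -- One tuple more than `t` is requested, for the disjointness argument in the extraction.
  splitsIfDense G κ D t dense large = finish (BlowUp.blowUp G κ 4 D (suc t) (Ok (colour G) κ) (ok? (colour G) κ) (λ ok → ok) dense large)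
    where
    finish : _ → _
    finish (cs , L , len , oks , links) = Extraction.extract G κ cs len oks links

  splits : ∀ {n} (G : ColouredK n) k d t → .{{NonZero k}} → Balanced G k → 4 * sampleSize k ^ 4 ≤ 2 ^ d →
           2 ^ (3 * (2 ^ cliqueSizeExponent 4 d 0 * suc t)) ≤ n → Split G t
  splits {zero}  G k d t bal D≤ large = contradiction large (<⇒≱ (m^n>0 2 (3 * (2 ^ cliqueSizeExponent 4 d 0 * suc t))))
  splits {suc n} G k d t bal D≤ large =
    build (Density.patternsDense G k (3 + 16 * (k * k)) (16 * (k * k)) refl balancedℤ enough enough′)
    where
    balancedℤ : ∀ v c → (ℤ.+ k ℤ.+ ℤ.+ 4) ℤ.* ℤ.+ suc n ℤ.≤ ℤ.+ 4 ℤ.* ℤ.+ k ℤ.* Density.deg G c v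
    balancedℤ v c = begin
      (ℤ.+ k ℤ.+ ℤ.+ 4) ℤ.* ℤ.+ suc n                ≡⟨ ℤ.pos-* (k + 4) (suc n) ⟨
      ℤ.+ ((k + 4) * suc n)                          ≤⟨ ℤ.+≤+ (≤-trans (bal v c) (*-monoʳ-≤ (4 * k) degree≤)) ⟩
      ℤ.+ (4 * k * length (filter (λ w → colour G v w ≟ᶜ c) (allFin (suc n))))
        ≡⟨ ℤ.pos-* (4 * k) (length (filter (λ w → colour G v w ≟ᶜ c) (allFin (suc n)))) ⟩
      ℤ.+ (4 * k) ℤ.* ℤ.+ length (filter (λ w → colour G v w ≟ᶜ c) (allFin (suc n)))
        ≡⟨ cong₂ ℤ._*_ (ℤ.pos-* 4 k) (sym (IntegerSums.∑-filter (λ w → colour G v w ≟ᶜ c) (allFin (suc n)))) ⟩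
      ℤ.+ 4 ℤ.* ℤ.+ k ℤ.* Density.deg G c v          ∎
      where
      open ℤ.≤-Reasoning
      degree≤ : degree G c v ≤ length (filter (λ w → colour G v w ≟ᶜ c) (allFin (suc n)))
      degree≤ = length-filter-mono (λ w → ¬? (v Fin.≟ w) ×-dec (colour G v w ≟ᶜ c)) (λ w → colour G v w ≟ᶜ c)
                                   proj₂ (allFin (suc n))
    enough : ℤ.+ 16 ℤ.* (ℤ.+ k ℤ.* ℤ.+ k) ℤ.≤ ℤ.+ sampleSize k
    enough = subst (ℤ._≤ ℤ.+ sampleSize k) (trans (ℤ.pos-* 16 (k * k)) (cong (ℤ.+ 16 ℤ.*_) (ℤ.pos-* k k)))
      (ℤ.+≤+ (m≤n+m (16 * (k * k)) 4))
    enough′ : ℤ.+ 10 ℤ.* ℤ.+ k ℤ.≤ ℤ.+ sampleSize k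
    enough′ = subst (ℤ._≤ ℤ.+ sampleSize k) (ℤ.pos-* 10 k) (ℤ.+≤+ (begin
      10 * k              ≤⟨ *-mono-≤ {10} {16} (m≤m+n 10 6) (m≤m*n k k) ⟩
      16 * (k * k)        ≤⟨ m≤n+m (16 * (k * k)) 4 ⟩
      4 + 16 * (k * k)    ∎))
      where open ≤-Reasoning
    build : ∃[ κ ] suc n ^ 4 ≤ 4 * sampleSize k ^ 4 * length (filter (ok? (colour G) κ) (Tuples.tuples (allFin (suc n)) 4)) →
            Split G t
    build (κ , dense) = splitsIfDense G κ (2 ^ d) t {{m^n≢0 2 d}} (≤-trans dense (*-monoˡ-≤ _ D≤))
      (subst (λ e → 2 ^ (3 * e) ≤ suc n)
        (sym (trans (cong (cliqueSize 4 (2 ^ d)) (sym (*-identityˡ (suc t)))) (cliqueSize-pow 4 d 0 (suc t)))) large)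

  -- For k = 2^j the sample size 4 + 16k² is at most 32k² = 2^(2j+5); its fourth power times 4 gives
  -- `densityExponent`. The 3 in `exponent` stands for a factor 8, as 3 (t + 1) ≤ 8t.
  densityExponent exponent : ℕ → ℕ
  densityExponent j = 2 + (j * 2 + 5) * 4
  exponent j = 3 + cliqueSizeExponent 4 (densityExponent j) 0

  splits-pow : ∀ {n} (G : ColouredK n) j t → .{{NonZero t}} → Balanced G (2 ^ j) →
               2 ^ (t * 2 ^ exponent j) ≤ n → Split G t
  splits-pow {n} G j t bal large = splits G k (densityExponent j) t {{m^n≢0 2 j}} bal D≤
      (≤-trans (^-monoʳ-≤ 2 (bound (2 ^ cliqueSizeExponent 4 (densityExponent j) 0))) large)
    where
    open ≤-Reasoning
    k : ℕ
    k = 2 ^ j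
    bound : ∀ X → 3 * (X * suc t) ≤ t * (2 * (2 * (2 * X)))
    bound X = begin
      3 * (X * suc t)          ≤⟨ *-mono-≤ {3} {4} (m≤m+n 3 1) (*-monoʳ-≤ X (+-monoˡ-≤ t (>-nonZero⁻¹ t))) ⟩
      4 * (X * (t + t))        ≡⟨ regroup X t ⟩
      t * (2 * (2 * (2 * X)))  ∎
      where
      regroup : ∀ X t → 4 * (X * (t + t)) ≡ t * (2 * (2 * (2 * X)))
      regroup = solve-∀
    sampleSize≤ : sampleSize k ≤ 2 ^ (j * 2 + 5)
    sampleSize≤ = begin
      4 + 16 * (k * k)
        ≤⟨ +-monoˡ-≤ (16 * (k * k)) (*-mono-≤ {4} {16} (m≤m+n 4 12) (*-mono-≤ (m^n>0 2 j) (m^n>0 2 j))) ⟩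
      16 * (k * k) + 16 * (k * k)
        ≡⟨ double k ⟩
      k ^ 2 * 2 ^ 5
        ≡⟨ cong (_* 2 ^ 5) (^-*-assoc 2 j 2) ⟩
      2 ^ (j * 2) * 2 ^ 5
        ≡⟨ ^-distribˡ-+-* 2 (j * 2) 5 ⟨
      2 ^ (j * 2 + 5) ∎
      where
      double : ∀ k → 16 * (k * k) + 16 * (k * k) ≡ k * (k * 1) * 32
      double = solve-∀
    D≤ : 4 * sampleSize k ^ 4 ≤ 2 ^ densityExponent j
    D≤ = begin
      4 * sampleSize k ^ 4           ≤⟨ *-monoʳ-≤ 4 (^-monoˡ-≤ 4 sampleSize≤) ⟩
      4 * (2 ^ (j * 2 + 5)) ^ 4      ≡⟨ cong (4 *_) (^-*-assoc 2 (j * 2 + 5) 4) ⟩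
      4 * 2 ^ ((j * 2 + 5) * 4)      ≡⟨ *-assoc 2 2 (2 ^ ((j * 2 + 5) * 4)) ⟩
      2 ^ densityExponent j          ∎

-- Rational bounds for expressions in positive reals.

module Reals where

  open import Algebra.Bundles using (CommutativeRing)
  open import Data.Empty using (⊥-elim)
  open import Data.Integer using (+_)
  import Data.Integer as ℤ
  import Data.Integer.Properties as ℤ
  open import Data.Integer.Tactic.RingSolver using (solve-∀)
  import Data.Nat as ℕ
  import Data.Nat.Properties as ℕ
  open import Data.Product using (∃-syntax; _×_; _,_)
  open import Data.Rational hiding (NonZero)
  open import Data.Rational.Properties
  open import Data.Rational.Solver using (module +-*-Solver)
  import Data.Rational.Unnormalised as ℚᵘ
  import Data.Rational.Unnormalised.Properties as ℚᵘ
  open import Algebra.Properties.CommutativeSemiring.Exp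
    (CommutativeRing.commutativeSemiring +-*-commutativeRing) using (_^_)
  open import Data.Sum using (inj₁; inj₂)
  open import Relation.Binary.PropositionalEquality
  open RationalLemmas hiding (*-mono-≤)
  open ℝ⁺ using (Lower; Upper)
  open +-*-Solver using (_:*_; _:+_; _:=_; con)

  ⌜_⌝ : ℕ → ℚ
  ⌜ a ⌝ = + a / 1

  ⌜⌝-* : ∀ a b → ⌜ a ⌝ * ⌜ b ⌝ ≡ ⌜ a ℕ.* b ⌝
  ⌜⌝-* a b = toℚᵘ-injective (ℚᵘ.≃-trans (toℚᵘ-homo-* ⌜ a ⌝ ⌜ b ⌝)
    (ℚᵘ.≃-trans (ℚᵘ.*-cong (/≃ a 0) (/≃ b 0))
      (ℚᵘ.≃-trans (ℚᵘ.*≡* (cong (ℤ._* + 1) (sym (ℤ.pos-* a b)))) (ℚᵘ.≃-sym (/≃ (a ℕ.* b) 0)))))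

  ⌜⌝-+ : ∀ a b → ⌜ a ⌝ + ⌜ b ⌝ ≡ ⌜ a ℕ.+ b ⌝
  ⌜⌝-+ a b = toℚᵘ-injective (ℚᵘ.≃-trans (toℚᵘ-homo-+ ⌜ a ⌝ ⌜ b ⌝)
    (ℚᵘ.≃-trans (ℚᵘ.+-cong (/≃ a 0) (/≃ b 0))
      (ℚᵘ.≃-trans (ℚᵘ.*≡* (cong (ℤ._* + 1) (units (+ a) (+ b)))) (ℚᵘ.≃-sym (/≃ (a ℕ.+ b) 0)))))
    where
    units : ∀ a b → a ℤ.* + 1 ℤ.+ b ℤ.* + 1 ≡ a ℤ.+ b
    units = solve-∀

  ⌜⌝-mono-< : ∀ a b → a ℕ.< b → ⌜ a ⌝ < ⌜ b ⌝
  ⌜⌝-mono-< a b a<b = /-<⇐ {a} {0} {b} {0} (ℕ.*-monoˡ-< 1 a<b)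

  ⌜⌝-cancel-≤ : ∀ a b → ⌜ a ⌝ ≤ ⌜ b ⌝ → a ℕ.≤ b
  ⌜⌝-cancel-≤ a b a≤b = ℕ.≮⇒≥ λ b<a → <-irrefl refl (<-≤-trans (⌜⌝-mono-< b a b<a) a≤b)

  2^≡ : ∀ a → 2ℚ ^ a ≡ ⌜ 2 ℕ.^ a ⌝
  2^≡ zero    = refl
  2^≡ (suc a) = trans (cong (2ℚ *_) (2^≡ a)) (⌜⌝-* 2 (2 ℕ.^ a))

  ½^*2^ : ∀ a → ½ ^ a * 2ℚ ^ a ≡ 1ℚ
  ½^*2^ zero    = refl
  ½^*2^ (suc a) = trans (+-*-Solver.solve 2 (λ x y → con ½ :* x :* (con 2ℚ :* y) := x :* y) refl (½ ^ a) (2ℚ ^ a)) (½^*2^ a)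

  0<½ : 0ℚ < ½
  0<½ = positive⁻¹ ½

  ½^-step : ∀ a → ½ ^ suc a < ½ ^ a
  ½^-step a = subst (½ ^ suc a <_) (*-identityˡ (½ ^ a))
    (*-monoˡ-<-pos (½ ^ a) {{positive (^-pos 0<½ a)}} {½} {1ℚ} (*<* (ℤ.+<+ (ℕ.s≤s (ℕ.s≤s ℕ.z≤n)))))

  lower-+ : ∀ x y {q r} → Lower x q → Lower y r → Lower (x +ʳ y) (q + r)
  lower-+ x y {q} {r} lq lr with ℝ⁺.lower-open x lq
  ... | q′ , q<q′ , lq′ = q′ + r , +-monoˡ-< r q<q′ , q′ , r , lq′ , lr , ≤-refl

  lower-* : ∀ x y {q r} → 0ℚ < q → 0ℚ < r → Lower x q → Lower y r → Lower (x *ʳ y) (q * r)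
  lower-* x y {q} {r} 0<q 0<r lq lr with ℝ⁺.lower-open x lq
  ... | q′ , q<q′ , lq′ = q′ * r , *-monoˡ-<-pos r {{positive 0<r}} q<q′ ,
                          q′ , r , <-trans 0<q q<q′ , 0<r , lq′ , lr , ≤-refl

  -- Lower cuts are open, so a larger witness than `q` is required. An upper bound `s` of `x`
  -- strictly below `u` leaves the room: `q` may be multiplied by the ratio of 1 to q s.
  lower-⁻¹ : ∀ x {q u} → 0ℚ < q → Upper x u → q * u ≤ 1ℚ → Lower (x ⁻¹) q
  lower-⁻¹ x {q} {u} 0<q xu qu≤1 with ℝ⁺.upper-open x xu
  ... | s , s<u , xs with ratio (*-pos 0<q (CutLemmas.0<upper x xs))
                               (<-≤-trans (*-monoʳ-<-pos q {{positive 0<q}} s<u) qu≤1)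
  ... | ρ , 1<ρ , qsρ≡1 = q * ρ , p<p*ρ 0<q 1<ρ , s , xs ,
    ≤-reflexive (trans (+-*-Solver.solve 3 (λ q ρ s → q :* ρ :* s := q :* s :* ρ) refl q ρ s) qsρ≡1)

  lower-2^ : ∀ x a {q} → Lower x ⌜ a ⌝ → q < 2ℚ ^ a → Lower (2^ x) q
  lower-2^ x a la q< = 2ℚ ^ a , q< , a , 0 , ^-pos 0<2 a , la , ≤-reflexive (*-identityʳ (2ℚ ^ a))

  lower-log₂ : ∀ x (1<x : 1ʳ <ʳ x) a {q} → Lower x (2ℚ ^ a) → q < ⌜ a ⌝ → Lower (log₂ x 1<x) q
  lower-log₂ x 1<x a la q< = ⌜ a ⌝ , q< , 2ℚ ^ a , a , 0 , ^-pos 0<2 a , la ,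
    ≤-reflexive (sym (*-identityʳ (2ℚ ^ a))) , ≤-refl

  -- Since 1 is not in its own open lower cut, `½` takes its place; the factors 1 then preserve it.
  lower-^ : ∀ x → Lower x 1ℚ → ∀ m → Lower (x ^ʳ m) ½
  lower-^ x l zero    = *<* (ℤ.+<+ (ℕ.s≤s (ℕ.s≤s ℕ.z≤n)))
  lower-^ x l (suc m) = lower-* x (x ^ʳ m) 0<1 0<½ l (lower-^ x l m)

  ≤ᴺ-power : ∀ x a n → Lower x ⌜ a ⌝ → 2^ x ≤ᴺ n → 2 ℕ.^ a ℕ.≤ n
  ≤ᴺ-power x a n la le = ℕ.≮⇒≥ λ n<2^a → absurd (dense (subst (⌜ n ⌝ <_) (sym (2^≡ a)) (⌜⌝-mono-< n (2 ℕ.^ a) n<2^a)))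
    where
    absurd : ∃[ q ] (⌜ n ⌝ < q × q < 2ℚ ^ a) → _
    absurd (q , n<q , q<2^a) = <-irrefl refl (<-≤-trans n<q (le q (lower-2^ x a la q<2^a)))

  -- If d < q n, some `r` lies strictly between d/q and `n`; then q r is a lower bound of the
  -- product exceeding `d`. The maximum with 0 provides the positive `r` that `lower-*` expects.
  ≤ᴺ-product : ∀ x q n d .{{_ : NonZero n}} → 0ℚ < q → Lower x q → (x *ʳ fromℕ n) ≤ᴺ d → q * ⌜ n ⌝ ≤ ⌜ d ⌝
  ≤ᴺ-product x q n d 0<q lq le = ≮⇒≥ λ d<qn → absurd d<qn (ratio⁻ 0<q ⌜ d ⌝)
    where
    absurd : ⌜ d ⌝ < q * ⌜ n ⌝ → ∃[ v ] v * q ≡ ⌜ d ⌝ → _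
    absurd d<qn (v , vq≡d) with dense v⊔0<n
      where
      0<n : 0ℚ < ⌜ n ⌝
      0<n = ⌜⌝-mono-< 0 n (ℕ.>-nonZero⁻¹ n)
      v<n : v < ⌜ n ⌝
      v<n = *-cancelʳ-<-nonNeg q {{0<⇒nonNeg 0<q}} (subst₂ _<_ (sym vq≡d) (*-comm q ⌜ n ⌝) d<qn)
      v⊔0<n : v ⊔ 0ℚ < ⌜ n ⌝
      v⊔0<n = ⊔-lub-< v<n 0<n
        where
        ⊔-lub-< : ∀ {a b c} → a < c → b < c → a ⊔ b < c
        ⊔-lub-< {a} {b} {c} a<c b<c with ⊔-sel a b
        ... | inj₁ e = subst (_< c) (sym e) a<c
        ... | inj₂ e = subst (_< c) (sym e) b<c
    ... | r , v⊔0<r , r<n = <-irrefl refl (begin-strict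
      ⌜ d ⌝   ≡⟨ vq≡d ⟨
      v * q   ≡⟨ *-comm v q ⟩
      q * v   <⟨ *-monoʳ-<-pos q {{positive 0<q}} (≤-<-trans (p≤p⊔q v 0ℚ) v⊔0<r) ⟩
      q * r   ≤⟨ le (q * r) (lower-* x (fromℕ n) 0<q (≤-<-trans (p≤q⊔p v 0ℚ) v⊔0<r) lq r<n) ⟩
      ⌜ d ⌝   ∎)
      where open ≤-Reasoning

  -- Locatedness only decides between two distinct rationals, so `ε` is caught in a window of ratio
  -- 4 rather than 2. Some power of ½ below a positive lower bound of `ε` bounds the search.
  dyadicBracket : ∀ ε → Upper ε (½ ^ 2) → ∃[ i ] (Upper ε (½ ^ (2 ℕ.+ i)) × Lower ε (½ ^ (4 ℕ.+ i)))
  dyadicBracket ε upper = start (ℝ⁺.lower-open ε (ℝ⁺.0-lower ε))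
    where
    search : ∀ fuel i → Upper ε (½ ^ (2 ℕ.+ i)) → Lower ε (½ ^ (2 ℕ.+ (fuel ℕ.+ i))) →
             ∃[ i ] (Upper ε (½ ^ (2 ℕ.+ i)) × Lower ε (½ ^ (4 ℕ.+ i)))
    search zero       i u l = ⊥-elim (ℝ⁺.disjoint ε l u)
    search (suc fuel) i u l with ℝ⁺.located ε (½^-step (3 ℕ.+ i))
    ... | inj₁ l′ = i , u , l′
    ... | inj₂ u′ = search fuel (suc i) u′ (subst (λ m → Lower ε (½ ^ (2 ℕ.+ m))) (sym (ℕ.+-suc fuel i)) l)
    start : ∃[ s ] (0ℚ < s × Lower ε s) → _
    start (s , 0<s , ls) with ratio⁻ 0<s 1ℚ
    ... | v , vs≡1 with archimedes 1<2 v
    ... | m , v<2^m = search m 0 upper (ℝ⁺.lower-closed ε (begin-strict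
        ½ ^ e              ≡⟨ trans (cong (½ ^ e *_) vs≡1) (*-identityʳ (½ ^ e)) ⟨
        ½ ^ e * (v * s)    <⟨ *-monoʳ-<-pos (½ ^ e) {{positive (^-pos 0<½ e)}} (*-monoˡ-<-pos s {{positive 0<s}}
                                (<-≤-trans v<2^m (^-monoʳ-≤ 1<2 (ℕ.≤-trans (ℕ.m≤m+n m 0) (ℕ.m≤n+m (m ℕ.+ 0) 2))))) ⟩
        ½ ^ e * (2ℚ ^ e * s) ≡⟨ trans (sym (*-assoc (½ ^ e) (2ℚ ^ e) s)) (trans (cong (_* s) (½^*2^ e)) (*-identityˡ s)) ⟩
        s                  ∎) ls)
      where
      open ≤-Reasoning
      e = 2 ℕ.+ (m ℕ.+ 0)

-- From the real hypotheses to natural-number inequalities.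

module Thresholds where

  open import Algebra.Bundles using (CommutativeRing)
  open import Data.Fin.Properties using (nonZeroIndex)
  open import Data.Integer using (+_)
  import Data.Integer as ℤ
  import Data.Nat as ℕ
  import Data.Nat.Properties as ℕ
  open import Data.Rational hiding (NonZero)
  open import Data.Rational.Properties
  open import Data.Rational.Solver using (module +-*-Solver)
  open import Algebra.Properties.CommutativeSemiring.Exp
    (CommutativeRing.commutativeSemiring +-*-commutativeRing) using (_^_)
  open import Relation.Binary.PropositionalEquality
  open RationalLemmas hiding (*-mono-≤)
  open ℝ⁺ using (Lower; Upper)
  open +-*-Solver using (_:*_; _:+_; _:-_; _:=_; con)
  open Reals
  open Finite

  -- For 2^-(4+i) < ε < 2^-(2+i) the proof gives C (log₂ (1/ε))⁸ > 536 · (1+i)/2, which exceeds 32 i + 267.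
  C : ℝ⁺
  C = fromℕ 537

  -- The 2 added to `E` provides two factors of 2: one is spent on the open lower cut of `Y`, the
  -- other on replacing `t` by t/2, which lies in the open lower cut of `t`.
  large⇒ : ∀ ε (1<ε⁻¹ : 1ʳ <ʳ ε ⁻¹) i E t n .{{_ : NonZero t}} → Upper ε (½ ^ (2 ℕ.+ i)) →
           2 ℕ.+ E ℕ.< 268 ℕ.* suc i →
           2^ (fromℕ t *ʳ 2^ (C *ʳ log₂ (ε ⁻¹) 1<ε⁻¹ ^ʳ 8)) ≤ᴺ n →
           2 ℕ.^ (t ℕ.* 2 ℕ.^ E) ℕ.≤ n
  large⇒ ε 1<ε⁻¹ i E t n upper E< = ≤ᴺ-power (fromℕ t *ʳ Y) (t ℕ.* 2 ℕ.^ E) n (subst (Lower (fromℕ t *ʳ Y)) product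
      (lower-* (fromℕ t) Y (*-pos 0<t 0<½) (^-pos 0<2 (suc E)) t½<t lowerY))
    where
    L X Y : ℝ⁺
    L = log₂ (ε ⁻¹) 1<ε⁻¹
    X = C *ʳ L ^ʳ 8
    Y = 2^ X
    0<t : 0ℚ < ⌜ t ⌝
    0<t = ⌜⌝-mono-< 0 t (ℕ.>-nonZero⁻¹ t)
    0<1+i : 0ℚ < ⌜ suc i ⌝
    0<1+i = ⌜⌝-mono-< 0 (suc i) (ℕ.s≤s ℕ.z≤n)
    ½<1 : ½ < 1ℚ
    ½<1 = *<* (ℤ.+<+ (ℕ.s≤s (ℕ.s≤s ℕ.z≤n)))
    t½<t : ⌜ t ⌝ * ½ < ⌜ t ⌝
    t½<t = subst (⌜ t ⌝ * ½ <_) (*-identityʳ ⌜ t ⌝) (*-monoʳ-<-pos ⌜ t ⌝ {{positive 0<t}} ½<1)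
    lowerε⁻¹ : Lower (ε ⁻¹) (2ℚ ^ (2 ℕ.+ i))
    lowerε⁻¹ = lower-⁻¹ ε (^-pos 0<2 (2 ℕ.+ i)) upper
      (≤-reflexive (trans (*-comm (2ℚ ^ (2 ℕ.+ i)) (½ ^ (2 ℕ.+ i))) (½^*2^ (2 ℕ.+ i))))
    lowerL : ∀ a → a ℕ.< 2 ℕ.+ i → Lower L ⌜ a ⌝
    lowerL a a< = lower-log₂ (ε ⁻¹) 1<ε⁻¹ (2 ℕ.+ i) lowerε⁻¹ (⌜⌝-mono-< a (2 ℕ.+ i) a<)
    -- One factor of the eighth power is bounded by 1 + i and the other seven only by 1: growth
    -- linear in `i` is enough.
    lowerL⁸ : Lower (L ^ʳ 8) (⌜ suc i ⌝ * ½)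
    lowerL⁸ = lower-* L (L ^ʳ 7) 0<1+i 0<½ (lowerL (suc i) (ℕ.n<1+n (suc i)))
                (lower-^ L (lowerL 1 (ℕ.s≤s (ℕ.s≤s ℕ.z≤n))) 7)
    536/2 : ⌜ 536 ⌝ * (⌜ suc i ⌝ * ½) ≡ ⌜ 268 ℕ.* suc i ⌝
    536/2 = trans (+-*-Solver.solve 1 (λ x → con ⌜ 536 ⌝ :* (x :* con ½) := con ⌜ 268 ⌝ :* x) refl ⌜ suc i ⌝)
                  (⌜⌝-* 268 (suc i))
    lowerX : Lower X ⌜ 2 ℕ.+ E ⌝
    lowerX = ℝ⁺.lower-closed X (subst (⌜ 2 ℕ.+ E ⌝ <_) (sym 536/2) (⌜⌝-mono-< (2 ℕ.+ E) (268 ℕ.* suc i) E<))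
      (lower-* C (L ^ʳ 8) (⌜⌝-mono-< 0 536 (ℕ.s≤s ℕ.z≤n)) (*-pos 0<1+i 0<½)
        (⌜⌝-mono-< 536 537 (ℕ.n<1+n 536)) lowerL⁸)
    lowerY : Lower Y (2ℚ ^ suc E)
    lowerY = lower-2^ X (2 ℕ.+ E) lowerX (^-step 1<2 (suc E))
    product : ⌜ t ⌝ * ½ * 2ℚ ^ suc E ≡ ⌜ t ℕ.* 2 ℕ.^ E ⌝
    product = trans (+-*-Solver.solve 2 (λ t p → t :* con ½ :* (con 2ℚ :* p) := t :* p) refl ⌜ t ⌝ (2ℚ ^ E))
      (trans (cong (⌜ t ⌝ *_) (2^≡ E)) (⌜⌝-* t (2 ℕ.^ E)))

  balanced⇒ : ∀ {n} (G : ColouredK n) ε i → Lower ε (½ ^ (4 ℕ.+ i)) → LocallyBalanced (¼ +ʳ ε) G →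
              Balanced G (2 ℕ.^ (5 ℕ.+ i))
  balanced⇒ {n} G ε i lower balanced v c = ⌜⌝-cancel-≤ ((k ℕ.+ 4) ℕ.* n) (4 ℕ.* k ℕ.* degree G c v) (begin
      ⌜ (k ℕ.+ 4) ℕ.* n ⌝
        ≡⟨ trans (cong (_* ⌜ n ⌝) (⌜⌝-+ k 4)) (⌜⌝-* (k ℕ.+ 4) n) ⟨
      (⌜ k ⌝ + ⌜ 4 ⌝) * ⌜ n ⌝
        ≡⟨ cong (λ z → (⌜ k ⌝ + ⌜ 4 ⌝ * z) * ⌜ n ⌝) (trans (cong (½ ^ (5 ℕ.+ i) *_) (sym (2^≡ (5 ℕ.+ i)))) (½^*2^ (5 ℕ.+ i))) ⟨
      (⌜ k ⌝ + ⌜ 4 ⌝ * (½ * w * ⌜ k ⌝)) * ⌜ n ⌝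
        ≡⟨ +-*-Solver.solve 3 (λ k w n → (k :+ con ⌜ 4 ⌝ :* (con ½ :* w :* k)) :* n :=
             con ⌜ 4 ⌝ :* k :* ((con (+ 1 / 4) :- con ½ :* w :+ w) :* n)) refl ⌜ k ⌝ w ⌜ n ⌝ ⟩
      ⌜ 4 ⌝ * ⌜ k ⌝ * (q * ⌜ n ⌝)
        ≤⟨ *-monoˡ-≤-nonNeg (⌜ 4 ⌝ * ⌜ k ⌝) {{0<⇒nonNeg (*-pos (⌜⌝-mono-< 0 4 (ℕ.s≤s ℕ.z≤n)) (⌜⌝-mono-< 0 k (ℕ.m^n>0 2 (5 ℕ.+ i))))}}
             (≤ᴺ-product (¼ +ʳ ε) q n (degree G c v) {{nonZeroIndex v}} 0<q lower-q (balanced v c)) ⟩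
      ⌜ 4 ⌝ * ⌜ k ⌝ * ⌜ degree G c v ⌝
        ≡⟨ trans (cong (_* ⌜ degree G c v ⌝) (⌜⌝-* 4 k)) (⌜⌝-* (4 ℕ.* k) (degree G c v)) ⟩
      ⌜ 4 ℕ.* k ℕ.* degree G c v ⌝ ∎)
    where
    open ≤-Reasoning
    k : ℕ
    k = 2 ℕ.^ (5 ℕ.+ i)
    w q : ℚ
    w = ½ ^ (4 ℕ.+ i)
    -- This is ¼ + w/2 with w/2 = 1/k, and ¼ + 1/k = (k+4)/(4k). It is written as (¼ - w/2) + w
    -- since `w` lies below `ε`, whereas ¼ itself is not in its open lower cut.
    q = + 1 / 4 - ½ * w + w
    0<w : 0ℚ < w
    0<w = ^-pos 0<½ (4 ℕ.+ i)
    0<½w : 0ℚ < ½ * w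
    0<½w = *-pos 0<½ 0<w
    0<q : 0ℚ < q
    0<q = subst (0ℚ <_) (+-*-Solver.solve 1 (λ w → con (+ 1 / 4) :+ con ½ :* w := con (+ 1 / 4) :- con ½ :* w :+ w) refl w)
      (+-mono-< (positive⁻¹ (+ 1 / 4)) 0<½w)
    lower-q : Lower (¼ +ʳ ε) q
    lower-q = lower-+ ¼ ε (subst (+ 1 / 4 - ½ * w <_) (+-identityʳ (+ 1 / 4))
      (+-monoʳ-< (+ 1 / 4) (neg-antimono-< 0<½w))) lower

theorem1p3 : Σ[ C ∈ ℝ⁺ ] ((ε : ℝ⁺) (ε<¼ : ε <ʳ ¼) (t : ℕ) .{{_ : NonZero t}} (n : ℕ) →
    2^ (fromℕ t *ʳ 2^ (C *ʳ log₂ (ε ⁻¹) (1<x⁻¹ ε ε<¼) ^ʳ 8)) ≤ᴺ n →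
    (G : ColouredK n) → LocallyBalanced (¼ +ʳ ε) G →
    Σ[ A ∈ Subset n ] Σ[ B ∈ Subset n ] Σ[ c ∈ Colour ]
    (∣ A ∣ ≡ t × ∣ B ∣ ≡ t × Disjoint A B ×
    AllInside G c A × AllInside G c B × AllBetween G (opposite c) A B))
theorem1p3 = C , main
  where
  open import Data.Nat using (_+_; _*_; _<_)
  import Data.Nat.Properties as ℕ
  open import Data.Nat.Tactic.RingSolver using (solve-∀)
  open import Data.Product using (∃-syntax; _,_)
  open import Algebra.Bundles using (CommutativeRing)
  open import Data.Rational using (½)
  open import Data.Rational.Properties using (+-*-commutativeRing)
  open import Algebra.Properties.CommutativeSemiring.Exp
    (CommutativeRing.commutativeSemiring +-*-commutativeRing) using (_^_)
  open import Relation.Binary.PropositionalEquality using (trans; cong)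
  open Thresholds
  open Reals using (dyadicBracket)
  open Finite using (exponent; densityExponent; splits-pow)
  exponent< : ∀ i → 2 + exponent (5 + i) < 268 * suc i
  exponent< i = begin-strict
    2 + exponent (5 + i)       ≡⟨ normalise i ⟩
    i * 32 + 267               <⟨ ℕ.+-mono-≤-< (ℕ.*-monoʳ-≤ i (ℕ.m≤m+n 32 236)) (ℕ.n<1+n 267) ⟩
    i * 268 + 268              ≡⟨ denormalise i ⟩
    268 * suc i                ∎
    where
    open ℕ.≤-Reasoning
    normalise : ∀ i → 2 + exponent (5 + i) ≡ i * 32 + 267
    normalise i = trans (cong (5 +_) (sumOfExponents (densityExponent (5 + i)))) (linear i)
      where
      -- The four levels of the blow-up contribute d, d+1, d+2 and d+3, each with an additional 2.
      sumOfExponents : ∀ d → 2 + (3 + d + (2 + (2 + d + (2 + (1 + d + (2 + (d + 0))))))) ≡ d * 4 + 14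
      sumOfExponents = solve-∀
      linear : ∀ i → 5 + ((2 + ((5 + i) * 2 + 5) * 4) * 4 + 14) ≡ i * 32 + 267
      linear = solve-∀
    denormalise : ∀ i → i * 268 + 268 ≡ 268 * (1 + i)
    denormalise = solve-∀
  main : (ε : ℝ⁺) (ε<¼ : ε <ʳ ¼) (t : ℕ) .{{_ : NonZero t}} (n : ℕ) →
    2^ (fromℕ t *ʳ 2^ (C *ʳ log₂ (ε ⁻¹) (1<x⁻¹ ε ε<¼) ^ʳ 8)) ≤ᴺ n →
    (G : ColouredK n) → LocallyBalanced (¼ +ʳ ε) G → Split G t
  -- `½ ^ 2` evaluates to ¼, so the hypothesis on `ε` is the starting upper bound of the search.
  main ε ε<¼@(q , uq , q<¼) t n large G balanced = finish (dyadicBracket ε (ℝ⁺.upper-closed ε q<¼ uq))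
    where
    finish : ∃[ i ] (ℝ⁺.Upper ε (½ ^ (2 + i)) × ℝ⁺.Lower ε (½ ^ (4 + i))) → Split G t
    finish (i , upper , lower) = splits-pow G (5 + i) t (balanced⇒ G ε i lower balanced)
      (large⇒ ε (1<x⁻¹ ε ε<¼) i (exponent (5 + i)) t n upper (exponent< i) large)
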